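{- For a prime power $q$, a positive integer $\Delta$ and a positive integer $n$, let $\Gamma_q(\Delta,n)$ denote the minimum of $\gamma_1(\mathcal{M})$ over all $\Delta$-divisible multisets of points $\mathcal{M}$ in $\mathrm{PG}(v-1,q)$ with cardinality $n$, where $v$ may be chosen arbitrarily large; if no such multiset of points exists for any $v$, set $\Gamma_q(\Delta,n)=\infty$. Then: \begin{itemize} \item $\Gamma_2(2,1)=\infty$, $\Gamma_2(4,n)=\infty$ for $n\in\{1,2,3,5,9\}$, and $\Gamma_2(8,n)=\infty$ for $n\in\{1,2,3,4,5,6,7,9,10,11,13,17,18,19,21,25,33\}$. \item $\Gamma_2(2,n)=1$ iff $n\ge 3$; $\Gamma_2(4,n)=1$ iff $n\in\{7,8\}$ or $n\ge 14$; and $\Gamma_2(8,n)=1$ iff $n\in\{15,16,30,31,32,45,46,47,48,49,50,51\}$ or $n\ge 60$. \item $\Gamma_2(2,2)=2$, $\Gamma_2(4,n)=2$ for $n\in\{6,10,12,13\}$, and $\Gamma_2(8,n)=2$ for $n\in\{14,28,29,34,36,38,40,42,43,44,52,53,54,55,56,57,58,59\}$. \item $\Gamma_2(4,n)=4$ for $n\in\{4,11\}$ and $\Gamma_2(8,n)=4$ for $n\in\{12,20,24,26,27,35,39,41\}$. \item $\Gamma_2(8,n)=8$ for $n\in\{8,22,23,37\}$. \end{itemize}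
   Context: For a prime power $q$, $\mathrm{PG}(v-1,q)$ is the projective geometry of $\mathbb{F}_q^v$; its points are the $1$-dimensional subspaces and its hyperplanes the $(v-1)$-dimensional subspaces. A multiset of points $\mathcal{M}$ assigns to each point $P$ a multiplicity $\mathcal{M}(P)\in\{0,1,2,\dots\}$; for a subspace $K$ put $\mathcal{M}(K)=\sum_{P\le K}\mathcal{M}(P)$, and the cardinality is $\#\mathcal{M}=\mathcal{M}(\mathbb{F}_q^v)$. $\mathcal{M}$ is $\Delta$-divisible if $\mathcal{M}(H)\equiv \#\mathcal{M}\pmod{\Delta}$ for every hyperplane $H$ (equivalently, the associated linear code whose generator matrix has the points of $\mathcal{M}$, with multiplicity, as columns has all weights divisible by $\Delta$). $\gamma_1(\mathcal{M})=\max_P \mathcal{M}(P)$ is the maximum point multiplicity. -}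

module Defs where

open import Data.Bool using (Bool; true; false; _∧_; _xor_; if_then_else_)
open import Data.Nat using (ℕ; zero; suc; _+_; _∸_; _≤_; _⊔_)
open import Data.Nat.Divisibility using (_∣_)
open import Data.Vec using (Vec; replicate; zipWith; foldr)
open import Data.Vec.Properties using (≡-dec)
open import Data.Bool.Properties using () renaming (_≟_ to _≟B_)
open import Data.List using (List; []; _∷_; length; map)
open import Data.List.Relation.Unary.All using (All)
open import Data.Product using (Σ; _×_; _,_)
open import Data.Empty using (⊥)
open import Relation.Binary.PropositionalEquality using (_≡_)
open import Relation.Nullary using (¬_; yes; no)

-- The field F_2 is modelled by Bool (addition = xor, multiplication = ∧).
-- Vectors of F_2^v.
F2^ : ℕ → Set
F2^ v = Vec Bool v

zeroVec : ∀ v → F2^ v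
zeroVec v = replicate v false

-- Points of PG(v-1,2): 1-dimensional subspaces of F_2^v, i.e. nonzero vectors
-- (over F_2 each 1-dim subspace has exactly one nonzero vector).
IsPoint : ∀ {v} → F2^ v → Set
IsPoint {v} x = ¬ (x ≡ zeroVec v)

dot : ∀ {v} → F2^ v → F2^ v → Bool
dot h x = foldr _ _xor_ false (zipWith _∧_ h x)

-- Hyperplanes of F_2^v are exactly the kernels of nonzero linear functionals;
-- a hyperplane is given by a nonzero h, and H_h = { x | h · x = 0 }.
InHyperplane : ∀ {v} → F2^ v → F2^ v → Set
InHyperplane h x = dot h x ≡ false

-- A multiset of points in PG(v-1,2), given as a list of points (repetitions =
-- multiplicity), i.e. the columns of a generator matrix.
record Multiset (v : ℕ) : Set where
  constructor mkMultiset
  field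
    elems  : List (F2^ v)
    points : All IsPoint elems
open Multiset public

countB : ∀ {A : Set} → (A → Bool) → List A → ℕ
countB p [] = 0
countB p (x ∷ xs) = (if p x then 1 else 0) + countB p xs

eqVec : ∀ {v} → F2^ v → F2^ v → Bool
eqVec x y with ≡-dec _≟B_ x y
... | yes _ = true
... | no _ = false

mult : ∀ {v} → Multiset v → F2^ v → ℕ
mult M P = countB (eqVec P) (elems M)

card : ∀ {v} → Multiset v → ℕ
card M = length (elems M)

multH : ∀ {v} → Multiset v → F2^ v → ℕ
multH M h = countB (λ x → if dot h x then false else true) (elems M)

-- γ₁(M) = max_P M(P)  (points not in the list have multiplicity 0)
maxList : List ℕ → ℕ
maxList [] = 0
maxList (x ∷ xs) = x ⊔ maxList xs

γ₁ : ∀ {v} → Multiset v → ℕ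
γ₁ M = maxList (map (mult M) (elems M))

-- Δ-divisible: M(H) ≡ #M (mod Δ) for every hyperplane H
-- (M(H) ≤ #M always, so this is Δ ∣ #M − M(H)).
Divisible : ℕ → ∀ {v} → Multiset v → Set
Divisible Δ {v} M = (h : F2^ v) → ¬ (h ≡ zeroVec v) → Δ ∣ (card M ∸ multH M h)

GammaIs : ℕ → ℕ → ℕ → Set
GammaIs Δ n g =
  Σ ℕ (λ v → Σ (Multiset v) (λ M → Divisible Δ M × card M ≡ n × γ₁ M ≡ g))
  × (∀ v (M : Multiset v) → Divisible Δ M → card M ≡ n → g ≤ γ₁ M)

GammaInf : ℕ → ℕ → Set
GammaInf Δ n = ∀ v (M : Multiset v) → Divisible Δ M → card M ≡ n → ⊥

{-# OPTIONS --safe #-}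
module Submission where

-- A multiset of points is a function M on F₂^v with M(0) = 0, studied through its Fourier transform
-- x(h) = ∑ M(P)(-1)^(h·P) = n - 2w(h), where w(h) is the weight of the codeword h. Since M restricted
-- to a hyperplane is Δ/2-divisible, only few values x are possible, and the mean over h of a quadratic
-- or cubic polynomial in x that is nonnegative on them is controlled by ∑ M² and ∑ M(P)M(Q)M(P+Q).
-- This excludes most sizes. For the others three further ideas are used.
-- (1) If a multiple of Δ is reached by giving weight to the origin, any point may be made the origin,
-- so a point of multiplicity m yields a multiset with m points fewer.
-- (2) For Δ = 2^k the points of odd multiplicity (with the origin, if n is odd) form a codeword of
-- RM(v-k-1,v): there are none or at least 2^(k+1), and in dimension k+2 they are a hyperplane or everything.
-- (3) Projection from a suitable point lowers the dimension without creating large multiplicities.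
-- Size 37 then reduces to dimension 5, and 39 and 41 reduce to 37. A projective set of size 59 reduces
-- to dimension 10, where the weight distribution is nearly determined; self-orthogonality of the code on
-- the support of a word of weight 16 excludes such words, and a fourth moment excludes weight 40.

open import Defs
open import Data.Bool using (Bool; true; false; _∧_; _∨_; _xor_; not; if_then_else_; T)
open import Data.Bool.Properties using (xor-comm; xor-assoc; xor-same; xor-identityʳ) renaming (_≟_ to _≟B_)
open import Data.Nat as ℕ using (ℕ; zero; suc)
import Data.Nat.Properties as ℕ
import Data.Nat.DivMod as ℕ
import Data.Nat.Divisibility as ℕ∣
open import Data.Integer using (ℤ; +_; -[1+_]; _+_; _*_; _-_; -_; _≤_; _<_; 0ℤ; 1ℤ; +≤+; -≤+; nonNegative; ∣_∣)
import Data.Integer.Properties as ℤ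
open import Data.Integer.Divisibility.Signed using (_∣_; divides; ∣ᵤ⇒∣)
open import Data.Integer.Tactic.RingSolver using (solve-∀)
open import Data.List using (List; []; _∷_; length; map; _++_)
import Data.List.Properties as List
open import Data.List.Relation.Unary.All using (All; []; _∷_)
import Data.List.Relation.Unary.All as All
import Data.List.Relation.Unary.All.Properties as All
open import Data.List.Relation.Unary.Any using (here; there)
open import Data.List.Membership.Propositional using (_∈_)
open import Data.Vec using ([]; _∷_; zipWith)
import Data.Vec
open import Data.Vec.Properties using (≡-dec)
open import Data.Product using (∃; _×_; _,_; proj₁; proj₂)
open import Data.Sum using (_⊎_; inj₁; inj₂; [_,_]′)
open import Data.Empty using (⊥; ⊥-elim)
open import Data.Unit using (⊤; tt)
open import Function.Bundles using (_⇔_; mk⇔)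
open import Relation.Nullary using (¬_; yes; no; Dec; does)
open import Relation.Nullary.Decidable using (_×-dec_; ¬?)
open import Relation.Binary.PropositionalEquality using (_≡_; refl; sym; trans; cong; cong₂; subst; subst₂; module ≡-Reasoning)

-- Vectors and characters of F₂^v

-- The dimension is not bounded in advance, so an argument in one fixed dimension needs projections
-- that keep the multiplicities under control. A suitable centre exists once 2^v exceeds a count of
-- bad centres, and this count decides which dimension can be reached: 5 for 37 points and 10 for
-- 59. Small dimension matters for 59 because (x - 11)(x + 5) sums to 4 · 2^v, of which the zero
-- word takes 3072: for v = 10 almost nothing is left, for larger v a lot. For 41 points no target
-- dimension is fixed: as long as there is no triple point the moments force 2^v ≥ 512, so one can
-- project until a triple point appears. Making it the origin directly would first require weight 7
-- at the origin, and would lead to 45 points, which do exist; hence the detour through a projection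
-- from a point of the multiset, after which the total can be lowered to 40. Lower bounds 2, 4 and 8
-- on Γ come from excluding maximum multiplicity 1, 3 and 7.

infixl 6 _⊕_
_⊕_ : ∀ {v} → F2^ v → F2^ v → F2^ v
_⊕_ = zipWith _xor_

⊕-comm : ∀ {v} (x y : F2^ v) → x ⊕ y ≡ y ⊕ x
⊕-comm [] [] = refl
⊕-comm (a ∷ x) (b ∷ y) = cong₂ _∷_ (xor-comm a b) (⊕-comm x y)

⊕-assoc : ∀ {v} (x y z : F2^ v) → x ⊕ y ⊕ z ≡ x ⊕ (y ⊕ z)
⊕-assoc [] [] [] = refl
⊕-assoc (a ∷ x) (b ∷ y) (c ∷ z) = cong₂ _∷_ (xor-assoc a b c) (⊕-assoc x y z)

⊕-self : ∀ {v} (x : F2^ v) → x ⊕ x ≡ zeroVec v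
⊕-self [] = refl
⊕-self (a ∷ x) = cong₂ _∷_ (xor-same a) (⊕-self x)

⊕-identityʳ : ∀ {v} (x : F2^ v) → x ⊕ zeroVec v ≡ x
⊕-identityʳ [] = refl
⊕-identityʳ (a ∷ x) = cong₂ _∷_ (xor-identityʳ a) (⊕-identityʳ x)

⊕-identityˡ : ∀ {v} (x : F2^ v) → zeroVec v ⊕ x ≡ x
⊕-identityˡ x = trans (⊕-comm (zeroVec _) x) (⊕-identityʳ x)

⊕-cancelʳ : ∀ {v} (x q : F2^ v) → x ⊕ q ⊕ q ≡ x
⊕-cancelʳ x q = trans (⊕-assoc x q q) (trans (cong (x ⊕_) (⊕-self q)) (⊕-identityʳ x))

⊕-zero⇒≡ : ∀ {v} (x y : F2^ v) → x ⊕ y ≡ zeroVec v → x ≡ y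
⊕-zero⇒≡ x y e = trans (sym (⊕-cancelʳ x y)) (trans (cong (_⊕ y) e) (⊕-identityˡ y))

sgn : Bool → ℤ
sgn false = 1ℤ
sgn true = - 1ℤ

χ : ∀ {v} → F2^ v → F2^ v → ℤ
χ h x = sgn (dot h x)

-- Sums over F₂^v, the Fourier transform and convolution

opaque
  -- Opaque because dimensions 5 and 10 occur concretely, where a transparent sum could unfold into
  -- 32 or 1024 terms.
  ∑ : ∀ {v} → (F2^ v → ℤ) → ℤ
  ∑ {zero} f = f []
  ∑ {suc v} f = ∑ (λ x → f (false ∷ x)) + ∑ (λ x → f (true ∷ x))

  ∑-[] : (f : F2^ 0 → ℤ) → ∑ f ≡ f []
  ∑-[] f = refl

  ∑-∷ : ∀ {v} (f : F2^ (suc v) → ℤ) → ∑ f ≡ ∑ (λ x → f (false ∷ x)) + ∑ (λ x → f (true ∷ x))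
  ∑-∷ f = refl

size : ℕ → ℤ
size zero = 1ℤ
size (suc v) = + 2 * size v

hat : ∀ {v} → (F2^ v → ℤ) → F2^ v → ℤ
hat f h = ∑ (λ x → f x * χ h x)

-- Subtraction is addition over F₂, so this is convolution. `conv M M p` counts ordered pairs of
-- points with sum `p`; for `p` nonzero this is twice the number of secants through `p`, with
-- multiplicities.
conv : ∀ {v} → (F2^ v → ℤ) → (F2^ v → ℤ) → F2^ v → ℤ
conv f g p = ∑ (λ q → f q * g (q ⊕ p))

opaque
  unfolding ∑

  ∑-cong : ∀ {v} {f g : F2^ v → ℤ} → (∀ x → f x ≡ g x) → ∑ f ≡ ∑ g
  ∑-cong {zero} e = e []
  ∑-cong {suc v} e = cong₂ _+_ (∑-cong {v} (λ x → e (false ∷ x))) (∑-cong {v} (λ x → e (true ∷ x)))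

  ∑-+ : ∀ {v} (f g : F2^ v → ℤ) → ∑ (λ x → f x + g x) ≡ ∑ f + ∑ g
  ∑-+ {zero} f g = refl
  ∑-+ {suc v} f g = trans
    (cong₂ _+_ (∑-+ {v} (λ x → f (false ∷ x)) (λ x → g (false ∷ x)))
               (∑-+ {v} (λ x → f (true ∷ x)) (λ x → g (true ∷ x))))
    (interchange (∑ {v} (λ x → f (false ∷ x))) (∑ {v} (λ x → g (false ∷ x)))
                 (∑ {v} (λ x → f (true ∷ x))) (∑ {v} (λ x → g (true ∷ x))))
    where interchange : ∀ a b c d → (a + b) + (c + d) ≡ (a + c) + (b + d)
          interchange = solve-∀

  ∑-* : ∀ {v} c (f : F2^ v → ℤ) → ∑ (λ x → c * f x) ≡ c * ∑ f
  ∑-* {zero} c f = refl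
  ∑-* {suc v} c f = trans (cong₂ _+_ (∑-* {v} c (λ x → f (false ∷ x))) (∑-* {v} c (λ x → f (true ∷ x))))
    (sym (ℤ.*-distribˡ-+ c (∑ {v} (λ x → f (false ∷ x))) (∑ {v} (λ x → f (true ∷ x)))))

  ∑-const : ∀ {v} c → ∑ {v} (λ _ → c) ≡ size v * c
  ∑-const {zero} c = sym (ℤ.*-identityˡ c)
  ∑-const {suc v} c = trans (cong₂ _+_ (∑-const {v} c) (∑-const {v} c)) (r (size v) c)
    where r : ∀ s c → s * c + s * c ≡ + 2 * s * c
          r = solve-∀

  ∑-mono : ∀ {v} {f g : F2^ v → ℤ} → (∀ x → f x ≤ g x) → ∑ f ≤ ∑ g
  ∑-mono {zero} e = e []
  ∑-mono {suc v} e = ℤ.+-mono-≤ (∑-mono {v} (λ x → e (false ∷ x))) (∑-mono {v} (λ x → e (true ∷ x)))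

  ∑-translate : ∀ {v} (q : F2^ v) (f : F2^ v → ℤ) → ∑ (λ x → f (x ⊕ q)) ≡ ∑ f
  ∑-translate [] f = refl
  ∑-translate {suc v} (false ∷ q) f =
    cong₂ _+_ (∑-translate q (λ x → f (false ∷ x))) (∑-translate q (λ x → f (true ∷ x)))
  ∑-translate {suc v} (true ∷ q) f = trans
    (cong₂ _+_ (∑-translate q (λ x → f (true ∷ x))) (∑-translate q (λ x → f (false ∷ x))))
    (ℤ.+-comm (∑ {v} (λ x → f (true ∷ x))) (∑ {v} (λ x → f (false ∷ x))))

∑-zero : ∀ {v} → ∑ {v} (λ _ → 0ℤ) ≡ 0ℤ
∑-zero {v} = trans (∑-const {v} 0ℤ) (ℤ.*-zeroʳ (size v))

∑-nonneg : ∀ {v} {f : F2^ v → ℤ} → (∀ x → 0ℤ ≤ f x) → 0ℤ ≤ ∑ f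
∑-nonneg {v} {f} e = subst (_≤ ∑ f) (∑-zero {v}) (∑-mono e)

hat-cong : ∀ {v} {f g : F2^ v → ℤ} → (∀ x → f x ≡ g x) → ∀ h → hat f h ≡ hat g h
hat-cong e h = ∑-cong (λ x → cong (_* χ h x) (e x))

hat-+ : ∀ {v} (f g : F2^ v → ℤ) h → hat (λ x → f x + g x) h ≡ hat f h + hat g h
hat-+ f g h = trans (∑-cong (λ x → ℤ.*-distribʳ-+ (χ h x) (f x) (g x)))
                    (∑-+ (λ x → f x * χ h x) (λ x → g x * χ h x))

sgn-not : ∀ b → sgn (not b) ≡ - 1ℤ * sgn b
sgn-not false = refl
sgn-not true = refl

sgn-xor : ∀ a b → sgn (a xor b) ≡ sgn a * sgn b
sgn-xor false b = sym (ℤ.*-identityˡ (sgn b))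
sgn-xor true b = sgn-not b

hat-[] : (f : F2^ 0 → ℤ) → hat f [] ≡ f []
hat-[] f = trans (∑-[] (λ x → f x * χ [] x)) (ℤ.*-identityʳ (f []))

hat-false : ∀ {v} (f : F2^ (suc v) → ℤ) h →
  hat f (false ∷ h) ≡ hat (λ x → f (false ∷ x)) h + hat (λ x → f (true ∷ x)) h
hat-false f h = ∑-∷ (λ x → f x * χ (false ∷ h) x)

hat-true : ∀ {v} (f : F2^ (suc v) → ℤ) h →
  hat f (true ∷ h) ≡ hat (λ x → f (false ∷ x)) h - hat (λ x → f (true ∷ x)) h
hat-true f h = trans (∑-∷ (λ x → f x * χ (true ∷ h) x)) (cong₂ _+_ (refl {x = hat (λ x → f (false ∷ x)) h}) (trans
  (∑-cong (λ x → trans (cong (f (true ∷ x) *_) (sgn-not (dot h x))) (r (f (true ∷ x)) (χ h x))))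
  (trans (∑-* (- 1ℤ) (λ x → f (true ∷ x) * χ h x)) (ℤ.-1*i≡-i (hat (λ x → f (true ∷ x)) h)))))
  where r : ∀ a b → a * (- 1ℤ * b) ≡ - 1ℤ * (a * b)
        r = solve-∀

dot-zeroˡ : ∀ {v} (x : F2^ v) → dot (zeroVec v) x ≡ false
dot-zeroˡ [] = refl
dot-zeroˡ (_ ∷ x) = dot-zeroˡ x

dot-comm : ∀ {v} (h x : F2^ v) → dot h x ≡ dot x h
dot-comm [] [] = refl
dot-comm (a ∷ h) (b ∷ x) = cong₂ _xor_ (∧-comm′ a b) (dot-comm h x)
  where ∧-comm′ : ∀ a b → a ∧ b ≡ b ∧ a
        ∧-comm′ false false = refl
        ∧-comm′ false true = refl
        ∧-comm′ true false = refl
        ∧-comm′ true true = refl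

dot-zeroʳ : ∀ {v} (h : F2^ v) → dot h (zeroVec v) ≡ false
dot-zeroʳ h = trans (dot-comm h _) (dot-zeroˡ h)

dot-⊕ʳ : ∀ {v} (h x y : F2^ v) → dot h (x ⊕ y) ≡ dot h x xor dot h y
dot-⊕ʳ [] [] [] = refl
dot-⊕ʳ (a ∷ h) (b ∷ x) (c ∷ y) =
  trans (cong ((a ∧ (b xor c)) xor_) (dot-⊕ʳ h x y)) (step a b c (dot h x) (dot h y))
  where
  step : ∀ a b c d e → (a ∧ (b xor c)) xor (d xor e) ≡ ((a ∧ b) xor d) xor ((a ∧ c) xor e)
  step false b c d e = refl
  step true false c d e = trans (sym (xor-assoc c d e)) (trans (cong (_xor e) (xor-comm c d)) (xor-assoc d c e))
  step true true false false false = refl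
  step true true false false true = refl
  step true true false true false = refl
  step true true false true true = refl
  step true true true false false = refl
  step true true true false true = refl
  step true true true true false = refl
  step true true true true true = refl

dot-⊕ˡ : ∀ {v} (h k x : F2^ v) → dot (h ⊕ k) x ≡ dot h x xor dot k x
dot-⊕ˡ h k x = trans (dot-comm (h ⊕ k) x) (trans (dot-⊕ʳ x h k) (cong₂ _xor_ (dot-comm x h) (dot-comm x k)))

χ-⊕ʳ : ∀ {v} (h x y : F2^ v) → χ h (x ⊕ y) ≡ χ h x * χ h y
χ-⊕ʳ h x y = trans (cong sgn (dot-⊕ʳ h x y)) (sgn-xor (dot h x) (dot h y))

hat-0 : ∀ {v} (f : F2^ v → ℤ) → hat f (zeroVec v) ≡ ∑ f
hat-0 f = ∑-cong (λ x → trans (cong (λ b → f x * sgn b) (dot-zeroˡ x)) (ℤ.*-identityʳ (f x)))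

conv-∷ : ∀ {v} (f g : F2^ (suc v) → ℤ) b p → conv f g (b ∷ p) ≡
  conv (λ x → f (false ∷ x)) (λ x → g (b ∷ x)) p + conv (λ x → f (true ∷ x)) (λ x → g (not b ∷ x)) p
conv-∷ f g b p = ∑-∷ (λ q → f q * g (q ⊕ (b ∷ p)))

-- Induction by splitting off the first coordinate: `hat` becomes the sum and the difference of the
-- transforms of the two halves, while `conv` multiplies the halves as in the group ring of a group
-- of order 2.
hat-conv : ∀ {v} (f g : F2^ v → ℤ) h → hat (conv f g) h ≡ hat f h * hat g h
hat-conv f g [] = trans (hat-[] (conv f g)) (trans (∑-[] (λ q → f q * g (q ⊕ [])))
                    (sym (cong₂ _*_ (hat-[] f) (hat-[] g))))
hat-conv {suc v} f g (b ∷ h) = both b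
  where
  f₀ f₁ g₀ g₁ : F2^ v → ℤ
  f₀ x = f (false ∷ x)
  f₁ x = f (true ∷ x)
  g₀ x = g (false ∷ x)
  g₁ x = g (true ∷ x)
  e₀ : hat (λ p → conv f g (false ∷ p)) h ≡ hat f₀ h * hat g₀ h + hat f₁ h * hat g₁ h
  e₀ = trans (hat-cong (conv-∷ f g false) h)
    (trans (hat-+ (conv f₀ g₀) (conv f₁ g₁) h) (cong₂ _+_ (hat-conv f₀ g₀ h) (hat-conv f₁ g₁ h)))
  e₁ : hat (λ p → conv f g (true ∷ p)) h ≡ hat f₀ h * hat g₁ h + hat f₁ h * hat g₀ h
  e₁ = trans (hat-cong (conv-∷ f g true) h)
    (trans (hat-+ (conv f₀ g₁) (conv f₁ g₀) h) (cong₂ _+_ (hat-conv f₀ g₁ h) (hat-conv f₁ g₀ h)))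
  r₀ : ∀ a b c d → (a * c + b * d) + (a * d + b * c) ≡ (a + b) * (c + d)
  r₀ = solve-∀
  r₁ : ∀ a b c d → (a * c + b * d) - (a * d + b * c) ≡ (a - b) * (c - d)
  r₁ = solve-∀
  both : ∀ b → hat (conv f g) (b ∷ h) ≡ hat f (b ∷ h) * hat g (b ∷ h)
  both false = trans (hat-false (conv f g) h) (trans (cong₂ _+_ e₀ e₁)
    (trans (r₀ (hat f₀ h) (hat f₁ h) (hat g₀ h) (hat g₁ h))
           (sym (cong₂ _*_ (hat-false f h) (hat-false g h)))))
  both true = trans (hat-true (conv f g) h) (trans (cong₂ _-_ e₀ e₁)
    (trans (r₁ (hat f₀ h) (hat f₁ h) (hat g₀ h) (hat g₁ h))
           (sym (cong₂ _*_ (hat-true f h) (hat-true g h)))))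

parseval : ∀ {v} (f g : F2^ v → ℤ) → ∑ (λ h → hat f h * hat g h) ≡ size v * ∑ (λ x → f x * g x)
parseval {zero} f g = trans (∑-[] (λ h → hat f h * hat g h))
  (trans (cong₂ _*_ (hat-[] f) (hat-[] g))
  (trans (sym (∑-[] (λ x → f x * g x))) (sym (ℤ.*-identityˡ (∑ (λ x → f x * g x))))))
parseval {suc v} f g = begin
  ∑ (λ h → hat f h * hat g h)
    ≡⟨ ∑-∷ (λ h → hat f h * hat g h) ⟩
  ∑ (λ h → hat f (false ∷ h) * hat g (false ∷ h)) + ∑ (λ h → hat f (true ∷ h) * hat g (true ∷ h))
    ≡⟨ cong₂ _+_ (∑-cong (λ h → cong₂ _*_ (hat-false f h) (hat-false g h)))
                 (∑-cong (λ h → cong₂ _*_ (hat-true f h) (hat-true g h))) ⟩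
  ∑ (λ h → (F₀ h + F₁ h) * (G₀ h + G₁ h)) + ∑ (λ h → (F₀ h - F₁ h) * (G₀ h - G₁ h))
    ≡⟨ sym (∑-+ (λ h → (F₀ h + F₁ h) * (G₀ h + G₁ h)) (λ h → (F₀ h - F₁ h) * (G₀ h - G₁ h))) ⟩
  ∑ (λ h → (F₀ h + F₁ h) * (G₀ h + G₁ h) + (F₀ h - F₁ h) * (G₀ h - G₁ h))
    ≡⟨ ∑-cong (λ h → r (F₀ h) (F₁ h) (G₀ h) (G₁ h)) ⟩
  ∑ (λ h → + 2 * (F₀ h * G₀ h + F₁ h * G₁ h))
    ≡⟨ ∑-* (+ 2) (λ h → F₀ h * G₀ h + F₁ h * G₁ h) ⟩
  + 2 * ∑ (λ h → F₀ h * G₀ h + F₁ h * G₁ h)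
    ≡⟨ cong (λ z → + 2 * z) (trans (∑-+ (λ h → F₀ h * G₀ h) (λ h → F₁ h * G₁ h))
                            (cong₂ _+_ (parseval f₀ g₀) (parseval f₁ g₁))) ⟩
  + 2 * (size v * ∑ (λ x → f₀ x * g₀ x) + size v * ∑ (λ x → f₁ x * g₁ x))
    ≡⟨ r′ (size v) (∑ (λ x → f₀ x * g₀ x)) (∑ (λ x → f₁ x * g₁ x)) ⟩
  + 2 * size v * (∑ (λ x → f₀ x * g₀ x) + ∑ (λ x → f₁ x * g₁ x))
    ≡⟨ cong (λ z → + 2 * size v * z) (sym (∑-∷ (λ x → f x * g x))) ⟩
  + 2 * size v * ∑ (λ x → f x * g x) ∎
  where
  open ≡-Reasoning
  f₀ f₁ g₀ g₁ F₀ F₁ G₀ G₁ : F2^ v → ℤ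
  f₀ x = f (false ∷ x)
  f₁ x = f (true ∷ x)
  g₀ x = g (false ∷ x)
  g₁ x = g (true ∷ x)
  F₀ = hat f₀
  F₁ = hat f₁
  G₀ = hat g₀
  G₁ = hat g₁
  r : ∀ a b c d → (a + b) * (c + d) + (a - b) * (c - d) ≡ + 2 * (a * c + b * d)
  r = solve-∀
  r′ : ∀ s a b → + 2 * (s * a + s * b) ≡ + 2 * s * (a + b)
  r′ = solve-∀

δ : ∀ {v} → F2^ v → ℤ
δ [] = 1ℤ
δ (false ∷ x) = δ x
δ (true ∷ x) = 0ℤ

∑-δ : ∀ {v} (f : F2^ v → ℤ) → ∑ (λ x → δ x * f x) ≡ f (zeroVec v)
∑-δ {zero} f = trans (∑-[] (λ x → δ x * f x)) (ℤ.*-identityˡ (f []))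
∑-δ {suc v} f = trans (∑-∷ (λ x → δ x * f x)) (trans
  (cong₂ _+_ (∑-δ (λ x → f (false ∷ x))) (∑-zero {v}))
  (ℤ.+-identityʳ (f (zeroVec (suc v)))))

δ-zero : ∀ v → δ (zeroVec v) ≡ 1ℤ
δ-zero zero = refl
δ-zero (suc v) = δ-zero v

δ-cases : ∀ {v} (x : F2^ v) → (x ≡ zeroVec v × δ x ≡ 1ℤ) ⊎ (¬ (x ≡ zeroVec v) × δ x ≡ 0ℤ)
δ-cases [] = inj₁ (refl , refl)
δ-cases (true ∷ x) = inj₂ ((λ ()) , refl)
δ-cases (false ∷ x) with δ-cases x
... | inj₁ (e , d) = inj₁ (cong (false ∷_) e , d)
... | inj₂ (ne , d) = inj₂ ((λ { refl → ne refl }) , d)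

δ-nonzero : ∀ {v} (x : F2^ v) → ¬ (x ≡ zeroVec v) → δ x ≡ 0ℤ
δ-nonzero x ne with δ-cases x
... | inj₁ (e , _) = ⊥-elim (ne e)
... | inj₂ (_ , d) = d

hat-δ : ∀ {v} (h : F2^ v) → hat δ h ≡ 1ℤ
hat-δ h = trans (∑-δ (χ h)) (cong sgn (dot-zeroʳ h))

hat-translate : ∀ {v} (q : F2^ v) (f : F2^ v → ℤ) h → hat (λ x → f (x ⊕ q)) h ≡ χ h q * hat f h
hat-translate q f h = trans
  (∑-cong (λ x → trans (cong (f (x ⊕ q) *_) (trans (cong (χ h) (sym (⊕-cancelʳ x q))) (χ-⊕ʳ h (x ⊕ q) q)))
                       (r (f (x ⊕ q)) (χ h (x ⊕ q)) (χ h q))))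
  (trans (∑-* (χ h q) (λ x → f (x ⊕ q) * χ h (x ⊕ q))) (cong (χ h q *_) (∑-translate q (λ x → f x * χ h x))))
  where r : ∀ a b c → a * (b * c) ≡ c * (a * b)
        r = solve-∀

-- Parseval against `δ`, whose transform is constantly 1, after translating `q` to the origin.
inversion : ∀ {v} (f : F2^ v → ℤ) q → ∑ (λ h → hat f h * χ h q) ≡ size v * f q
inversion {v} f q = begin
  ∑ (λ h → hat f h * χ h q)
    ≡⟨ ∑-cong (λ h → trans (ℤ.*-comm (hat f h) (χ h q)) (trans (sym (hat-translate q f h))
         (trans (sym (ℤ.*-identityʳ (hat (λ x → f (x ⊕ q)) h))) (cong (hat (λ x → f (x ⊕ q)) h *_) (sym (hat-δ h)))))) ⟩
  ∑ (λ h → hat (λ x → f (x ⊕ q)) h * hat δ h)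
    ≡⟨ parseval (λ x → f (x ⊕ q)) δ ⟩
  size v * ∑ (λ x → f (x ⊕ q) * δ x)
    ≡⟨ cong (size v *_) (trans (∑-cong (λ x → ℤ.*-comm (f (x ⊕ q)) (δ x))) (∑-δ (λ x → f (x ⊕ q)))) ⟩
  size v * f (zeroVec v ⊕ q)
    ≡⟨ cong (λ x → size v * f x) (⊕-identityˡ q) ⟩
  size v * f q ∎
  where open ≡-Reasoning

hat-size : ∀ {v} (f : F2^ v → ℤ) → ∑ (hat f) ≡ size v * f (zeroVec v)
hat-size {v} f = trans (∑-cong (λ h → sym (trans (cong (λ b → hat f h * sgn b) (dot-zeroʳ h)) (ℤ.*-identityʳ _))))
                   (inversion f (zeroVec v))

-- Linear arithmetic over ℤ

infixl 6 _⊞_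
infixl 7 _⊠_
_⊞_ : ∀ {a b} → 0ℤ ≤ a → 0ℤ ≤ b → 0ℤ ≤ a + b
p ⊞ q = ℤ.+-mono-≤ p q

_⊠_ : ∀ {a b} → 0ℤ ≤ a → 0ℤ ≤ b → 0ℤ ≤ a * b
_⊠_ {a} {b} p q = subst (_≤ a * b) (ℤ.*-zeroʳ a) (ℤ.*-monoˡ-≤-nonNeg a {{nonNegative p}} q)

nat≥0 : ∀ {n} → 0ℤ ≤ + n
nat≥0 = +≤+ ℕ.z≤n

-- To prove a ≤ b, exhibit b - a as an expression that is visibly nonnegative.
≤-by : ∀ {a b c} → b - a ≡ c → 0ℤ ≤ c → a ≤ b
≤-by {a} {b} e p = ℤ.0≤i-j⇒j≤i {b} {a} (subst (0ℤ ≤_) (sym e) p)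

gap : ∀ {a b} → a ≤ b → 0ℤ ≤ b - a
gap = ℤ.i≤j⇒0≤j-i

-- The end of every Farkas-type contradiction below: a nonnegative combination of the slacks of the
-- hypotheses that the ring solver evaluates to a negative constant.
impossible : ∀ {c} n → 0ℤ ≤ c → c ≡ -[1+ n ] → ⊥
impossible n () refl

-- Here integrality enters: no integer lies strictly between the roots of z(z - 1).
square-≥ : ∀ z → z ≤ z * z
square-≥ (+ zero) = ℤ.≤-refl
square-≥ (+ suc n) = +≤+ (ℕ.m≤m+n (suc n) (n ℕ.* suc n))
square-≥ -[1+ n ] = -≤+

toℕ≥0 : ∀ {z} → 0ℤ ≤ z → ∃ λ n → z ≡ + n
toℕ≥0 {+ n} p = n , refl

size-pos : ∀ v → ∃ λ n → size v ≡ + suc n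
size-pos zero = 0 , refl
size-pos (suc v) with size-pos v
... | n , e = n ℕ.+ suc (n ℕ.+ 0) , cong (λ z → + 2 * z) e

size≥1 : ∀ v → 1ℤ ≤ size v
size≥1 v with size-pos v
... | n , e = subst (1ℤ ≤_) (sym e) (+≤+ (ℕ.s≤s ℕ.z≤n))

size≥0 : ∀ v → 0ℤ ≤ size v
size≥0 v = ℤ.≤-trans (+≤+ ℕ.z≤n) (size≥1 v)

size-cancel : ∀ v c → 1ℤ ≤ size v * c → 1ℤ ≤ c
size-cancel v c p with ℤ.≤-total 1ℤ c
... | inj₁ q = q
... | inj₂ q with c ℤ.≤? 0ℤ
...   | yes r = ⊥-elim (impossible 0 (gap p ⊞ size≥0 v ⊠ gap r) (alg (size v) c))
  where alg : ∀ s c → (s * c - 1ℤ) + s * (0ℤ - c) ≡ -[1+ 0 ]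
        alg = solve-∀
...   | no r = ℤ.i<j⇒suc[i]≤j (ℤ.≰⇒> r)

-- Weights

bit : Bool → ℤ
bit true = 1ℤ
bit false = 0ℤ

ind : ∀ {v} → F2^ v → F2^ v → ℤ
ind h x = bit (dot h x)

bit-nonneg : ∀ b → 0ℤ ≤ bit b
bit-nonneg true = +≤+ ℕ.z≤n
bit-nonneg false = +≤+ ℕ.z≤n

1-bit-nonneg : ∀ b → 0ℤ ≤ 1ℤ - bit b
1-bit-nonneg true = +≤+ ℕ.z≤n
1-bit-nonneg false = +≤+ ℕ.z≤n

sgn-bit : ∀ b → sgn b ≡ 1ℤ - + 2 * bit b
sgn-bit true = refl
sgn-bit false = refl

wt : ∀ {v} → (F2^ v → ℤ) → F2^ v → ℤ
wt M h = ∑ (λ x → M x * ind h x)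

∑-- : ∀ {v} (f g : F2^ v → ℤ) → ∑ (λ x → f x - g x) ≡ ∑ f - ∑ g
∑-- f g = trans (∑-+ f (λ x → - g x)) (cong₂ _+_ (refl {x = ∑ f})
  (trans (∑-cong (λ x → sym (ℤ.-1*i≡-i (g x)))) (trans (∑-* (- 1ℤ) g) (ℤ.-1*i≡-i (∑ g)))))

hat-wt : ∀ {v} (M : F2^ v → ℤ) h → hat M h ≡ ∑ M - + 2 * wt M h
hat-wt M h = trans
  (∑-cong (λ x → trans (cong (M x *_) (sgn-bit (dot h x))) (r (M x) (ind h x))))
  (trans (∑-- M (λ x → + 2 * (M x * ind h x)))
         (cong₂ _-_ (refl {x = ∑ M}) (∑-* (+ 2) (λ x → M x * ind h x))))
  where r : ∀ a b → a * (1ℤ - + 2 * b) ≡ a - + 2 * (a * b)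
        r = solve-∀

wt-zero : ∀ {v} (M : F2^ v → ℤ) → wt M (zeroVec v) ≡ 0ℤ
wt-zero {v} M = trans (∑-cong (λ x → trans (cong (λ b → M x * bit b) (dot-zeroˡ x)) (ℤ.*-zeroʳ (M x)))) (∑-zero {v})

wt-+ : ∀ {v} (f g : F2^ v → ℤ) h → wt (λ x → f x + g x) h ≡ wt f h + wt g h
wt-+ f g h = trans (∑-cong (λ x → ℤ.*-distribʳ-+ (ind h x) (f x) (g x))) (∑-+ (λ x → f x * ind h x) (λ x → g x * ind h x))

wt-* : ∀ {v} c (f : F2^ v → ℤ) h → wt (λ x → c * f x) h ≡ c * wt f h
wt-* c f h = trans (∑-cong (λ x → ℤ.*-assoc c (f x) (ind h x))) (∑-* c (λ x → f x * ind h x))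

-- Affine multisets: the origin may carry weight, and then Δ-divisibility is a
-- condition on the hyperplanes not through the origin.
record Aff {v} (Δ μ n : ℕ) (M : F2^ v → ℤ) : Set where
  field
    nonneg : ∀ x → 0ℤ ≤ M x
    bound : ∀ x → M x ≤ + μ
    total : ∑ M ≡ + n
    div : ∀ h → + Δ ∣ wt M h
open Aff public

Pts : ∀ {v} (Δ μ n : ℕ) → (F2^ v → ℤ) → Set
Pts {v} Δ μ n M = Aff Δ μ n M × M (zeroVec v) ≡ 0ℤ

Ex : (Δ μ n : ℕ) → Set
Ex Δ μ n = ∀ {v} (M : F2^ v → ℤ) → Pts Δ μ n M → ⊥

weaken : ∀ {Δ μ μ′ n v} {M : F2^ v → ℤ} → μ ℕ.≤ μ′ → Aff Δ μ n M → Aff Δ μ′ n M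
weaken p a = record { nonneg = nonneg a ; bound = λ x → ℤ.≤-trans (bound a x) (+≤+ p)
                    ; total = total a ; div = div a }

on off : ∀ {v} → F2^ v → (F2^ v → ℤ) → F2^ v → ℤ
on h M x = M x * (1ℤ - ind h x)
off h M x = M x * ind h x

-- Inclusion and exclusion for the overlap of two codewords. The factor 2 is the reason why every
-- restriction to a hyperplane or its complement costs half of the divisor.
wt-off : ∀ {v} (a h : F2^ v) M → + 2 * wt (off a M) h ≡ wt M a + wt M h - wt M (a ⊕ h)
wt-off a h M = trans (sym (∑-* (+ 2) (λ x → M x * ind a x * ind h x)))
  (trans (∑-cong (λ x → trans (r (M x) (ind a x) (ind h x))
           (cong (λ z → M x * ind a x + M x * ind h x - M x * z) (sym (bit-xor (dot a x) (dot h x) (dot (a ⊕ h) x) (dot-⊕ˡ a h x))))))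
    (trans (∑-- (λ x → M x * ind a x + M x * ind h x) (λ x → M x * ind (a ⊕ h) x))
           (cong (_- wt M (a ⊕ h)) (∑-+ (λ x → M x * ind a x) (λ x → M x * ind h x)))))
  where
  r : ∀ m a h → + 2 * (m * a * h) ≡ m * a + m * h - m * (a + h - + 2 * (a * h))
  r = solve-∀
  bit-xor : ∀ a b c → c ≡ a xor b → bit c ≡ bit a + bit b - + 2 * (bit a * bit b)
  bit-xor false false _ refl = refl
  bit-xor false true _ refl = refl
  bit-xor true false _ refl = refl
  bit-xor true true _ refl = refl

wt-on : ∀ {v} (a h : F2^ v) M → + 2 * wt (on a M) h ≡ wt M h - wt M a + wt M (a ⊕ h)
wt-on a h M = trans (cong (+ 2 *_) (trans
    (∑-cong (λ x → r (M x) (ind a x) (ind h x)))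
    (∑-- (λ x → M x * ind h x) (λ x → off a M x * ind h x))))
  (trans (r₂ (wt M h) (wt (off a M) h)) (trans (cong (λ z → + 2 * wt M h - z) (wt-off a h M))
    (r₃ (wt M a) (wt M h) (wt M (a ⊕ h)))))
  where
  r : ∀ m a h → m * (1ℤ - a) * h ≡ m * h - m * a * h
  r = solve-∀
  r₂ : ∀ m a → + 2 * (m - a) ≡ + 2 * m - + 2 * a
  r₂ = solve-∀
  r₃ : ∀ a h b → + 2 * h - (a + h - b) ≡ h - a + b
  r₃ = solve-∀

∑-on : ∀ {v} (a : F2^ v) M → ∑ (on a M) ≡ ∑ M - wt M a
∑-on a M = trans (∑-cong (λ x → r (M x) (ind a x))) (∑-- M (λ x → M x * ind a x))
  where r : ∀ m a → m * (1ℤ - a) ≡ m - m * a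
        r = solve-∀

on-aff : ∀ {δ μ n v} {M : F2^ v → ℤ} → Aff (2 ℕ.* δ) μ n M → ∀ a m → ∑ M - wt M a ≡ + m → Aff δ μ m (on a M)
on-aff {δ} {μ} {n} {v} {M} A a m e = record
  { nonneg = λ x → nonneg A x ⊠ 1-bit-nonneg (dot a x)
  ; bound = λ x → ℤ.≤-trans (le (dot a x) (nonneg A x)) (bound A x)
  ; total = trans (∑-on a M) e
  ; div = dv }
  where
  le : ∀ b {z} → 0ℤ ≤ z → z * (1ℤ - bit b) ≤ z
  le true {z} p = subst (_≤ z) (sym (ℤ.*-zeroʳ z)) p
  le false {z} p = ℤ.≤-reflexive (ℤ.*-identityʳ z)
  dv : ∀ h → + δ ∣ wt (on a M) h
  dv h with div A h | div A a | div A (a ⊕ h)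
  ... | divides q e₁ | divides q₂ e₂ | divides q₃ e₃ = divides (q - q₂ + q₃)
    (ℤ.*-cancelˡ-≡ (+ 2) _ _ (trans (wt-on a h M)
      (trans (cong₂ _+_ (cong₂ _-_ e₁ e₂) e₃)
      (trans (cong (λ z → q * z - q₂ * z + q₃ * z) (ℤ.pos-* 2 δ)) (r q q₂ q₃ (+ δ))))))
    where r : ∀ a b c d → a * (+ 2 * d) - b * (+ 2 * d) + c * (+ 2 * d) ≡ + 2 * ((a - b + c) * d)
          r = solve-∀

on-zero : ∀ {v} (a : F2^ v) M → M (zeroVec v) ≡ 0ℤ → on a M (zeroVec v) ≡ 0ℤ
on-zero a M e = trans (cong (_* (1ℤ - ind a (zeroVec _))) e) refl

wt≥0 : ∀ {Δ μ n v} {M : F2^ v → ℤ} → Aff Δ μ n M → ∀ h → 0ℤ ≤ wt M h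
wt≥0 A h = ∑-nonneg (λ x → nonneg A x ⊠ bit-nonneg (dot h x))

wt≤n : ∀ {Δ μ n v} {M : F2^ v → ℤ} → Aff Δ μ n M → ∀ h → wt M h ≤ + n
wt≤n {M = M} A h = subst (wt M h ≤_) (total A) (≤-by (sym (∑-on h M)) (∑-nonneg (λ x → nonneg A x ⊠ 1-bit-nonneg (dot h x))))

-- The crude bound `k ≤ n` turns the condition on all weights into the finite check `feasible`.
weight-cases : ∀ {Δ μ n v} {M : F2^ v → ℤ} → Aff (suc Δ) μ n M → ∀ h →
  ∃ λ k → wt M h ≡ + (k ℕ.* suc Δ) × k ℕ.* suc Δ ℕ.≤ n × k ℕ.≤ n
weight-cases {Δ} {μ} {n} A h with div A h | wt≥0 A h | wt≤n A h
... | divides (+ k) e | _ | le = k , e′ , le′ , ℕ.≤-trans (ℕ.m≤m*n k (suc Δ)) le′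
  where e′ = trans e (sym (ℤ.pos-* k (suc Δ)))
        le′ = ℤ.drop‿+≤+ (subst (_≤ + n) e′ le)
... | divides -[1+ k ] e | p | _ = ⊥-elim (neg (subst (0ℤ ≤_) e p))
  where neg : 0ℤ ≤ -[1+ k ] * + suc Δ → ⊥
        neg ()

-- Linear programming bounds

∑² ∑³ : ∀ {v} → (F2^ v → ℤ) → ℤ
∑² M = ∑ (λ x → M x * M x)
∑³ M = ∑ (λ x → M x * conv M M x)

record Cubic : Set where
  constructor cubic
  field c₀ c₁ c₂ c₃ : ℤ

infixl 8 _⟦_⟧
_⟦_⟧ : Cubic → ℤ → ℤ
cubic a b c d ⟦ x ⟧ = a + b * x + c * (x * x) + d * (x * (x * x))

-- The first three power moments: the transform has mean M(0) = 0, mean square `∑² M` and mean cube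
-- `∑³ M`. The linear coefficient `b` therefore costs nothing and can be chosen to place the roots.
∑-cubic : ∀ {v} (M : F2^ v → ℤ) → M (zeroVec v) ≡ 0ℤ → ∀ a b c d →
  ∑ (λ h → cubic a b c d ⟦ hat M h ⟧) ≡ size v * (a + c * ∑² M + d * ∑³ M)
∑-cubic {v} M M0 a b c d = trans
  (trans (∑-+ (λ h → a + b * hat M h + c * (hat M h * hat M h)) (λ h → d * (hat M h * (hat M h * hat M h))))
    (cong₂ _+_ (trans (∑-+ (λ h → a + b * hat M h) (λ h → c * (hat M h * hat M h)))
      (cong₂ _+_ (trans (∑-+ (λ _ → a) (λ h → b * hat M h)) (cong₂ _+_ (∑-const {v} a) (∑-* b (hat M))))
                 (∑-* c (λ h → hat M h * hat M h))))
      (∑-* d (λ h → hat M h * (hat M h * hat M h)))))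
  (trans (cong₂ _+_ (cong₂ _+_ (cong (λ z → size v * a + b * z) (trans (hat-size M) (trans (cong (λ z → size v * z) M0) (ℤ.*-zeroʳ (size v)))))
                               (cong (λ z → c * z) (parseval M M)))
                    (cong (λ z → d * z) (trans (∑-cong (λ h → cong (λ z → hat M h * z) (sym (hat-conv M M h)))) (parseval M (conv M M)))))
    (r (size v) a b c d (∑² M) (∑³ M)))
  where r : ∀ s a b c d e f → s * a + b * 0ℤ + c * (s * e) + d * (s * f) ≡ s * (a + c * e + d * f)
        r = solve-∀

δ-0or1 : ∀ {v} (x : F2^ v) → (δ x ≡ 0ℤ) ⊎ (δ x ≡ 1ℤ)
δ-0or1 x with δ-cases x
... | inj₁ (_ , d) = inj₂ d
... | inj₂ (_ , d) = inj₁ d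

∑δ : ∀ v → ∑ {v} δ ≡ 1ℤ
∑δ v = trans (∑-cong (λ x → sym (ℤ.*-identityʳ (δ x)))) (∑-δ {v} (λ _ → 1ℤ))

∑-≥-origin : ∀ {v} (f : F2^ v → ℤ) {c} → (∀ h → 0ℤ ≤ f h) → c ≤ f (zeroVec v) → c ≤ ∑ f
∑-≥-origin {v} f {c} p q = ℤ.≤-trans q (subst (_≤ ∑ f) (∑-δ f) (∑-mono le))
  where le : ∀ h → δ h * f h ≤ f h
        le h with δ-0or1 h
        ... | inj₁ e = subst (λ z → z * f h ≤ f h) (sym e) (p h)
        ... | inj₂ e = subst (λ z → z * f h ≤ f h) (sym e) (ℤ.≤-reflexive (ℤ.*-identityˡ (f h)))

hat-origin : ∀ {Δ μ n v} {M : F2^ v → ℤ} → Aff Δ μ n M → hat M (zeroVec v) ≡ + n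
hat-origin {M = M} A = trans (hat-0 M) (total A)

-- The word h = 0, where the transform equals n, makes the sum positive; the mean is an integer and
-- so at least 1.
moments : ∀ {Δ μ n v} {M : F2^ v → ℤ} → Pts Δ μ n M → ∀ a b c d →
  (∀ h → 0ℤ ≤ cubic a b c d ⟦ hat M h ⟧) → 1ℤ ≤ cubic a b c d ⟦ + n ⟧ →
  1ℤ ≤ a + c * ∑² M + d * ∑³ M
moments {v = v} {M} (A , M0) a b c d p q = size-cancel v _ (subst (1ℤ ≤_) (∑-cubic M M0 a b c d)
  (∑-≥-origin (λ h → cubic a b c d ⟦ hat M h ⟧) p
    (subst (λ z → 1ℤ ≤ cubic a b c d ⟦ z ⟧) (sym (hat-origin A)) q)))

_∈ᵇ_ : ℕ → List ℕ → Bool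
m ∈ᵇ [] = false
m ∈ᵇ (x ∷ xs) = (m ℕ.≡ᵇ x) ∨ (m ∈ᵇ xs)

lookupᵇ : ∀ {P : ℕ → Set} {xs} m → All P xs → T (m ∈ᵇ xs) → P m
lookupᵇ {P} {x ∷ xs} m (px ∷ ps) t with m ℕ.≡ᵇ x in eq
... | true = subst P (sym (ℕ.≡ᵇ⇒≡ m x (subst T (sym eq) _))) px
... | false = lookupᵇ m ps t

-- The weight kΔ needs no check if it exceeds n or if the hyperplane it belongs to
-- would contain a forbidden number of points.
admissible : (Δ n : ℕ) → List ℕ → Cubic → ℕ → Bool
admissible Δ n L p k = (n ℕ.<ᵇ k ℕ.* Δ) ∨ ((n ℕ.∸ k ℕ.* Δ) ∈ᵇ L) ∨
  does (0ℤ ℤ.≤? p ⟦ + n - + 2 * + (k ℕ.* Δ) ⟧)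

allBelow : ℕ → (ℕ → Bool) → Bool
allBelow zero f = true
allBelow (suc n) f = f n ∧ allBelow n f

T-∧ : ∀ a b → T (a ∧ b) → T a × T b
T-∧ true b t = _ , t

allBelow-sound : ∀ n f → T (allBelow n f) → ∀ k → k ℕ.< n → T (f k)
allBelow-sound (suc n) f t k lt with T-∧ (f n) _ t | k ℕ.≟ n
... | t₁ , _ | yes refl = t₁
... | _ , t₂ | no ne = allBelow-sound n f t₂ k (ℕ.≤∧≢⇒< (ℕ.≤-pred lt) ne)

feasible : (Δ n : ℕ) → List ℕ → Cubic → Bool
feasible Δ n L p = allBelow (suc n) (admissible Δ n L p)

T-does : ∀ {P : Set} (d : Dec P) → T (does d) → P
T-does (yes p) _ = p

hat≥0 : ∀ d {μ n v} {M : F2^ v → ℤ} {L} → Pts (2 ℕ.* suc d) μ n M → All (Ex (suc d) μ) L →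
  ∀ p → T (feasible (2 ℕ.* suc d) n L p) → ∀ h → 0ℤ ≤ p ⟦ hat M h ⟧
hat≥0 d {μ} {n} {v} {M} {L} (A , M0) ex p ok h with weight-cases A h
... | k , e , le , k≤n = go _ _ (allBelow-sound (suc n) (admissible (2 ℕ.* suc d) n L p) ok k (ℕ.s≤s k≤n)) refl refl
  where
  w = k ℕ.* (2 ℕ.* suc d)
  go : ∀ a b → T (a ∨ b ∨ does (0ℤ ℤ.≤? p ⟦ + n - + 2 * + w ⟧)) → (n ℕ.<ᵇ w) ≡ a → ((n ℕ.∸ w) ∈ᵇ L) ≡ b →
       0ℤ ≤ p ⟦ hat M h ⟧
  go true b t e₁ e₂ = ⊥-elim (ℕ.<⇒≱ (ℕ.<ᵇ⇒< n w (subst T (sym e₁) _)) le)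
  go false true t e₁ e₂ = ⊥-elim (lookupᵇ (n ℕ.∸ w) ex (subst T (sym e₂) _) (on h M)
    (on-aff A h (n ℕ.∸ w) (trans (cong₂ _-_ (total A) e) (trans (ℤ.m-n≡m⊖n n w) (ℤ.⊖-≥ le))) , on-zero h M M0))
  go false false t e₁ e₂ = subst (λ z → 0ℤ ≤ p ⟦ z ⟧)
    (sym (trans (hat-wt M h) (cong₂ (λ a b → a - + 2 * b) (total A) e))) (T-does (0ℤ ℤ.≤? _) t)

-- A lower bound on `∑² M`, to be played against the upper bound that `quadratic-bound` derives from
-- parity.
second : ∀ d {μ n v} {M : F2^ v → ℤ} {L} → Pts (2 ℕ.* suc d) μ n M → All (Ex (suc d) μ) L → ∀ a b →
  T (feasible (2 ℕ.* suc d) n L (cubic a b 1ℤ 0ℤ)) → 1ℤ ≤ cubic a b 1ℤ 0ℤ ⟦ + n ⟧ → 1ℤ ≤ a + ∑² M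
second d {M = M} P ex a b ok q = subst (1ℤ ≤_) (r a (∑² M) (∑³ M)) (moments P a b 1ℤ 0ℤ (hat≥0 d P ex (cubic a b 1ℤ 0ℤ) ok) q)
  where r : ∀ a e f → a + 1ℤ * e + 0ℤ * f ≡ a + e
        r = solve-∀

∑²-≥ : ∀ {Δ μ n v} {M : F2^ v → ℤ} → Aff Δ μ n M → + n ≤ ∑² M
∑²-≥ {M = M} A = subst (_≤ ∑² M) (total A) (∑-mono (λ x → square-≥ (M x)))

∑²-≤ : ∀ {Δ μ n v} {M : F2^ v → ℤ} → Aff Δ μ n M → ∑² M ≤ + μ * + n
∑²-≤ {μ = μ} {M = M} A = subst (∑² M ≤_) (trans (∑-* (+ μ) M) (cong (λ z → + μ * z) (total A)))
  (∑-mono (λ x → ℤ.*-monoʳ-≤-nonNeg (M x) {{nonNegative (nonneg A x)}} (bound A x)))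

conv≥0 : ∀ {v} {f g : F2^ v → ℤ} → (∀ x → 0ℤ ≤ f x) → (∀ x → 0ℤ ≤ g x) → ∀ p → 0ℤ ≤ conv f g p
conv≥0 f≥0 g≥0 p = ∑-nonneg (λ q → f≥0 q ⊠ g≥0 (q ⊕ p))

∑³≥0 : ∀ {Δ μ n v} {M : F2^ v → ℤ} → Aff Δ μ n M → 0ℤ ≤ ∑³ M
∑³≥0 A = ∑-nonneg (λ x → nonneg A x ⊠ conv≥0 (nonneg A) (nonneg A) x)

-- Uses n ≤ ∑² ≤ μn and 0 ≤ ∑³, so it bounds the mean of p from above only if c₃ ≤ 0.
mean : (μ n : ℕ) → Cubic → ℤ
mean μ n (cubic a b c d) = a + (if does (0ℤ ℤ.≤? c) then c * (+ μ * + n) else c * + n)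

certified : (Δ μ n : ℕ) → List ℕ → Cubic → Bool
certified Δ μ n L p = feasible Δ n L p ∧ does (1ℤ ℤ.≤? p ⟦ + n ⟧) ∧ does (Cubic.c₃ p ℤ.≤? 0ℤ)
  ∧ does (mean μ n p ℤ.≤? 0ℤ)

exclude : ∀ d {μ L} → All (Ex (suc d) μ) L → ∀ n p → T (certified (2 ℕ.* suc d) μ n L p) → Ex (2 ℕ.* suc d) μ n
exclude d {μ} {L} ex n p@(cubic a b c e) ok {v} M P@(A , _)
  with T-∧ (feasible (2 ℕ.* suc d) n L p) _ ok
... | t₁ , t with T-∧ (does (1ℤ ℤ.≤? p ⟦ + n ⟧)) _ t
... | t₂ , t′ with T-∧ (does (e ℤ.≤? 0ℤ)) _ t′
... | t₃ , t₄ = impossible 0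
    (gap mo ⊞ gap (T-does (mean μ n p ℤ.≤? 0ℤ) t₄) ⊞ gap quad ⊞ gap cub)
    (r a (mean μ n p) (c * ∑² M) (e * ∑³ M))
  where
  r : ∀ a m x y → (a + x + y - 1ℤ) + (0ℤ - m) + (m - (a + x)) + (0ℤ - y) ≡ -[1+ 0 ]
  r = solve-∀
  mo = moments P a b c e (hat≥0 d P ex p t₁) (T-does (1ℤ ℤ.≤? _) t₂)
  cub : e * ∑³ M ≤ 0ℤ
  cub = ≤-by (r′ e (∑³ M)) (gap (T-does (e ℤ.≤? 0ℤ) t₃) ⊠ ∑³≥0 A)
    where r′ : ∀ e s → 0ℤ - e * s ≡ (0ℤ - e) * s
          r′ = solve-∀
  quad : a + c * ∑² M ≤ mean μ n p
  quad with 0ℤ ℤ.≤? c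
  ... | yes q = ℤ.+-monoʳ-≤ a (ℤ.*-monoˡ-≤-nonNeg c {{nonNegative q}} (∑²-≤ A))
  ... | no q = ℤ.+-monoʳ-≤ a (≤-by (r′ c (+ n) (∑² M)) (gap (ℤ.<⇒≤ (ℤ.≰⇒> q)) ⊠ gap (∑²-≥ A)))
    where r′ : ∀ c n s → c * n - c * s ≡ (0ℤ - c) * (s - n)
          r′ = solve-∀

-- Sizes excluded by polynomial certificates for Δ = 2, 4, 8

averaging : Cubic
averaging = cubic 0ℤ 1ℤ 0ℤ 0ℤ

-- The transform takes values congruent to n modulo 2Δ. The quadratics below are (x - s)(x - s + 2Δ)
-- with s the least positive such value, so no possible value lies strictly between the roots. If n
-- = Δ, then n is itself a root, and the constant is raised by 1 to keep the value at n positive.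
x²+_x+_ : ℤ → ℤ → Cubic
x²+ b x+ a = cubic a b 1ℤ 0ℤ

exclude₂ : ∀ μ → All (Ex 2 μ) (1 ∷ [])
exclude₂ μ = exclude 0 [] 1 averaging _ ∷ []

exclude₂-1 : All (Ex 2 1) (1 ∷ 2 ∷ [])
exclude₂-1 = exclude 0 [] 1 averaging _ ∷ exclude 0 [] 2 (x²+ + 0 x+ -[1+ 2 ]) _ ∷ []

-- A word of weight above n/2 would leave a forbidden number of points on its hyperplane. Hence n -
-- 2w is nonnegative for every word and positive for the zero word, although its mean is 0.
exclude₄ : ∀ μ → All (Ex 4 μ) (1 ∷ 2 ∷ 3 ∷ 5 ∷ 9 ∷ [])
exclude₄ μ = by 1 _ ∷ by 2 _ ∷ by 3 _ ∷ by 5 _ ∷ by 9 _ ∷ []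
  where
  by : ∀ n → T (feasible 4 n (1 ∷ []) averaging ∧ does (1ℤ ℤ.≤? averaging ⟦ + n ⟧) ∧ true ∧ true) → Ex 4 μ n
  by n t = exclude 1 (exclude₂ μ) n averaging t

exclude₈ : ∀ μ → All (Ex 8 μ) (1 ∷ 2 ∷ 3 ∷ 4 ∷ 5 ∷ 6 ∷ 7 ∷ 9 ∷ 10 ∷ 11 ∷ 13 ∷ 17 ∷ 18 ∷ 19 ∷ 21 ∷ 25 ∷ 33 ∷ [])
exclude₈ μ = by 1 _ ∷ by 2 _ ∷ by 3 _ ∷ by 4 _ ∷ by 5 _ ∷ by 6 _ ∷ by 7 _ ∷ by 9 _ ∷ by 10 _ ∷ by 11 _ ∷ by 13 _
  ∷ by 17 _ ∷ by 18 _ ∷ by 19 _ ∷ by 21 _ ∷ by 25 _ ∷ by 33 _ ∷ []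
  where
  by : ∀ n → T (feasible 8 n (1 ∷ 2 ∷ 3 ∷ 5 ∷ 9 ∷ []) averaging ∧ does (1ℤ ℤ.≤? averaging ⟦ + n ⟧) ∧ true ∧ true) → Ex 8 μ n
  by n t = exclude 3 (exclude₄ μ) n averaging t

exclude₄-4 : Ex 4 3 4
exclude₄-4 = exclude 1 (exclude₂ 3) 4 (x²+ + 0 x+ -[1+ 14 ]) _

exclude₈-8 : Ex 8 7 8
exclude₈-8 = exclude 3 (exclude₄ 7) 8 (x²+ + 0 x+ -[1+ 62 ]) _

-- Parity: the points of odd multiplicity

Even : ℤ → Set
Even z = + 2 ∣ z

odd : ℤ → ℤ
odd z = + (∣ z ∣ ℕ.% 2)

even-+ : ∀ {a b} → Even a → Even b → Even (a + b)
even-+ {a} {b} (divides p e) (divides q f) = divides (p + q) (trans (cong₂ _+_ e f) (sym (ℤ.*-distribʳ-+ (+ 2) p q)))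

even-* : ∀ {a} c → Even a → Even (a * c)
even-* c (divides p e) = divides (p * c) (trans (cong (_* c) e) (r p c))
  where r : ∀ p c → p * + 2 * c ≡ p * c * + 2
        r = solve-∀

even-double : ∀ a → Even (a + a)
even-double a = divides a (r a)
  where r : ∀ a → a + a ≡ a * + 2
        r = solve-∀

even-- : ∀ {a} → Even a → Even (- a)
even-- (divides p e) = divides (- p) (trans (cong -_ e) (ℤ.neg-distribˡ-* p (+ 2)))

parityℕ : ∀ n → (∃ λ q → n ≡ q ℕ.* 2 × n ℕ.% 2 ≡ 0) ⊎ (∃ λ q → n ≡ suc (q ℕ.* 2) × n ℕ.% 2 ≡ 1)
parityℕ zero = inj₁ (0 , refl , refl)
parityℕ (suc zero) = inj₂ (0 , refl , refl)
parityℕ (suc (suc n)) with parityℕ n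
... | inj₁ (q , e , f) = inj₁ (suc q , cong (2 ℕ.+_) e , trans (cong (ℕ._% 2) (ℕ.+-comm 2 n)) (trans (ℕ.[m+n]%n≡m%n n 2) f))
... | inj₂ (q , e , f) = inj₂ (suc q , cong (2 ℕ.+_) e , trans (cong (ℕ._% 2) (ℕ.+-comm 2 n)) (trans (ℕ.[m+n]%n≡m%n n 2) f))

parity : ∀ z → (Even z × odd z ≡ 0ℤ) ⊎ (Even (z - 1ℤ) × odd z ≡ 1ℤ)
parity (+ n) with parityℕ n
... | inj₁ (q , e , f) = inj₁ (divides (+ q) (trans (cong +_ e) (ℤ.pos-* q 2)) , cong +_ f)
... | inj₂ (q , refl , f) = inj₂ (divides (+ q) (ℤ.pos-* q 2) , cong +_ f)
parity -[1+ n ] with parityℕ (suc n)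
... | inj₁ (q , e , f) = inj₁ (divides (- (+ q)) (trans (cong (λ m → - (+ m)) e) (trans (cong -_ (ℤ.pos-* q 2)) (ℤ.neg-distribˡ-* (+ q) (+ 2)))) , cong +_ f)
... | inj₂ (q , refl , f) = inj₂ (divides (- (+ q) - 1ℤ) (trans (cong (λ z → - (1ℤ + z) - 1ℤ) (ℤ.pos-* q 2)) (r (+ q))) , cong +_ f)
  where r : ∀ q → - (1ℤ + q * + 2) - 1ℤ ≡ (- q - 1ℤ) * + 2
        r = solve-∀

odd≥0 : ∀ z → 0ℤ ≤ odd z
odd≥0 z = +≤+ ℕ.z≤n

-- Orthogonality to all products of fewer than r linear functionals, as for the codewords of RM(v-r,v).
Orth : ∀ {v} → ℕ → (F2^ v → ℤ) → Set
Orth zero f = ⊤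
Orth (suc r) f = Even (∑ f) × (∀ a → Orth r (off a f))

∑-even : ∀ {v} {f : F2^ v → ℤ} → (∀ x → Even (f x)) → Even (∑ f)
∑-even {v} {f} e = divides (∑ (λ x → _∣_.quotient (e x))) (trans
  (∑-cong (λ x → trans (_∣_.equality (e x)) (ℤ.*-comm _ (+ 2))))
  (trans (∑-* (+ 2) (λ x → _∣_.quotient (e x))) (ℤ.*-comm (+ 2) _)))

orth-≈ : ∀ r {v} {f g : F2^ v → ℤ} → (∀ x → Even (g x - f x)) → Orth r f → Orth r g
orth-≈ zero e o = tt
orth-≈ (suc r) {f = f} {g} e (o , os) =
  subst Even (trans (cong (λ z → ∑ f + z) (∑-- g f)) (alg (∑ f) (∑ g))) (even-+ o (∑-even e)) ,
  λ a → orth-≈ r (λ x → subst Even (alg′ (g x) (f x) (ind a x)) (even-* (ind a x) (e x))) (os a)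
  where
  alg : ∀ a b → a + (b - a) ≡ b
  alg = solve-∀
  alg′ : ∀ a b c → (a - b) * c ≡ a * c - b * c
  alg′ = solve-∀

orth-≡ : ∀ r {v} {f g : F2^ v → ℤ} → (∀ x → f x ≡ g x) → Orth r f → Orth r g
orth-≡ r {f = f} {g} e = orth-≈ r (λ x → divides 0ℤ (ℤ.i≡j⇒i-j≡0 (sym (e x))))

orth-+ : ∀ r {v} {f g : F2^ v → ℤ} → Orth r f → Orth r g → Orth r (λ x → f x + g x)
orth-+ zero o p = tt
orth-+ (suc r) {f = f} {g} (o , os) (p , ps) =
  subst Even (sym (∑-+ f g)) (even-+ o p) ,
  λ a → orth-≡ r (λ x → sym (ℤ.*-distribʳ-+ (ind a x) (f x) (g x))) (orth-+ r (os a) (ps a))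

orth-pred : ∀ r {v} {f : F2^ v → ℤ} → Orth (suc r) f → Orth r f
orth-pred zero o = tt
orth-pred (suc r) (o , os) = o , λ a → orth-pred r (os a)

half₀ half₁ : ∀ {v} → (F2^ (suc v) → ℤ) → F2^ v → ℤ
half₀ f x = f (false ∷ x)
half₁ f x = f (true ∷ x)

orth-merge : ∀ r {v} {f : F2^ (suc v) → ℤ} → Orth r f → Orth r (λ x → half₀ f x + half₁ f x)
orth-merge zero o = tt
orth-merge (suc r) {f = f} (o , os) =
  subst Even (trans (∑-∷ f) (sym (∑-+ (half₀ f) (half₁ f)))) o ,
  λ a → orth-≡ r (λ x → sym (ℤ.*-distribʳ-+ (ind a x) (half₀ f x) (half₁ f x))) (orth-merge r (os (false ∷ a)))

-- Multiplication by the first coordinate isolates the half where it is 1. This uses up one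
-- functional, hence one order of orthogonality.
orth-half₁ : ∀ r {v} {f : F2^ (suc v) → ℤ} → Orth (suc r) f → Orth r (half₁ f)
orth-half₁ r {v} {f} (o , os) = orth-≡ r e (orth-merge r (os (true ∷ zeroVec v)))
  where
  alg : ∀ a b → a * 0ℤ + b * 1ℤ ≡ b
  alg = solve-∀
  e : ∀ x → off (true ∷ zeroVec v) f (false ∷ x) + off (true ∷ zeroVec v) f (true ∷ x) ≡ f (true ∷ x)
  e x = trans (cong (λ b → f (false ∷ x) * bit b + f (true ∷ x) * bit (not b)) (dot-zeroˡ x)) (alg (f (false ∷ x)) (f (true ∷ x)))

orth-half₀ : ∀ r {v} {f : F2^ (suc v) → ℤ} → Orth (suc r) f → Orth r (half₀ f)
orth-half₀ r {f = f} o = orth-≈ r (λ x → subst Even (alg (f (false ∷ x)) (f (true ∷ x))) (even-- (even-double (f (true ∷ x)))))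
    (orth-+ r (orth-merge r (orth-pred r o)) (orth-half₁ r o))
  where alg : ∀ a b → - (b + b) ≡ a - (a + b + b)
        alg = solve-∀

-- Merging the halves keeps the order, and modulo 2 an even half does not contribute to the merged
-- function.
orth-drop₁ : ∀ r {v} {f : F2^ (suc v) → ℤ} → Orth r f → (∀ x → Even (half₁ f x)) → Orth r (half₀ f)
orth-drop₁ r {f = f} o e = orth-≈ r (λ x → subst Even (alg (half₀ f x) (half₁ f x)) (even-- (e x))) (orth-merge r o)
  where alg : ∀ a b → - b ≡ a - (a + b)
        alg = solve-∀

orth-drop₀ : ∀ r {v} {f : F2^ (suc v) → ℤ} → Orth r f → (∀ x → Even (half₀ f x)) → Orth r (half₁ f)
orth-drop₀ r {f = f} o e = orth-≈ r (λ x → subst Even (alg (half₀ f x) (half₁ f x)) (even-- (e x))) (orth-merge r o)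
  where alg : ∀ a b → - a ≡ b - (a + b)
        alg = solve-∀

AllEven : ∀ {v} → (F2^ v → ℤ) → Set
AllEven f = ∀ x → Even (f x)

evens : ∀ {v} {f : F2^ (suc v) → ℤ} → AllEven (half₀ f) → AllEven (half₁ f) → AllEven f
evens a b (false ∷ x) = a x
evens a b (true ∷ x) = b x

odds : ∀ {v} → (F2^ v → ℤ) → ℤ
odds f = ∑ (λ x → odd (f x))

odds≥0 : ∀ {v} (f : F2^ v → ℤ) → 0ℤ ≤ odds f
odds≥0 f = ∑-nonneg (λ x → odd≥0 (f x))

odds-∷ : ∀ {v} (f : F2^ (suc v) → ℤ) → odds f ≡ odds (half₀ f) + odds (half₁ f)
odds-∷ f = ∑-∷ (λ x → odd (f x))

-- The minimum distance of RM(v-r,v) is 2^r, by the (u | u+v) construction.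
minimum-weight : ∀ v r (f : F2^ v → ℤ) → Orth r f → AllEven f ⊎ size r ≤ odds f
minimum-weight zero zero f o with parity (f [])
... | inj₁ (e , _) = inj₁ (λ { [] → e })
... | inj₂ (_ , e) = inj₂ (ℤ.≤-reflexive (sym (trans (∑-[] (λ x → odd (f x))) e)))
minimum-weight zero (suc r) f (o , _) = inj₁ (λ { [] → subst Even (∑-[] f) o })
minimum-weight (suc v) r f o = go r o
  where
  left : ∀ {c} → c ≤ odds (half₀ f) → c ≤ odds f
  left {c} p = subst₂ _≤_ (ℤ.+-identityʳ c) (sym (odds-∷ f)) (ℤ.+-mono-≤ p (odds≥0 (half₁ f)))
  right : ∀ {c} → c ≤ odds (half₁ f) → c ≤ odds f
  right {c} p = subst₂ _≤_ (ℤ.+-identityˡ c) (sym (odds-∷ f)) (ℤ.+-mono-≤ (odds≥0 (half₀ f)) p)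
  double : ∀ s → s + s ≡ + 2 * s
  double = solve-∀
  go : ∀ r → Orth r f → AllEven f ⊎ size r ≤ odds f
  go zero o with minimum-weight v 0 (half₀ f) tt | minimum-weight v 0 (half₁ f) tt
  ... | inj₁ a | inj₁ b = inj₁ (evens a b)
  ... | inj₂ a | _ = inj₂ (left a)
  ... | inj₁ _ | inj₂ b = inj₂ (right b)
  go (suc r) o
    with minimum-weight v r (half₁ f) (orth-half₁ r o) | minimum-weight v r (half₀ f) (orth-half₀ r o)
  ... | inj₁ b | _ = [ (λ a → inj₁ (evens a b)) , (λ a → inj₂ (left a)) ]′
                       (minimum-weight v (suc r) (half₀ f) (orth-drop₁ (suc r) o b))
  ... | inj₂ _ | inj₁ a = [ (λ b → inj₁ (evens a b)) , (λ b → inj₂ (right b)) ]′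
                            (minimum-weight v (suc r) (half₁ f) (orth-drop₀ (suc r) o a))
  ... | inj₂ b | inj₂ a = inj₂ (subst₂ _≤_ (double (size r)) (sym (odds-∷ f)) (ℤ.+-mono-≤ a b))

divides-off : ∀ k {v} {M : F2^ v → ℤ} → (∀ h → + (2 ℕ.^ suc k) ∣ wt M h) → ∀ a h → + (2 ℕ.^ k) ∣ wt (off a M) h
divides-off k {M = M} d a h with d a | d h | d (a ⊕ h)
... | divides p e | divides q e₂ | divides s e₃ = divides (p + q - s)
  (ℤ.*-cancelˡ-≡ (+ 2) _ _ (trans (wt-off a h M) (trans (cong₂ _-_ (cong₂ _+_ e e₂) e₃)
    (trans (cong (λ z → p * z + q * z - s * z) (ℤ.pos-* 2 (2 ℕ.^ k))) (alg p q s (+ (2 ℕ.^ k)))))))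
  where alg : ∀ p q s d → p * (+ 2 * d) + q * (+ 2 * d) - s * (+ 2 * d) ≡ + 2 * ((p + q - s) * d)
        alg = solve-∀

-- By `wt-off` each functional after the first costs one factor 2, so products of up to k
-- functionals still have even sum. The empty product is the hypothesis on `∑ M`.
orthogonal : ∀ k {v} {M : F2^ v → ℤ} → (∀ h → + (2 ℕ.^ k) ∣ wt M h) → Even (∑ M) → Orth (suc k) M
orthogonal zero d e = e , λ _ → tt
orthogonal (suc k) {M = M} d e = e , λ a → orthogonal k (divides-off k {M = M} d a) (ev (d a))
  where
  ev : ∀ {z} → + (2 ℕ.^ suc k) ∣ z → Even z
  ev (divides q eq) = divides (q * + (2 ℕ.^ k)) (trans eq (trans (cong (q *_) (ℤ.pos-* 2 (2 ℕ.^ k))) (alg q (+ (2 ℕ.^ k)))))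
    where alg : ∀ q d → q * (+ 2 * d) ≡ q * d * + 2
          alg = solve-∀

odd-points : ∀ k {μ n v} {K : F2^ v → ℤ} → Aff (2 ℕ.^ k) μ n K → Even (+ n) → AllEven K ⊎ size (suc k) ≤ odds K
odd-points k {v = v} {K} A e = minimum-weight v (suc k) K (orthogonal k (div A) (subst Even (sym (total A)) e))

-- Moving the origin

δ≥0 : ∀ {v} (x : F2^ v) → 0ℤ ≤ δ x
δ≥0 x with δ-0or1 x
... | inj₁ e = ℤ.≤-reflexive (sym e)
... | inj₂ e = subst (0ℤ ≤_) (sym e) (+≤+ ℕ.z≤n)

wt-δ : ∀ {v} (h : F2^ v) → wt δ h ≡ 0ℤ
wt-δ h = trans (∑-δ (ind h)) (cong bit (dot-zeroʳ h))

wt-translate : ∀ {v} (r h : F2^ v) K →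
  wt (λ x → K (x ⊕ r)) h ≡ wt K h ⊎ wt (λ x → K (x ⊕ r)) h ≡ ∑ K - wt K h
wt-translate r h K = go (dot h r) refl
  where
  s : ∀ b → dot h r ≡ b → wt (λ x → K (x ⊕ r)) h ≡ ∑ (λ y → K y * bit (dot h y xor b))
  s b e = trans (∑-cong (λ x → cong (λ y → K (x ⊕ r) * bit y) (trans (cong (dot h) (sym (⊕-cancelʳ x r)))
              (trans (dot-⊕ʳ h (x ⊕ r) r) (cong (dot h (x ⊕ r) xor_) e)))))
            (∑-translate r (λ y → K y * bit (dot h y xor b)))
  xor-f : ∀ a → bit (a xor false) ≡ bit a
  xor-f true = refl
  xor-f false = refl
  xor-t : ∀ a → bit (a xor true) ≡ 1ℤ - bit a
  xor-t true = refl
  xor-t false = refl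
  go : ∀ b → dot h r ≡ b → wt (λ x → K (x ⊕ r)) h ≡ wt K h ⊎ wt (λ x → K (x ⊕ r)) h ≡ ∑ K - wt K h
  go false e = inj₁ (trans (s false e) (∑-cong (λ y → cong (K y *_) (xor-f (dot h y)))))
  go true e = inj₂ (trans (s true e) (trans (∑-cong (λ y → cong (K y *_) (xor-t (dot h y)))) (∑-on h K)))

∣-- : ∀ {d a b} → d ∣ a → d ∣ b → d ∣ a - b
∣-- {d} (divides p e) (divides q f) = divides (p - q) (trans (cong₂ _-_ e f) (alg p q d))
  where alg : ∀ p q d → p * d - q * d ≡ (p - q) * d
        alg = solve-∀

-- A translation replaces some weights w by N - w, which is harmless since Δ divides N; clearing the
-- new origin changes no weight, because every functional vanishes there.
recenter : ∀ {Δ μ N v} {K : F2^ v → ℤ} → Aff Δ μ N K → + Δ ∣ + N → ∀ r m n → K r ≡ + m → n ℕ.+ m ≡ N →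
  Pts Δ μ n (λ x → K (x ⊕ r) - + m * δ x)
recenter {Δ} {μ} {N} {v} {K} A dN r m n Kr e = record
  { nonneg = λ x → pos x (δ-cases x)
  ; bound = λ x → ℤ.≤-trans (≤-by (alg (K (x ⊕ r)) (+ m) (δ x)) (nat≥0 {m} ⊠ δ≥0 x)) (bound A (x ⊕ r))
  ; total = trans (∑-- (λ x → K (x ⊕ r)) (λ x → + m * δ x))
      (trans (cong₂ _-_ (trans (∑-translate r K) (total A)) (trans (∑-* {v} (+ m) δ) (cong (+ m *_) (∑δ v))))
        (trans (cong (λ z → + z - + m * 1ℤ) (sym e)) (trans (cong (_- + m * 1ℤ) (ℤ.pos-+ n m)) (alg₂ (+ n) (+ m)))))
  ; div = λ h → subst (+ Δ ∣_) (sym (w h)) (d h (wt-translate r h K)) } ,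
  at0 (zeroVec v) refl
  where
  alg : ∀ k m d → k - (k - m * d) ≡ m * d
  alg = solve-∀
  alg₂ : ∀ n m → n + m - m * 1ℤ ≡ n
  alg₂ = solve-∀
  at0 : ∀ x → x ≡ zeroVec v → K (x ⊕ r) - + m * δ x ≡ 0ℤ
  at0 _ refl = trans (cong₂ (λ a b → a - + m * b) (trans (cong K (⊕-identityˡ r)) Kr) (δ-zero v))
    (trans (cong (λ z → + m - z) (ℤ.*-identityʳ (+ m))) (ℤ.+-inverseʳ (+ m)))
  pos : ∀ x → _ → 0ℤ ≤ K (x ⊕ r) - + m * δ x
  pos x (inj₁ (z , _)) = ℤ.≤-reflexive (sym (at0 x z))
  pos x (inj₂ (_ , z)) = subst (0ℤ ≤_) (sym (trans (cong (λ d → K (x ⊕ r) - + m * d) z)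
    (trans (cong (λ d → K (x ⊕ r) - d) (ℤ.*-zeroʳ (+ m))) (ℤ.+-identityʳ _)))) (nonneg A (x ⊕ r))
  w : ∀ h → wt (λ x → K (x ⊕ r) - + m * δ x) h ≡ wt (λ x → K (x ⊕ r)) h
  w h = trans (∑-cong (λ x → alg₄ (K (x ⊕ r)) (+ m) (δ x) (ind h x)))
    (trans (∑-- (λ x → K (x ⊕ r) * ind h x) (λ x → + m * (δ x * ind h x)))
    (trans (cong (λ z → wt (λ x → K (x ⊕ r)) h - z) (trans (∑-* (+ m) (λ x → δ x * ind h x)) (trans (cong (+ m *_) (wt-δ h)) (ℤ.*-zeroʳ (+ m)))))
      (ℤ.+-identityʳ _)))
    where alg₄ : ∀ k m d i → (k - m * d) * i ≡ k * i - m * (d * i)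
          alg₄ = solve-∀
  d : ∀ h → _ → + Δ ∣ wt (λ x → K (x ⊕ r)) h
  d h (inj₁ e) = subst (+ Δ ∣_) (sym e) (div A h)
  d h (inj₂ e) = subst (+ Δ ∣_) (sym e) (∣-- (subst (+ Δ ∣_) (sym (total A)) dN) (div A h))

withOrigin : ∀ {v} → ℕ → (F2^ v → ℤ) → F2^ v → ℤ
withOrigin a M x = M x + + a * δ x

add-origin : ∀ {Δ μ n v} {M : F2^ v → ℤ} → Pts Δ μ n M → ∀ a → a ℕ.≤ μ → Aff Δ μ (n ℕ.+ a) (withOrigin a M)
add-origin {Δ} {μ} {n} {v} {M} (A , M0) a le = record
  { nonneg = λ x → nonneg A x ⊞ nat≥0 {a} ⊠ δ≥0 x
  ; bound = λ x → bd x (δ-cases x)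
  ; total = trans (∑-+ M (λ x → + a * δ x)) (trans (cong₂ _+_ (total A) (trans (∑-* {v} (+ a) δ) (trans (cong (+ a *_) (∑δ v)) (ℤ.*-identityʳ (+ a)))))
      (sym (ℤ.pos-+ n a)))
  ; div = λ h → subst (+ Δ ∣_) (sym (trans (wt-+ M (λ x → + a * δ x) h)
      (trans (cong (λ z → wt M h + z) (trans (wt-* (+ a) δ h) (trans (cong (+ a *_) (wt-δ h)) (ℤ.*-zeroʳ (+ a))))) (ℤ.+-identityʳ _)))) (div A h) }
  where
  bd : ∀ x → _ → M x + + a * δ x ≤ + μ
  bd x (inj₁ (refl , z)) = subst (_≤ + μ) (sym (trans (cong₂ (λ p q → p + + a * q) M0 z) (trans (ℤ.+-identityˡ _) (ℤ.*-identityʳ (+ a))))) (+≤+ le)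
  bd x (inj₂ (_ , z)) = subst (_≤ + μ) (sym (trans (cong (λ q → M x + + a * q) z) (trans (cong (λ q → M x + q) (ℤ.*-zeroʳ (+ a))) (ℤ.+-identityʳ _)))) (bound A x)

withOrigin-nonzero : ∀ {v} a (M : F2^ v → ℤ) x → ¬ (x ≡ zeroVec v) → withOrigin a M x ≡ M x
withOrigin-nonzero a M x ne = trans (cong (λ d → M x + + a * d) (δ-nonzero x ne)) (trans (cong (λ z → M x + z) (ℤ.*-zeroʳ (+ a))) (ℤ.+-identityʳ (M x)))

no-multiplicity : ∀ {Δ μ n v} {M : F2^ v → ℤ} → Pts Δ μ n M → ∀ a m n′ → a ℕ.≤ μ → + Δ ∣ + (n ℕ.+ a) →
  n′ ℕ.+ suc m ≡ n ℕ.+ a → Ex Δ μ n′ → ∀ x → ¬ (M x ≡ + suc m)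
no-multiplicity {v = v} {M} P@(A , M0) a m n′ le d e ex x Mx = ex _
  (recenter (add-origin P a le) d x (suc m) n′ (trans (withOrigin-nonzero a M x ne) Mx) e)
  where
  ne : ¬ (x ≡ zeroVec v)
  ne refl with trans (sym M0) Mx
  ... | ()

values : ∀ {Δ μ n v} {M : F2^ v → ℤ} → Aff Δ μ n M → ∀ x → ∃ λ m → M x ≡ + m × m ℕ.≤ μ
values A x with toℕ≥0 (nonneg A x)
... | m , e = m , e , ℤ.drop‿+≤+ (subst (_≤ _) e (bound A x))

Never : ∀ {v} → (F2^ v → ℤ) → ℕ → Set
Never M m = ∀ x → ¬ (M x ≡ + m)

-- Sum of the pointwise inequality m² + d(m mod 2) ≤ cm, checked for each multiplicity m outside X.
-- The more odd points parity forces, the smaller `∑² M` must be.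
quadratic-bound : ∀ {Δ μ n v} {M : F2^ v → ℤ} {X} → Aff Δ μ n M → All (Never M) X → ∀ c d →
  T (allBelow (suc μ) (λ m → (m ∈ᵇ X) ∨ (m ℕ.* m ℕ.+ d ℕ.* (m ℕ.% 2) ℕ.≤ᵇ c ℕ.* m))) → ∑² M + + d * odds M ≤ + c * + n
quadratic-bound {μ = μ} {M = M} {X} A ex c d ok = subst₂ _≤_
    (trans (∑-+ (λ x → M x * M x) (λ x → + d * odd (M x))) (cong (λ z → ∑² M + z) (∑-* (+ d) (λ x → odd (M x)))))
    (trans (∑-* (+ c) M) (cong (+ c *_) (total A)))
    (∑-mono le)
  where
  le : ∀ x → M x * M x + + d * odd (M x) ≤ + c * M x
  le x with values A x
  ... | m , e , m≤μ = subst (λ z → z * z + + d * odd z ≤ + c * z) (sym e) (go _ (allBelow-sound (suc μ) _ ok m (ℕ.s≤s m≤μ)) refl)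
    where
    go : ∀ b → T (b ∨ (m ℕ.* m ℕ.+ d ℕ.* (m ℕ.% 2) ℕ.≤ᵇ c ℕ.* m)) → (m ∈ᵇ X) ≡ b → + m * + m + + d * odd (+ m) ≤ + c * + m
    go true t eq = ⊥-elim (lookupᵇ m ex (subst T (sym eq) tt) x e)
    go false t eq = subst₂ _≤_ (trans (ℤ.pos-+ (m ℕ.* m) _) (cong₂ _+_ (ℤ.pos-* m m) (ℤ.pos-* d (m ℕ.% 2)))) (ℤ.pos-* c m)
      (+≤+ (ℕ.≤ᵇ⇒≤ _ _ t))

odd-+δ : ∀ {v} {M : F2^ v → ℤ} → M (zeroVec v) ≡ 0ℤ → ∀ x → odd (withOrigin 1 M x) ≡ odd (M x) + δ x
odd-+δ {M = M} M0 x with δ-cases x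
... | inj₁ (refl , z) = trans (cong₂ (λ a b → odd (a + 1ℤ * b)) M0 z) (sym (cong₂ (λ a b → odd a + b) M0 z))
... | inj₂ (ne , z) = trans (cong odd (withOrigin-nonzero 1 M x ne)) (sym (trans (cong (λ b → odd (M x) + b) z) (ℤ.+-identityʳ _)))

-- Weight 1 at the origin makes the total even and rules out that all values are even. The origin is
-- then one of the odd points, which explains the `+ 1ℤ`.
odd-many : ∀ k {μ n v} {M : F2^ v → ℤ} → Pts (2 ℕ.^ k) μ n M → 1 ℕ.≤ μ → Even (+ (n ℕ.+ 1)) → size (suc k) ≤ odds M + 1ℤ
odd-many k {v = v} {M} P@(A , M0) le ev with odd-points k (add-origin P 1 le) ev
... | inj₂ p = subst (size (suc k) ≤_) (trans (∑-cong (odd-+δ {M = M} M0)) (trans (∑-+ (λ x → odd (M x)) δ) (cong (λ z → odds M + z) (∑δ v)))) p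
... | inj₁ e with subst Even (trans (cong₂ (λ a b → a + 1ℤ * b) M0 (δ-zero v)) refl) (e (zeroVec v))
...   | divides (+ zero) ()
...   | divides (+ suc n) ()
...   | divides -[1+ n ] ()

halve : ∀ {δ μ n v} {M : F2^ v → ℤ} → Pts (2 ℕ.* suc δ) (2 ℕ.* μ ℕ.+ 1) (2 ℕ.* n) M → AllEven M → ∃ λ D → Pts {v} (suc δ) μ n D
halve {δ} {μ} {n} {v} {M} (A , M0) ev = D , record
  { nonneg = λ x → ℤ.*-cancelˡ-≤-pos 0ℤ (D x) (+ 2) (subst (0ℤ ≤_) (D2 x) (nonneg A x))
  ; bound = λ x → bd x
  ; total = ℤ.*-cancelˡ-≡ (+ 2) _ _ (trans (sym (∑-* (+ 2) D)) (trans (sym (∑-cong D2)) (trans (total A) (ℤ.pos-* 2 n))))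
  ; div = dv } , ℤ.*-cancelˡ-≡ (+ 2) (D (zeroVec v)) 0ℤ (trans (sym (D2 (zeroVec v))) M0)
  where
  D : F2^ v → ℤ
  D x = _∣_.quotient (ev x)
  D2 : ∀ x → M x ≡ + 2 * D x
  D2 x = trans (_∣_.equality (ev x)) (ℤ.*-comm (D x) (+ 2))
  bd : ∀ x → D x ≤ + μ
  bd x with D x ℤ.≤? + μ
  ... | yes p = p
  ... | no p = ⊥-elim (impossible 0 (gap le ⊞ nat≥0 {2} ⊠ gap (ℤ.i<j⇒suc[i]≤j (ℤ.≰⇒> p))) (alg (D x) (+ μ)))
    where
    le : + 2 * D x ≤ + 2 * + μ + 1ℤ
    le = subst₂ _≤_ (D2 x) (trans (ℤ.pos-+ (2 ℕ.* μ) 1) (cong (_+ 1ℤ) (ℤ.pos-* 2 μ))) (bound A x)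
    alg : ∀ d m → (+ 2 * m + 1ℤ - + 2 * d) + + 2 * (d - (1ℤ + m)) ≡ -[1+ 0 ]
    alg = solve-∀
  dv : ∀ h → + suc δ ∣ wt D h
  dv h with div A h
  ... | divides q e = divides q (ℤ.*-cancelˡ-≡ (+ 2) _ _ (trans (sym (wt-* (+ 2) D h))
    (trans (∑-cong (λ x → cong (_* ind h x) (sym (D2 x)))) (trans e (trans (cong (q *_) (ℤ.pos-* 2 (suc δ))) (alg q (+ suc δ)))))))
    where alg : ∀ q d → q * (+ 2 * d) ≡ + 2 * (q * d)
          alg = solve-∀

ex-weaken : ∀ {Δ μ μ′ n} → μ ℕ.≤ μ′ → Ex Δ μ′ n → Ex Δ μ n
ex-weaken p ex M (A , M0) = ex M (weaken p A , M0)

-- Small sizes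

-- A triple point would leave 9 points. Otherwise at least 7 points are odd and `∑² M` ≤ 22 - 7 =
-- 15, whereas (x - 3)(x + 5) requires at least 16.
exclude₄-11 : Ex 4 3 11
exclude₄-11 M P@(A , _) = clash (∑² M) (odds M)
    (second 1 P (exclude₂ 3) -[1+ 14 ] (+ 2) _ (+≤+ (ℕ.s≤s ℕ.z≤n)))
    (quadratic-bound A (no-multiplicity P 1 2 9 (ℕ.s≤s ℕ.z≤n) (divides (+ 3) refl) refl (lookupᵇ 9 (exclude₄ 3) tt) ∷ []) 2 1 tt)
    (odd-many 2 P (ℕ.s≤s ℕ.z≤n) (divides (+ 6) refl))
  where
  alg : ∀ e o → (-[1+ 14 ] + e - 1ℤ) + (+ 22 - (e + 1ℤ * o)) + (o + 1ℤ - + 8) ≡ -[1+ 0 ]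
  alg = solve-∀
  clash : ∀ e o → 1ℤ ≤ -[1+ 14 ] + e → e + 1ℤ * o ≤ + 22 → + 8 ≤ o + 1ℤ → ⊥
  clash e o p q r = impossible 0 (gap p ⊞ gap q ⊞ gap r) (alg e o)

exclude₄-below-4 : All (Ex 4 3) (11 ∷ 4 ∷ 1 ∷ 2 ∷ 3 ∷ 5 ∷ 9 ∷ [])
exclude₄-below-4 = exclude₄-11 ∷ exclude₄-4 ∷ exclude₄ 3

exclude₄-below-2 : All (Ex 4 1) (4 ∷ 6 ∷ 10 ∷ 11 ∷ 12 ∷ 13 ∷ 1 ∷ 2 ∷ 3 ∷ 5 ∷ 9 ∷ [])
exclude₄-below-2 = ex-weaken (ℕ.s≤s ℕ.z≤n) exclude₄-4
  ∷ exclude 1 exclude₂-1 6 averaging _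
  ∷ exclude 1 exclude₂-1 10 averaging _
  ∷ ex-weaken (ℕ.s≤s ℕ.z≤n) exclude₄-11
  ∷ exclude 1 exclude₂-1 12 (x²+ + 0 x+ -[1+ 15 ]) _
  ∷ exclude 1 exclude₂-1 13 (x²+ -[1+ 1 ] x+ -[1+ 14 ]) _
  ∷ exclude₄ 1

-- With weight 2 at the origin, multiplicities 3, 5, 6, 7 would leave 21, 19, 18, 17 points. If all
-- values are even, halving gives the excluded size 11; otherwise 16 odd points force `∑² M` ≤ 88 -
-- 48 = 40, whereas (x - 6)(x + 10) requires at least 61.
exclude₈-22 : Ex 8 7 22
exclude₈-22 M P@(A , _) = [ (λ ev → exclude₄-11 _ (proj₂ (halve {3} {3} {11} P ev))) ,
    (λ o → clash (∑² M) (odds M) (second 3 P (exclude₄ 7) -[1+ 59 ] (+ 4) _ (+≤+ (ℕ.s≤s ℕ.z≤n))) (few A) o) ]′ (odd-points 3 A (divides (+ 11) refl))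
  where
  never : ∀ m n′ → n′ ℕ.+ suc m ≡ 24 → Ex 8 7 n′ → Never M (suc m)
  never m n′ = no-multiplicity P 2 m n′ (ℕ.s≤s (ℕ.s≤s ℕ.z≤n)) (divides (+ 3) refl)
  few : Aff 8 7 22 M → ∑² M + + 3 * odds M ≤ + 88
  few A = quadratic-bound A (never 2 21 refl (lookupᵇ 21 (exclude₈ 7) tt) ∷ never 4 19 refl (lookupᵇ 19 (exclude₈ 7) tt)
    ∷ never 5 18 refl (lookupᵇ 18 (exclude₈ 7) tt) ∷ never 6 17 refl (lookupᵇ 17 (exclude₈ 7) tt) ∷ []) 4 3 tt
  alg : ∀ e o → (-[1+ 59 ] + e - 1ℤ) + (+ 88 - (e + + 3 * o)) + + 3 * (o - + 16) ≡ -[1+ 20 ]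
  alg = solve-∀
  clash : ∀ e o → 1ℤ ≤ -[1+ 59 ] + e → e + + 3 * o ≤ + 88 → + 16 ≤ o → ⊥
  clash e o p q r = impossible 20 (gap p ⊞ gap q ⊞ nat≥0 {3} ⊠ gap r) (alg e o)

exclude₈-23 : Ex 8 7 23
exclude₈-23 M P@(A , _) = clash (∑² M) (odds M) (second 3 P (exclude₄ 7) -[1+ 62 ] (+ 2) _ (+≤+ (ℕ.s≤s ℕ.z≤n)))
    few (odd-many 3 P (ℕ.s≤s ℕ.z≤n) (divides (+ 12) refl))
  where
  never : ∀ m n′ → n′ ℕ.+ suc m ≡ 24 → Ex 8 7 n′ → Never M (suc m)
  never m n′ = no-multiplicity P 1 m n′ (ℕ.s≤s ℕ.z≤n) (divides (+ 3) refl)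
  few : ∑² M + + 3 * odds M ≤ + 92
  few = quadratic-bound A (never 2 21 refl (lookupᵇ 21 (exclude₈ 7) tt) ∷ never 4 19 refl (lookupᵇ 19 (exclude₈ 7) tt)
    ∷ never 5 18 refl (lookupᵇ 18 (exclude₈ 7) tt) ∷ never 6 17 refl (lookupᵇ 17 (exclude₈ 7) tt) ∷ []) 4 3 tt
  alg : ∀ e o → (-[1+ 62 ] + e - 1ℤ) + (+ 92 - (e + + 3 * o)) + + 3 * (o + 1ℤ - + 16) ≡ -[1+ 16 ]
  alg = solve-∀
  clash : ∀ e o → 1ℤ ≤ -[1+ 62 ] + e → e + + 3 * o ≤ + 92 → + 16 ≤ o + 1ℤ → ⊥
  clash e o p q r = impossible 16 (gap p ⊞ gap q ⊞ nat≥0 {3} ⊠ gap r) (alg e o)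

-- Halving would give a 4-divisible set of 12 distinct points; otherwise 16 odd points force `∑² M`
-- ≤ 96 - 48, against at least 65 from x² - 64.
exclude₈-24 : Ex 8 3 24
exclude₈-24 M P@(A , _) = [ (λ ev → lookupᵇ 12 exclude₄-below-2 tt _ (proj₂ (halve {3} {1} {12} P ev))) ,
    (λ o → clash (∑² M) (odds M) (second 3 P (exclude₄ 3) -[1+ 63 ] (+ 0) _ (+≤+ (ℕ.s≤s ℕ.z≤n)))
    (quadratic-bound A [] 4 3 tt) o) ]′ (odd-points 3 A (divides (+ 12) refl))
  where
  alg : ∀ e o → (-[1+ 63 ] + e - 1ℤ) + (+ 96 - (e + + 3 * o)) + + 3 * (o - + 16) ≡ -[1+ 16 ]
  alg = solve-∀
  clash : ∀ e o → 1ℤ ≤ -[1+ 63 ] + e → e + + 3 * o ≤ + 96 → + 16 ≤ o → ⊥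
  clash e o p q r = impossible 16 (gap p ⊞ gap q ⊞ nat≥0 {3} ⊠ gap r) (alg e o)

exclude₈-26 : Ex 8 3 26
exclude₈-26 M P@(A , _) = [ (λ ev → lookupᵇ 13 exclude₄-below-2 tt _ (proj₂ (halve {3} {1} {13} P ev))) ,
    (λ o → clash (∑² M) (odds M) (second 3 P (exclude₄ 3) -[1+ 59 ] -[1+ 3 ] _ (+≤+ (ℕ.s≤s ℕ.z≤n)))
    (quadratic-bound A [] 4 3 tt) o) ]′ (odd-points 3 A (divides (+ 13) refl))
  where
  alg : ∀ e o → (-[1+ 59 ] + e - 1ℤ) + (+ 104 - (e + + 3 * o)) + + 3 * (o - + 16) ≡ -[1+ 4 ]
  alg = solve-∀
  clash : ∀ e o → 1ℤ ≤ -[1+ 59 ] + e → e + + 3 * o ≤ + 104 → + 16 ≤ o → ⊥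
  clash e o p q r = impossible 4 (gap p ⊞ gap q ⊞ nat≥0 {3} ⊠ gap r) (alg e o)

exclude₈-below-4 : ∀ n → T (certified 8 3 n (11 ∷ 4 ∷ 1 ∷ 2 ∷ 3 ∷ 5 ∷ 9 ∷ []) averaging) → Ex 8 3 n
exclude₈-below-4 n = exclude 3 exclude₄-below-4 n averaging

exclude₈-below-2 : All (Ex 8 1) (14 ∷ 28 ∷ 29 ∷ 34 ∷ 36 ∷ 38 ∷ 40 ∷ 42 ∷ 43 ∷ 44 ∷ 52 ∷ 53 ∷ 54 ∷ 55 ∷ 56 ∷ 57 ∷ 58 ∷ [])
exclude₈-below-2 = by 14 averaging _ ∷ by 28 averaging _ ∷ by 29 averaging _ ∷ by 34 averaging _ ∷ by 36 averaging _
  ∷ by 38 (x²+ + 4 x+ -[1+ 59 ]) _ ∷ by 40 (x²+ + 0 x+ -[1+ 63 ]) _ ∷ by 42 (x²+ -[1+ 3 ] x+ -[1+ 59 ]) _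
  ∷ by 43 (x²+ -[1+ 5 ] x+ -[1+ 54 ]) _ ∷ by 44 (x²+ -[1+ 7 ] x+ -[1+ 47 ]) _
  -- The quadratic method fails for 52; this is (52 - x)(x - 4)(x + 12) + 1.
  ∷ by 52 (cubic -[1+ 2494 ] (+ 464) (+ 44) -[1+ 0 ]) _
  ∷ by 53 (x²+ + 6 x+ -[1+ 54 ]) _ ∷ by 54 (x²+ + 4 x+ -[1+ 59 ]) _ ∷ by 55 (x²+ + 2 x+ -[1+ 62 ]) _
  ∷ by 56 (x²+ + 0 x+ -[1+ 63 ]) _ ∷ by 57 (x²+ -[1+ 1 ] x+ -[1+ 62 ]) _ ∷ by 58 (x²+ -[1+ 3 ] x+ -[1+ 59 ]) _ ∷ []
  where
  by : ∀ n p → T (certified 8 1 n (4 ∷ 6 ∷ 10 ∷ 11 ∷ 12 ∷ 13 ∷ 1 ∷ 2 ∷ 3 ∷ 5 ∷ 9 ∷ []) p) → Ex 8 1 n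
  by n p = exclude 3 exclude₄-below-2 n p

-- Projection from a point

-- The quotient by the span of `q`, in the coordinates left after deleting the first one in which
-- `q` is 1; the values on a coset are added. For `q` = 0 the value is a dummy.
quot : ∀ {v} → F2^ (suc v) → (F2^ (suc v) → ℤ) → F2^ v → ℤ
quot (true ∷ q) M y = M (false ∷ y) + M (true ∷ (y ⊕ q))
quot {zero} (false ∷ q) M y = 0ℤ
quot {suc v} (false ∷ q) M (b ∷ y) = quot q (λ x → M (b ∷ x)) y

section : ∀ {v} → F2^ (suc v) → F2^ v → F2^ (suc v)
section (true ∷ q) y = false ∷ y
section {zero} (false ∷ q) y = false ∷ y
section {suc v} (false ∷ q) (b ∷ y) = b ∷ section q y

-- For nonzero `q`, the functional that vanishes at `q` and induces `h` on the quotient.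
lift : ∀ {v} → F2^ (suc v) → F2^ v → F2^ (suc v)
lift (true ∷ q) h = dot h q ∷ h
lift {zero} (false ∷ q) h = false ∷ h
lift {suc v} (false ∷ q) (b ∷ h) = b ∷ lift q h

Nonzero : ∀ {v} → F2^ v → Set
Nonzero {v} x = ¬ (x ≡ zeroVec v)

nonzero-tail : ∀ {v} {x : F2^ v} → Nonzero (false ∷ x) → Nonzero x
nonzero-tail ne refl = ne refl

quot-section : ∀ {v} (q : F2^ (suc v)) M → Nonzero q → ∀ y → quot q M y ≡ M (section q y) + M (section q y ⊕ q)
quot-section (true ∷ q) M ne y = refl
quot-section {zero} (false ∷ []) M ne y = ⊥-elim (ne refl)
quot-section {suc v} (false ∷ q) M ne (b ∷ y) = trans (quot-section q (λ x → M (b ∷ x)) (nonzero-tail ne) y)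
  (cong (λ c → M (b ∷ section q y) + M (c ∷ (section q y ⊕ q))) (sym (xor-identityʳ b)))

section-zero : ∀ {v} (q : F2^ (suc v)) → section q (zeroVec v) ≡ zeroVec (suc v)
section-zero (true ∷ q) = refl
section-zero {zero} (false ∷ q) = refl
section-zero {suc v} (false ∷ q) = cong (false ∷_) (section-zero q)

section-onto : ∀ {v} (q : F2^ (suc v)) → Nonzero q → ∀ x → ∃ λ y → section q y ≡ x ⊎ section q y ≡ x ⊕ q
section-onto (true ∷ q) ne (false ∷ x) = x , inj₁ refl
section-onto (true ∷ q) ne (true ∷ x) = x ⊕ q , inj₂ refl
section-onto {zero} (false ∷ []) ne x = ⊥-elim (ne refl)
section-onto {suc v} (false ∷ q) ne (b ∷ x) with section-onto q (nonzero-tail ne) x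
... | y , inj₁ e = b ∷ y , inj₁ (cong (b ∷_) e)
... | y , inj₂ e = b ∷ y , inj₂ (cong₂ _∷_ (sym (xor-identityʳ b)) e)

-- Projection only selects the functionals vanishing at `q`. So the weights of the quotient are
-- weights of `M`, and divisibility survives; only multiplicities can get worse.
hat-quot : ∀ {v} (q : F2^ (suc v)) M → Nonzero q → ∀ h → hat (quot q M) h ≡ hat M (lift q h)
hat-quot (true ∷ q) M ne h = trans (hat-+ (half₀ M) (λ y → half₁ M (y ⊕ q)) h)
  (trans (cong (λ z → hat (half₀ M) h + z) (hat-translate q (half₁ M) h)) (go (dot h q)))
  where
  go : ∀ b → hat (half₀ M) h + sgn b * hat (half₁ M) h ≡ hat M (b ∷ h)
  go false = trans (cong (λ z → hat (half₀ M) h + z) (ℤ.*-identityˡ _)) (sym (hat-false M h))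
  go true = trans (cong (λ z → hat (half₀ M) h + z) (ℤ.-1*i≡-i _)) (sym (hat-true M h))
hat-quot {zero} (false ∷ []) M ne h = ⊥-elim (ne refl)
hat-quot {suc v} (false ∷ q) M ne (false ∷ h) = trans (hat-false (quot (false ∷ q) M) h)
  (trans (cong₂ _+_ (hat-quot q (half₀ M) (nonzero-tail ne) h) (hat-quot q (half₁ M) (nonzero-tail ne) h)) (sym (hat-false M (lift q h))))
hat-quot {suc v} (false ∷ q) M ne (true ∷ h) = trans (hat-true (quot (false ∷ q) M) h)
  (trans (cong₂ _-_ (hat-quot q (half₀ M) (nonzero-tail ne) h) (hat-quot q (half₁ M) (nonzero-tail ne) h)) (sym (hat-true M (lift q h))))

lift-zero : ∀ {v} (q : F2^ (suc v)) → lift q (zeroVec v) ≡ zeroVec (suc v)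
lift-zero (true ∷ q) = cong (_∷ _) (dot-zeroˡ q)
lift-zero {zero} (false ∷ q) = refl
lift-zero {suc v} (false ∷ q) = cong (false ∷_) (lift-zero q)

∑-quot : ∀ {v} (q : F2^ (suc v)) M → Nonzero q → ∑ (quot q M) ≡ ∑ M
∑-quot {v} q M ne = trans (sym (hat-0 (quot q M))) (trans (hat-quot q M ne (zeroVec v)) (trans (cong (hat M) (lift-zero q)) (hat-0 M)))

wt-quot : ∀ {v} (q : F2^ (suc v)) M → Nonzero q → ∀ h → wt (quot q M) h ≡ wt M (lift q h)
wt-quot q M ne h = ℤ.*-cancelˡ-≡ (+ 2) _ _ (cancel (∑ M) _ _
  (trans (cong (_- + 2 * wt (quot q M) h) (sym (∑-quot q M ne)))
    (trans (sym (hat-wt (quot q M) h)) (trans (hat-quot q M ne h) (hat-wt M (lift q h))))))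
  where
  alg : ∀ a b → b ≡ a - (a - b)
  alg = solve-∀
  cancel : ∀ a b c → a - b ≡ a - c → b ≡ c
  cancel a b c e = trans (alg a b) (trans (cong (λ z → a - z) e) (sym (alg a c)))

aff-quot : ∀ {Δ μ μ′ n v} {M : F2^ (suc v) → ℤ} → Aff Δ μ n M → ∀ q → Nonzero q → (∀ x → M x + M (x ⊕ q) ≤ + μ′) →
  Aff Δ μ′ n (quot q M)
aff-quot {M = M} A q ne b = record
  { nonneg = λ y → subst (0ℤ ≤_) (sym (quot-section q M ne y)) (nonneg A (section q y) ⊞ nonneg A (section q y ⊕ q))
  ; bound = λ y → subst (_≤ _) (sym (quot-section q M ne y)) (b (section q y))
  ; total = trans (∑-quot q M ne) (total A)
  ; div = λ h → subst (+ _ ∣_) (sym (wt-quot q M ne h)) (div A (lift q h)) }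

quot-zero : ∀ {v} (q : F2^ (suc v)) M → Nonzero q → quot q M (zeroVec v) ≡ M (zeroVec (suc v)) + M q
quot-zero q M ne = trans (quot-section q M ne _) (trans (cong (λ x → M x + M (x ⊕ q)) (section-zero q))
  (cong (λ x → M (zeroVec _) + M x) (⊕-identityˡ q)))

-- Averaging

search : ∀ v (g : F2^ v → ℤ) t → (∃ λ x → g x < t) ⊎ size v * t ≤ ∑ g
search zero g t with g [] ℤ.<? t
... | yes p = inj₁ ([] , p)
... | no p = inj₂ (subst₂ _≤_ (sym (ℤ.*-identityˡ t)) (sym (∑-[] g)) (ℤ.≮⇒≥ p))
search (suc v) g t with search v (half₀ g) t | search v (half₁ g) t
... | inj₁ (x , p) | _ = inj₁ (false ∷ x , p)
... | inj₂ _ | inj₁ (x , p) = inj₁ (true ∷ x , p)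
... | inj₂ p | inj₂ q = inj₂ (subst₂ _≤_ (double (size v) t) (sym (∑-∷ g)) (ℤ.+-mono-≤ p q))
  where double : ∀ s t → s * t + s * t ≡ + 2 * s * t
        double = solve-∀

-- The value at the origin is replaced by t, so the origin can never be the element found; this
-- accounts for the correction on the right.
search-nonzero : ∀ v (g : F2^ v → ℤ) t → (∃ λ x → Nonzero x × g x < t) ⊎ size v * t ≤ ∑ g - g (zeroVec v) + t
search-nonzero v g t with search v (λ x → g x + δ x * (t - g x)) t
... | inj₂ p = inj₂ (subst (size v * t ≤_) (trans (∑-+ g (λ x → δ x * (t - g x)))
    (trans (cong (λ z → ∑ g + z) (∑-δ (λ x → t - g x))) (alg (∑ g) (g (zeroVec v)) t))) p)
  where alg : ∀ s a t → s + (t - a) ≡ s - a + t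
        alg = solve-∀
... | inj₁ (x , p) with δ-cases x
...   | inj₁ (_ , d) = ⊥-elim (ℤ.<-irrefl refl (subst (_< t) (trans (cong (λ z → g x + z * (t - g x)) d) (alg (g x) t)) p))
  where alg : ∀ a t → a + 1ℤ * (t - a) ≡ t
        alg = solve-∀
...   | inj₂ (ne , d) = inj₁ (x , ne , subst (_< t) (trans (cong (λ z → g x + z * (t - g x)) d) (alg (g x) t)) p)
  where alg : ∀ a t → a + 0ℤ * (t - a) ≡ a
        alg = solve-∀

∑-≥-point : ∀ {v} (f : F2^ v → ℤ) → (∀ x → 0ℤ ≤ f x) → ∀ x → f x ≤ ∑ f
∑-≥-point f p x = subst (f x ≤_) (∑-translate x f)
  (∑-≥-origin (λ y → f (y ⊕ x)) (λ y → p (y ⊕ x)) (ℤ.≤-reflexive (cong f (sym (⊕-identityˡ x)))))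

∑-conv : ∀ {v} (f g : F2^ v → ℤ) → ∑ (conv f g) ≡ ∑ f * ∑ g
∑-conv {v} f g = trans (sym (hat-0 (conv f g))) (trans (hat-conv f g (zeroVec v)) (cong₂ _*_ (hat-0 f) (hat-0 g)))

conv-zero : ∀ {v} (f g : F2^ v → ℤ) → conv f g (zeroVec v) ≡ ∑ (λ x → f x * g x)
conv-zero f g = ∑-cong (λ x → cong (λ y → f x * g y) (⊕-identityʳ x))

-- Thirty-seven points

step : ℕ → ℕ → ℕ
step k m = if k ℕ.≤ᵇ m then 1 else 0

thr : ℕ → ℤ → ℤ
thr k z = + step k ∣ z ∣

linear-bound : ∀ {Δ μ n v} {M : F2^ v → ℤ} → Aff Δ μ n M → (w : ℕ → ℕ) →
  T (allBelow (suc μ) (λ m → w m ℕ.≤ᵇ m)) → ∑ (λ x → + w ∣ M x ∣) ≤ + n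
linear-bound {μ = μ} {M = M} A w ok = subst (∑ (λ x → + w ∣ M x ∣) ≤_) (total A) (∑-mono le)
  where
  le : ∀ x → + w ∣ M x ∣ ≤ M x
  le x with values A x
  ... | m , e , m≤μ = subst (λ z → + w ∣ z ∣ ≤ z) (sym e) (+≤+ (ℕ.≤ᵇ⇒≤ (w m) m (allBelow-sound (suc μ) (λ m → w m ℕ.≤ᵇ m) ok m (ℕ.s≤s m≤μ))))

light-pair : ∀ m m′ → m ℕ.< 7 → m′ ℕ.< 7 → step 4 m ℕ.* step 2 m′ ≡ 0 → step 4 m′ ℕ.* step 2 m ≡ 0 → m ℕ.+ m′ ℕ.≤ 7
light-pair m m′ lt lt′ e e′ = ℕ.≤ᵇ⇒≤ (m ℕ.+ m′) 7 (go _ _ e e′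
    (allBelow-sound 7 (light m) (allBelow-sound 7 (λ m → allBelow 7 (light m)) tt m lt) m′ lt′))
  where
  test : ℕ → ℕ → Bool → Bool
  test zero zero b = b
  test _ _ b = true
  light : ℕ → ℕ → Bool
  light m m′ = test (step 4 m ℕ.* step 2 m′) (step 4 m′ ℕ.* step 2 m) (m ℕ.+ m′ ℕ.≤ᵇ 7)
  go : ∀ a b → a ≡ 0 → b ≡ 0 → ∀ {c} → T (test a b c) → T c
  go _ _ refl refl t = t

-- Here s, g, f count the points of multiplicity at least 1, 2, 4, and o those of odd multiplicity.
-- If f ≥ 1, then g ≤ 11 - f and s + fg - f + 1 ≤ 47 - (f - 4)(f - 5) ≤ 47, short of 64; if f = 0,
-- already s ≤ 37 is too small.
module Budget where
  consecutive : ∀ z → 0ℤ ≤ (z - + 4) * (z - + 5)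
  consecutive z = subst (0ℤ ≤_) (alg z) (gap (square-≥ (z - + 4)))
    where alg : ∀ z → (z - + 4) * (z - + 4) - (z - + 4) ≡ (z - + 4) * (z - + 5)
          alg = solve-∀
  alg₁ : ∀ s g f o → + 2 * (+ 37 - (s + g + (f + f))) + + 2 * (s + f * g - f + 1ℤ - + 64)
      + (f - 1ℤ) * ((+ 37 - ((g + g) + (f + f) + o)) + (o + 1ℤ - + 16)) + + 2 * ((f - + 4) * (f - + 5)) ≡ -[1+ 33 ]
  alg₁ = solve-∀
  alg₂ : ∀ s g f → (+ 37 - (s + g + (f + f))) + (s + f * g - f + 1ℤ - + 64) + g + (0ℤ - f) * g + + 3 * f ≡ -[1+ 25 ]
  alg₂ = solve-∀
  clash₁ : ∀ s g f o → s + g + (f + f) ≤ + 37 → (g + g) + (f + f) + o ≤ + 37 → + 16 ≤ o + 1ℤ → 1ℤ ≤ f →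
    + 64 ≤ s + f * g - f + 1ℤ → ⊥
  clash₁ s g f o p q r h t = impossible 33
    (nat≥0 {2} ⊠ gap p ⊞ nat≥0 {2} ⊠ gap t ⊞ gap h ⊠ (gap q ⊞ gap r) ⊞ nat≥0 {2} ⊠ consecutive f)
    (alg₁ s g f o)
  clash : ∀ s g f o → s + g + (f + f) ≤ + 37 → (g + g) + (f + f) + o ≤ + 37 → + 16 ≤ o + 1ℤ → 0ℤ ≤ f → 0ℤ ≤ g →
    + 64 ≤ s + f * g - f + 1ℤ → ⊥
  clash s g f o p q r f≥0 g≥0 t = [ (λ h → impossible 25 (gap p ⊞ gap t ⊞ g≥0 ⊞ gap h ⊠ g≥0 ⊞ nat≥0 {3} ⊠ f≥0) (alg₂ s g f)) ,
      (λ h → clash₁ s g f o p q r h t) ]′ (zero-or-positive f f≥0)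
    where
    zero-or-positive : ∀ f → 0ℤ ≤ f → f ≤ 0ℤ ⊎ 1ℤ ≤ f
    zero-or-positive (+ zero) _ = inj₁ ℤ.≤-refl
    zero-or-positive (+ suc n) _ = inj₂ (+≤+ (ℕ.s≤s ℕ.z≤n))

module _ {v} {M : F2^ v → ℤ} (P : Pts 8 7 37 M) where
  private
    A = proj₁ P
    heavy middle : F2^ v → ℤ
    heavy x = thr 4 (M x)
    middle x = thr 2 (M x)
    S G F : ℤ
    S = ∑ (λ x → thr 1 (M x))
    G = ∑ middle
    F = ∑ heavy

  -- A nonzero q with badness 0 lies outside M, and no line {x, x + q, q} carries more than 7
  -- on {x, x + q}, since 8 = 6 + 2 = 5 + 3 = 4 + 4 and 7 does not occur.
  badness : F2^ v → ℤ
  badness q = thr 1 (M q) + conv heavy middle q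

  never-7 : Never M 7
  never-7 = no-multiplicity P 3 6 33 (ℕ.s≤s (ℕ.s≤s (ℕ.s≤s ℕ.z≤n))) (divides (+ 5) refl) refl (lookupᵇ 33 (exclude₈ 7) tt)

  ∑-badness : ∑ badness - badness (zeroVec v) ≡ S + F * G - F
  ∑-badness = cong₂ _-_ (trans (∑-+ (λ x → thr 1 (M x)) (conv heavy middle)) (cong (λ z → S + z) (∑-conv heavy middle)))
    (trans (cong₂ _+_ (cong (thr 1) (proj₂ P)) (trans (conv-zero heavy middle) (∑-cong (λ x → hm ∣ M x ∣)))) (ℤ.+-identityˡ F))
    where
    -- A heavy point is also a middle point, so the badness of the origin is exactly F.
    hm : ∀ m → + step 4 m * + step 2 m ≡ + step 4 m
    hm 0 = refl
    hm 1 = refl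
    hm 2 = refl
    hm 3 = refl
    hm (suc (suc (suc (suc m)))) = refl

  heavy≥0 : 0ℤ ≤ F
  heavy≥0 = ∑-nonneg {v} {heavy} (λ x → nat≥0 {step 4 ∣ M x ∣})

  middle≥0 : 0ℤ ≤ G
  middle≥0 = ∑-nonneg {v} {middle} (λ x → nat≥0 {step 2 ∣ M x ∣})

  count₁ : S + G + (F + F) ≤ + 37
  count₁ = subst (_≤ + 37)
    (trans (∑-+ (λ x → thr 1 (M x) + middle x) (λ x → heavy x + heavy x))
      (cong₂ _+_ (∑-+ (λ x → thr 1 (M x)) middle) (∑-+ heavy heavy)))
    (linear-bound A (λ m → step 1 m ℕ.+ step 2 m ℕ.+ (step 4 m ℕ.+ step 4 m)) tt)

  count₂ : (G + G) + (F + F) + odds M ≤ + 37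
  count₂ = subst (_≤ + 37)
    (trans (∑-+ (λ x → (middle x + middle x) + (heavy x + heavy x)) (λ x → odd (M x)))
      (cong (_+ odds M) (trans (∑-+ (λ x → middle x + middle x) (λ x → heavy x + heavy x)) (cong₂ _+_ (∑-+ middle middle) (∑-+ heavy heavy)))))
    (linear-bound A (λ m → (step 2 m ℕ.+ step 2 m) ℕ.+ (step 4 m ℕ.+ step 4 m) ℕ.+ m ℕ.% 2) tt)

  good-direction : + 64 ≤ size v → ∃ λ q → Nonzero q × badness q < 1ℤ
  good-direction big = [ (λ x → x) , (λ le → ⊥-elim (Budget.clash S G F (odds M) count₁ count₂
      (odd-many 3 P (ℕ.s≤s ℕ.z≤n) (divides (+ 19) refl)) heavy≥0 middle≥0
      (ℤ.≤-trans big (subst₂ _≤_ (ℤ.*-identityʳ (size v)) (cong (_+ 1ℤ) ∑-badness) le)))) ]′ (search-nonzero v badness 1ℤ)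

  private
    split : ∀ a b → 0ℤ ≤ a → 0ℤ ≤ b → a + b < 1ℤ → a ≤ 0ℤ × b ≤ 0ℤ
    split a b p q r = ≤-by (alg a b) (gap s ⊞ q) , ≤-by (alg′ a b) (gap s ⊞ p)
      where
      s : 1ℤ + (a + b) ≤ 1ℤ
      s = ℤ.i<j⇒suc[i]≤j r
      alg : ∀ a b → 0ℤ - a ≡ (1ℤ - (1ℤ + (a + b))) + b
      alg = solve-∀
      alg′ : ∀ a b → 0ℤ - b ≡ (1ℤ - (1ℤ + (a + b))) + a
      alg′ = solve-∀
    conv≥0′ : ∀ q → 0ℤ ≤ conv heavy middle q
    conv≥0′ q = conv≥0 {f = heavy} {middle} (λ x → nat≥0 {step 4 ∣ M x ∣}) (λ x → nat≥0 {step 2 ∣ M x ∣}) q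

  good-outside : ∀ q → badness q < 1ℤ → M q ≡ 0ℤ
  good-outside q p = go (values A q) (proj₁ (split (thr 1 (M q)) (conv heavy middle q) (nat≥0 {step 1 ∣ M q ∣}) (conv≥0′ q) p))
    where
    absurd : 1ℤ ≤ 0ℤ → ⊥
    absurd (+≤+ ())
    go : (∃ λ m → M q ≡ + m × m ℕ.≤ 7) → thr 1 (M q) ≤ 0ℤ → M q ≡ 0ℤ
    go (zero , e , _) _ = e
    go (suc m , e , _) le = ⊥-elim (absurd (subst (λ z → thr 1 z ≤ 0ℤ) e le))

  good-bound : ∀ q → badness q < 1ℤ → ∀ x → M x + M (x ⊕ q) ≤ + 7
  good-bound q p x = go (values A x) (values A (x ⊕ q)) (term x)
    (subst (λ y → heavy (x ⊕ q) * middle y ≤ 0ℤ) (⊕-cancelʳ x q) (term (x ⊕ q)))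
    where
    term : ∀ x → heavy x * middle (x ⊕ q) ≤ 0ℤ
    term x = ℤ.≤-trans (∑-≥-point (λ y → heavy y * middle (y ⊕ q))
        (λ y → nat≥0 {step 4 ∣ M y ∣} ⊠ nat≥0 {step 2 ∣ M (y ⊕ q) ∣}) x)
      (proj₂ (split (thr 1 (M q)) (conv heavy middle q) (nat≥0 {step 1 ∣ M q ∣}) (conv≥0′ q) p))
    zero-product : ∀ a b → + a * + b ≤ 0ℤ → a ℕ.* b ≡ 0
    zero-product a b le = ℕ.n≤0⇒n≡0 (ℤ.drop‿+≤+ (subst (_≤ 0ℤ) (sym (ℤ.pos-* a b)) le))
    below : ∀ {m y} → M y ≡ + m → m ℕ.≤ 7 → m ℕ.< 7
    below {m} {y} e le = ℕ.≤∧≢⇒< le (λ { refl → never-7 y e })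
    go : (∃ λ m → M x ≡ + m × m ℕ.≤ 7) → (∃ λ m → M (x ⊕ q) ≡ + m × m ℕ.≤ 7) →
      heavy x * middle (x ⊕ q) ≤ 0ℤ → heavy (x ⊕ q) * middle x ≤ 0ℤ → M x + M (x ⊕ q) ≤ + 7
    go (m , e , le) (m′ , e′ , le′) t t′ = subst₂ (λ a b → a + b ≤ + 7) (sym e) (sym e′)
      (+≤+ (light-pair m m′ (below e le) (below e′ le′)
        (zero-product (step 4 m) (step 2 m′) (subst₂ (λ a b → thr 4 a * thr 2 b ≤ 0ℤ) e e′ t))
        (zero-product (step 4 m′) (step 2 m) (subst₂ (λ a b → thr 4 a * thr 2 b ≤ 0ℤ) e′ e t′))))

project-37 : ∀ {v} {M : F2^ (suc v) → ℤ} → + 64 ≤ size (suc v) → Pts 8 7 37 M → ∃ λ (N : F2^ v → ℤ) → Pts 8 7 37 N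
project-37 {M = M} big P = go (good-direction P big)
  where
  go : (∃ λ q → Nonzero q × badness P q < 1ℤ) → _
  go (q , ne , p) = quot q M , aff-quot (proj₁ P) q ne (good-bound P q p) ,
    trans (quot-zero q M ne) (cong₂ _+_ (proj₂ P) (good-outside P q p))

-- Codewords of RM(0,v) and RM(1,v)

orth-even : ∀ v (f : F2^ v → ℤ) → Orth (suc v) f → AllEven f
orth-even zero f (o , _) [] = subst Even (∑-[] f) o
orth-even (suc v) f o = evens (orth-even v (half₀ f) (orth-drop₁ (suc v) (orth-pred (suc v) o) e₁)) e₁
  where
  e₁ : AllEven (half₁ f)
  e₁ = orth-even v (half₁ f) (orth-half₁ (suc v) o)

orth-constant : ∀ v (f : F2^ v → ℤ) → Orth v f → ∃ λ c → ∀ x → Even (f x - c)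
orth-constant zero f o = f [] , λ { [] → divides 0ℤ (ℤ.+-inverseʳ (f [])) }
orth-constant (suc v) f o with orth-constant v (half₁ f) (orth-half₁ v o)
... | c , e = c , evens {f = λ x → f x - c} e₀ e
  where
  alg : ∀ a b c → (a + b) - (b - c) + - (c + c) ≡ a - c
  alg = solve-∀
  e₀ : ∀ x → Even (half₀ f x - c)
  e₀ x = subst Even (alg (half₀ f x) (half₁ f x) c)
    (even-+ (even-+ (orth-even v _ (orth-merge (suc v) o) x) (even-- (e x))) (even-- (even-double c)))

-- The half with first coordinate 1 is affine by induction. The two halves add up to a constant
-- modulo 2, and its parity decides whether the first coordinate enters the functional.
orth-affine : ∀ v (f : F2^ (suc v) → ℤ) → Orth v f → ∃ λ a → ∃ λ c → ∀ x → Even (f x - (ind a x + c))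
orth-affine zero f o with parity (f (true ∷ []) - f (false ∷ []))
... | inj₁ (e , _) = false ∷ [] , f (false ∷ []) ,
  λ { (false ∷ []) → divides 0ℤ (alg (f (false ∷ []))) ; (true ∷ []) → subst Even (alg′ (f (true ∷ [])) (f (false ∷ []))) e }
  where
  alg : ∀ a → a - (0ℤ + a) ≡ 0ℤ
  alg = solve-∀
  alg′ : ∀ a b → a - b ≡ a - (0ℤ + b)
  alg′ = solve-∀
... | inj₂ (e , _) = true ∷ [] , f (false ∷ []) ,
  λ { (false ∷ []) → divides 0ℤ (alg (f (false ∷ []))) ; (true ∷ []) → subst Even (alg′ (f (true ∷ [])) (f (false ∷ []))) e }
  where
  alg : ∀ a → a - (0ℤ + a) ≡ 0ℤ
  alg = solve-∀
  alg′ : ∀ a b → a - b - 1ℤ ≡ a - (1ℤ + b)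
  alg′ = solve-∀
orth-affine (suc v) f o = go (orth-affine v (half₁ f) (orth-half₁ v o)) (orth-constant (suc v) _ (orth-merge (suc v) o))
  where
  go : (∃ λ a → ∃ λ c → ∀ x → Even (half₁ f x - (ind a x + c))) → (∃ λ c → ∀ x → Even (half₀ f x + half₁ f x - c)) →
    ∃ λ a → ∃ λ c → ∀ x → Even (f x - (ind a x + c))
  go (a , c , e) (d , e′) with parity d
  ... | inj₁ (ev , _) = false ∷ a , c , evens {f = λ x → f x - (ind (false ∷ a) x + c)}
      (λ x → subst Even (alg (half₀ f x) (half₁ f x) (ind a x) c d) (even-+ (even-+ (even-+ (e′ x) ev) (even-- (e x))) (even-- (even-double (ind a x + c)))))
      e
    where
    alg : ∀ p q i c d → (p + q - d) + d + - (q - (i + c)) + - ((i + c) + (i + c)) ≡ p - (i + c)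
    alg = solve-∀
  ... | inj₂ (od , _) = true ∷ a , c + 1ℤ , evens {f = λ x → f x - (ind (true ∷ a) x + (c + 1ℤ))}
      (λ x → subst Even (alg (half₀ f x) (half₁ f x) (ind a x) c d) (even-+ (even-+ (even-+ (e′ x) od) (even-- (e x))) (even-- (even-double (ind a x + c)))))
      (λ x → subst (λ i → Even (half₁ f x - (i + (c + 1ℤ)))) (sym (bit-not (dot a x)))
        (subst Even (alg′ (half₁ f x) (ind a x) c) (even-+ (e x) (even-double (ind a x - 1ℤ)))))
    where
    bit-not : ∀ b → bit (not b) ≡ 1ℤ - bit b
    bit-not true = refl
    bit-not false = refl
    alg : ∀ p q i c d → (p + q - d) + (d - 1ℤ) + - (q - (i + c)) + - ((i + c) + (i + c)) ≡ p - (i + (c + 1ℤ))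
    alg = solve-∀
    alg′ : ∀ p i c → p - (i + c) + ((i - 1ℤ) + (i - 1ℤ)) ≡ p - ((1ℤ - i) + (c + 1ℤ))
    alg′ = solve-∀

size-grow : ∀ n k → size n ≤ size (n ℕ.+ k)
size-grow zero k = size≥1 k
size-grow (suc n) k = ℤ.*-monoˡ-≤-nonNeg (+ 2) (size-grow n k)

size-mono : ∀ {m n} → m ℕ.≤ n → size m ≤ size n
size-mono {m} {n} le = subst (λ k → size m ≤ size k) (ℕ.m+[n∸m]≡n le) (size-grow m (n ℕ.∸ m))

one : ∀ {v} → F2^ v → ℤ
one _ = 1ℤ

∑-χ : ∀ {v} (q : F2^ v) → ∑ (λ h → χ h q) ≡ size v * δ q
∑-χ q = trans (∑-cong (λ h → trans (sym (ℤ.*-identityˡ (χ h q))) (cong (_* χ h q) (sym (hat-δ h))))) (inversion δ q)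

hat-one : ∀ {v} (q : F2^ v) → hat one q ≡ size v * δ q
hat-one q = trans (∑-cong (λ x → trans (ℤ.*-identityˡ (χ q x)) (cong sgn (dot-comm q x)))) (∑-χ q)

wt-one : ∀ {v} (h : F2^ v) → + 2 * wt one h ≡ size v * (1ℤ - δ h)
wt-one {v} h = trans (alg (hat one h) (∑ {v} one) (wt one h) (hat-wt one h))
  (trans (cong₂ _-_ (∑-const {v} 1ℤ) (hat-one h)) (alg′ (size v) (δ h)))
  where
  alg : ∀ a b c → a ≡ b - + 2 * c → + 2 * c ≡ b - a
  alg _ b c refl = r b c
    where r : ∀ b c → + 2 * c ≡ b - (b - + 2 * c)
          r = solve-∀
  alg′ : ∀ s d → s * 1ℤ - s * d ≡ s * (1ℤ - d)
  alg′ = solve-∀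

one-aff : Aff {5} 16 1 32 one
one-aff = record
  { nonneg = λ _ → +≤+ ℕ.z≤n
  ; bound = λ _ → ℤ.≤-refl
  ; total = ∑-const {5} 1ℤ
  ; div = λ h → divides (1ℤ - δ h) (ℤ.*-cancelˡ-≡ (+ 2) _ _ (trans (wt-one h) (alg (1ℤ - δ h)))) }
  where alg : ∀ d → + 32 * d ≡ + 2 * (d * + 16)
        alg = solve-∀

-- In dimension 5 the points of odd multiplicity are those of a hyperplane a = 0 (or all points,
-- if a = 0); removing them leaves twice a 4-divisible multiset.
module Dimension-5 {M : F2^ 5 → ℤ} (P : Pts 8 7 37 M) (a : F2^ 5) (c : ℤ)
  (even-K : ∀ x → Even (withOrigin 1 M x - (ind a x + c))) where
  private
    A = proj₁ P

    -- The origin carries weight 1 in K, so the constant is odd and the odd points are those with a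
    -- · x = 0.
    odd-c : Even (1ℤ - c)
    odd-c = subst Even (trans (cong₂ (λ m i → m - (i + c)) (cong (λ z → z + 1ℤ) (proj₂ P)) (cong bit (dot-zeroʳ a))) (alg c))
        (even-K (zeroVec 5))
      where alg : ∀ c → 0ℤ + 1ℤ - (0ℤ + c) ≡ 1ℤ - c
            alg = solve-∀

    T₀ : F2^ 5 → ℤ
    T₀ x = on a one x - δ x

    even-D : ∀ x → Even (M x - T₀ x)
    even-D x = subst Even (alg (M x) (δ x) (ind a x) c)
      (even-+ (even-+ (even-K x) (even-double (ind a x))) (even-- odd-c))
      where alg : ∀ m d i c → m + 1ℤ * d - (i + c) + (i + i) + - (1ℤ - c) ≡ m - (1ℤ * (1ℤ - i) - d)
            alg = solve-∀

    D : F2^ 5 → ℤ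
    D x = _∣_.quotient (even-D x)

    D2 : ∀ x → M x - T₀ x ≡ D x * + 2
    D2 x = _∣_.equality (even-D x)

    T≥0 : ∀ x → 0ℤ ≤ T₀ x
    T≥0 x = [ (λ { (refl , d) → subst₂ (λ b z → 0ℤ ≤ 1ℤ * (1ℤ - bit b) - z) (sym (dot-zeroʳ a)) (sym d) ℤ.≤-refl })
            , (λ { (_ , d) → subst (λ z → 0ℤ ≤ on a one x - z) (sym d) (go (dot a x)) }) ]′ (δ-cases x)
      where
      go : ∀ b → 0ℤ ≤ 1ℤ * (1ℤ - bit b) - 0ℤ
      go true = ℤ.≤-refl
      go false = +≤+ ℕ.z≤n

    D≥0 : ∀ x → 0ℤ ≤ D x
    D≥0 x = go (D x) (subst (0ℤ ≤_) (trans (alg (M x) (ind a x) (δ x)) (cong (_+ 1ℤ) (D2 x))) (nonneg A x ⊞ bit-nonneg (dot a x) ⊞ δ≥0 x))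
      where
      alg : ∀ m i d → m + i + d ≡ m - (1ℤ * (1ℤ - i) - d) + 1ℤ
      alg = solve-∀
      go : ∀ d → 0ℤ ≤ d * + 2 + 1ℤ → 0ℤ ≤ d
      go (+ n) _ = +≤+ ℕ.z≤n
      go -[1+ n ] ()

    D≤3 : ∀ x → D x ≤ + 3
    D≤3 x = [ (λ p → p) , (λ p → ⊥-elim (clash (M x) (T₀ x) (D x) (D2 x) (bound A x) (T≥0 x) p)) ]′ (below (D x))
      where
      below : ∀ d → d ≤ + 3 ⊎ + 4 ≤ d
      below d with d ℤ.≤? + 3
      ... | yes p = inj₁ p
      ... | no p = inj₂ (ℤ.i<j⇒suc[i]≤j (ℤ.≰⇒> p))
      alg : ∀ m t d → (+ 7 - m) + t + (m - t - d * + 2) + + 2 * (d - + 4) ≡ -[1+ 0 ]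
      alg = solve-∀
      clash : ∀ m t d → m - t ≡ d * + 2 → m ≤ + 7 → 0ℤ ≤ t → + 4 ≤ d → ⊥
      clash m t d e p q r = impossible 0 (gap p ⊞ q ⊞ gap (ℤ.≤-reflexive (sym e)) ⊞ nat≥0 {2} ⊠ gap r) (alg m t d)

    D0 : D (zeroVec 5) ≡ 0ℤ
    D0 = ℤ.*-cancelʳ-≡ (D (zeroVec 5)) 0ℤ (+ 2) (trans (sym (D2 (zeroVec 5)))
      (trans (cong₂ (λ m b → m - (1ℤ * (1ℤ - bit b) - 1ℤ)) (proj₂ P) (dot-zeroʳ a)) refl))

    -- m vectors satisfy a · x = 0, so m - 1 nonzero ones are removed and 37 - (m - 1) = 2n. The
    -- removed set is 8-divisible, which leaves divisor 4 after halving.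
    D-pts : ∀ m n → ∑ {5} one - wt one a ≡ + m → 2 ℕ.* n ℕ.+ m ≡ 38 → Pts 4 3 n D
    D-pts m n e e′ = record
      { nonneg = D≥0
      ; bound = D≤3
      ; total = ℤ.*-cancelˡ-≡ (+ 2) (∑ D) (+ n) (trans (sym (∑-* (+ 2) D)) (trans (∑-cong (λ x → trans (ℤ.*-comm (+ 2) (D x)) (sym (D2 x))))
          (trans (∑-- M T₀) (trans (cong₂ _-_ (total A) (trans (∑-- (on a one) δ) (cong₂ _-_ (total O) (∑δ 5)))) (arith e′)))))
      ; div = λ h → dv h (div A h) (div O h) } , D0
      where
      O : Aff 8 1 m (on a one)
      O = on-aff {8} one-aff a m e
      arith : 2 ℕ.* n ℕ.+ m ≡ 38 → + 37 - (+ m - 1ℤ) ≡ + 2 * + n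
      arith e = trans (alg (+ m)) (trans (cong (λ z → + z - + m) (sym e)) (trans (cong (_- + m) (trans (ℤ.pos-+ (2 ℕ.* n) m) (cong (_+ + m) (ℤ.pos-* 2 n)))) (alg′ (+ 2 * + n) (+ m))))
        where
        alg : ∀ m → + 37 - (m - 1ℤ) ≡ + 38 - m
        alg = solve-∀
        alg′ : ∀ a b → a + b - b ≡ a
        alg′ = solve-∀
      w : ∀ h → + 2 * wt D h ≡ wt M h - (wt (on a one) h - wt δ h)
      w h = trans (sym (wt-* (+ 2) D h)) (trans
        (∑-cong (λ x → trans (cong (_* ind h x) (trans (ℤ.*-comm (+ 2) (D x)) (sym (D2 x)))) (alg (M x) (on a one x) (δ x) (ind h x))))
        (trans (∑-- (λ x → M x * ind h x) (λ x → on a one x * ind h x - δ x * ind h x))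
          (cong (λ z → wt M h - z) (∑-- (λ x → on a one x * ind h x) (λ x → δ x * ind h x)))))
        where alg : ∀ m o d i → (m - (o - d)) * i ≡ m * i - (o * i - d * i)
              alg = solve-∀
      dv : ∀ h → + 8 ∣ wt M h → + 8 ∣ wt (on a one) h → + 4 ∣ wt D h
      dv h (divides q e₁) (divides q₂ e₂) = divides (q - q₂) (ℤ.*-cancelˡ-≡ (+ 2) (wt D h) ((q - q₂) * + 4)
        (trans (w h) (trans (cong₂ (λ x y → x - y) e₁ (cong₂ _-_ e₂ (wt-δ h))) (alg q q₂))))
        where alg : ∀ q r → q * + 8 - (r * + 8 - 0ℤ) ≡ + 2 * ((q - r) * + 4)
              alg = solve-∀

    wt-one-a : ∀ d → δ a ≡ d → wt one a ≡ (1ℤ - d) * + 16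
    wt-one-a d e = ℤ.*-cancelˡ-≡ (+ 2) (wt one a) ((1ℤ - d) * + 16) (trans (wt-one a) (trans (cong (λ d → + 32 * (1ℤ - d)) e) (alg (1ℤ - d))))
      where alg : ∀ d → + 32 * d ≡ + 2 * (d * + 16)
            alg = solve-∀

  absurd : ⊥
  -- For a = 0 all 31 points are odd and 3 remain after halving; for a ≠ 0 there are 15 odd points
  -- and 11 remain.
  absurd = [ (λ { (_ , d) → lookupᵇ 3 (exclude₄ 3) tt D (D-pts 32 3 (cong₂ _-_ (∑-const {5} 1ℤ) (wt-one-a 1ℤ d)) refl) })
           , (λ { (_ , d) → exclude₄-11 D (D-pts 16 11 (cong₂ _-_ (∑-const {5} 1ℤ) (wt-one-a 0ℤ d)) refl) }) ]′ (δ-cases a)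

dimension-5 : ∀ {M : F2^ 5 → ℤ} → Pts 8 7 37 M → ⊥
dimension-5 {M} P = go (orth-affine 4 (withOrigin 1 M) (orthogonal 3 (div K) (subst Even (sym (total K)) (divides (+ 19) refl))))
  where
  K = add-origin P 1 (ℕ.s≤s ℕ.z≤n)
  go : (∃ λ a → ∃ λ c → ∀ x → Even (withOrigin 1 M x - (ind a x + c))) → ⊥
  go (a , c , e) = Dimension-5.absurd P a c e

pad : ∀ {v} → (F2^ v → ℤ) → F2^ (suc v) → ℤ
pad M (false ∷ x) = M x
pad M (true ∷ x) = 0ℤ

pad-pts : ∀ {Δ μ n v} {M : F2^ v → ℤ} → Pts Δ μ n M → Pts Δ μ n (pad M)
pad-pts {v = v} {M} (A , M0) = record
  { nonneg = λ { (false ∷ x) → nonneg A x ; (true ∷ x) → +≤+ ℕ.z≤n }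
  ; bound = λ { (false ∷ x) → bound A x ; (true ∷ x) → +≤+ ℕ.z≤n }
  ; total = trans (∑-∷ (pad M)) (trans (cong₂ _+_ (total A) (∑-zero {v})) (ℤ.+-identityʳ _))
  ; div = λ { (b ∷ h) → subst (_ ∣_) (sym (w b h)) (div A h) } } , M0
  where
  w : ∀ b h → wt (pad M) (b ∷ h) ≡ wt M h
  w b h = trans (∑-∷ (λ x → pad M x * ind (b ∷ h) x)) (trans (cong₂ _+_
    (∑-cong (λ x → cong (λ c → M x * bit (c xor dot h x)) (∧-false b))) (∑-zero {v})) (ℤ.+-identityʳ _))
    where ∧-false : ∀ b → b ∧ false ≡ false
          ∧-false true = refl
          ∧-false false = refl

raise : ∀ {Δ μ n v} k {M : F2^ v → ℤ} → Pts Δ μ n M → ∃ λ (N : F2^ (k ℕ.+ v) → ℤ) → Pts Δ μ n N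
raise zero {M} P = M , P
raise (suc k) P = pad (proj₁ (raise k P)) , pad-pts (proj₂ (raise k P))

-- Embedding into dimension 5 + v first makes dimension 5 the only base case. A centre is found
-- whenever the dimension is at least 6, as 2^6 = 64 exceeds the budget.
exclude₈-37 : Ex 8 7 37
exclude₈-37 {v} M P = descend v _ (proj₂ (raise 5 P))
  where
  descend : ∀ k (N : F2^ (5 ℕ.+ k) → ℤ) → Pts 8 7 37 N → ⊥
  descend zero N P = dimension-5 P
  descend (suc k) N P = go (project-37 (size-grow 6 k) P)
    where go : (∃ λ (N′ : F2^ (5 ℕ.+ k) → ℤ) → Pts 8 7 37 N′) → ⊥
          go (N′ , P′) = descend k N′ P′

3≤7 : 3 ℕ.≤ 7
3≤7 = ℕ.s≤s (ℕ.s≤s (ℕ.s≤s ℕ.z≤n))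

-- A triple point would leave 37 points. Otherwise 15 odd points give `∑² M` ≤ 78 - 15 = 63, one
-- less than (x - 7)(x + 9) requires.
exclude₈-39 : Ex 8 3 39
exclude₈-39 M P@(A , _) = clash (∑² M) (odds M) (second 3 P (exclude₄ 3) -[1+ 62 ] (+ 2) _ (+≤+ (ℕ.s≤s ℕ.z≤n)))
    (quadratic-bound A (no-multiplicity P 1 2 37 (ℕ.s≤s ℕ.z≤n) (divides (+ 5) refl) refl (ex-weaken 3≤7 exclude₈-37) ∷ []) 2 1 tt)
    (odd-many 3 P (ℕ.s≤s ℕ.z≤n) (divides (+ 20) refl))
  where
  alg : ∀ e o → (-[1+ 62 ] + e - 1ℤ) + (+ 78 - (e + 1ℤ * o)) + (o + 1ℤ - + 16) ≡ -[1+ 0 ]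
  alg = solve-∀
  clash : ∀ e o → 1ℤ ≤ -[1+ 62 ] + e → e + 1ℤ * o ≤ + 78 → + 16 ≤ o + 1ℤ → ⊥
  clash e o p q r = impossible 0 (gap p ⊞ gap q ⊞ gap r) (alg e o)

-- Forty-one points

decide : ∀ {v} {Q : F2^ v → Set} → (∀ x → Dec (Q x)) → (∃ Q) ⊎ (∀ x → ¬ Q x)
decide {zero} d with d []
... | yes p = inj₁ ([] , p)
... | no p = inj₂ (λ { [] → p })
decide {suc v} d with decide {v} (λ x → d (false ∷ x)) | decide {v} (λ x → d (true ∷ x))
... | inj₁ (x , p) | _ = inj₁ (false ∷ x , p)
... | inj₂ _ | inj₁ (x , p) = inj₁ (true ∷ x , p)
... | inj₂ p | inj₂ q = inj₂ (λ { (false ∷ x) → p x ; (true ∷ x) → q x })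

zero? : ∀ {v} (x : F2^ v) → Dec (x ≡ zeroVec v)
zero? x = ≡-dec _≟B_ x (zeroVec _)

size-cancel-≤ : ∀ v {a b} → size v * a ≤ size v * b → a ≤ b
size-cancel-≤ v {a} {b} p with size-pos v
... | n , e = ℤ.*-cancelˡ-≤-pos a b (+ suc n) (subst (λ s → s * a ≤ s * b) e p)

∑-mul-χ : ∀ {v} (M : F2^ v → ℤ) r a b → ∑ (λ h → cubic a b 1ℤ 0ℤ ⟦ hat M h ⟧ * χ h r) ≡
  size v * (a * δ r + b * M r + conv M M r)
∑-mul-χ {v} M r a b = trans (∑-cong (λ h → alg (hat M h) (χ h r) a b))
  (trans (∑-+ (λ h → a * χ h r + b * (hat M h * χ h r)) (λ h → hat M h * hat M h * χ h r))
  (trans (cong₂ _+_ (trans (∑-+ (λ h → a * χ h r) (λ h → b * (hat M h * χ h r)))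
      (cong₂ _+_ (trans (∑-* a (λ h → χ h r)) (cong (a *_) (∑-χ r))) (trans (∑-* b (λ h → hat M h * χ h r)) (cong (b *_) (inversion M r)))))
    (trans (∑-cong (λ h → cong (_* χ h r) (sym (hat-conv M M h)))) (inversion (conv M M) r)))
    (alg′ (size v) a b (δ r) (M r) (conv M M r))))
  where
  alg : ∀ x c a b → (a + b * x + 1ℤ * (x * x) + 0ℤ * (x * (x * x))) * c ≡ a * c + b * (x * c) + x * x * c
  alg = solve-∀
  alg′ : ∀ s a b d m c → a * (s * d) + b * (s * m) + s * c ≡ s * (a * d + b * m + c)
  alg′ = solve-∀

-- A character has absolute value 1, so twisting a sum of nonnegative terms by it cannot increase
-- the sum. This bounds the number of pairs of points with sum `r`.
twisted : ∀ {Δ μ n v} {M : F2^ v → ℤ} → Pts Δ μ n M → ∀ a b → (∀ h → 0ℤ ≤ cubic a b 1ℤ 0ℤ ⟦ hat M h ⟧) → ∀ r →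
  a * δ r + b * M r + conv M M r ≤ a + 1ℤ * ∑² M + 0ℤ * ∑³ M
twisted {v = v} {M} (A , M0) a b p r = size-cancel-≤ v (subst₂ _≤_ (∑-mul-χ M r a b) (∑-cubic M M0 a b 1ℤ 0ℤ) (∑-mono (λ h → le (dot h r) (p h))))
  where
  le : ∀ c {z} → 0ℤ ≤ z → z * sgn c ≤ z
  le false {z} q = ℤ.≤-reflexive (ℤ.*-identityʳ z)
  le true {z} q = ≤-by (alg z) (nat≥0 {2} ⊠ q)
    where alg : ∀ z → z - z * (- 1ℤ) ≡ + 2 * z
          alg = solve-∀

module _ {v} {M : F2^ v → ℤ} (P : Pts 8 3 41 M) where
  private
    A = proj₁ P
    p : Cubic
    p = cubic -[1+ 62 ] -[1+ 1 ] 1ℤ 0ℤ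

    p≥0 : ∀ h → 0ℤ ≤ p ⟦ hat M h ⟧
    p≥0 = hat≥0 3 P (exclude₄ 3) p tt

  -- The zero word alone contributes (41 - 9)(41 + 7) = 1536. Keeping this value instead of mere
  -- positivity yields a lower bound on the dimension.
  ∑²-41 : + 1536 ≤ size v * (-[1+ 62 ] + ∑² M)
  ∑²-41 = subst (+ 1536 ≤_) (trans (∑-cubic M (proj₂ P) -[1+ 62 ] -[1+ 1 ] 1ℤ 0ℤ) (cong (λ z → size v * z) (alg (∑² M) (∑³ M))))
    (∑-≥-origin (λ h → p ⟦ hat M h ⟧) p≥0 (subst (λ z → + 1536 ≤ p ⟦ z ⟧) (sym (hat-origin A)) ℤ.≤-refl))
    where alg : ∀ e f → -[1+ 62 ] + 1ℤ * e + 0ℤ * f ≡ -[1+ 62 ] + e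
          alg = solve-∀

  -- With all points of multiplicity at most 2 the dimension is at least 9, and some q lies
  -- neither in M nor on a line through two double points.
  sparse : Never M 3 → ∑² M ≤ + 67
  sparse no-3 = clash (∑² M) (odds M) (quadratic-bound A (no-3 ∷ []) 2 1 tt) (odd-many 3 P (ℕ.s≤s ℕ.z≤n) (divides (+ 21) refl))
    where
    alg : ∀ e o → + 67 - e ≡ (+ 82 - (e + 1ℤ * o)) + (o + 1ℤ - + 16)
    alg = solve-∀
    clash : ∀ e o → e + 1ℤ * o ≤ + 82 → + 16 ≤ o + 1ℤ → e ≤ + 67
    clash e o q r = ≤-by (alg e o) (gap q ⊞ gap r)

  -- With `∑² M` ≤ 67 the moment gives 1536 ≤ 4 · 2^v, so 2^v ≥ 384 and the next power of 2 is 512.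
  large-dimension : Never M 3 → + 512 ≤ size v
  large-dimension no-3 = [ (λ le → ⊥-elim (clash (size v) (∑² M) ∑²-41 (sparse no-3) le (size≥0 v))) , (λ le → le) ]′ dichotomy
    where
    dichotomy : size v ≤ + 256 ⊎ + 512 ≤ size v
    dichotomy with v ℕ.≤? 8
    ... | yes le = inj₁ (size-mono le)
    ... | no nle = inj₂ (size-mono {9} (ℕ.≰⇒> nle))
    alg : ∀ s e → (s * (-[1+ 62 ] + e) - + 1536) + s * (+ 67 - e) + + 4 * (+ 256 - s) ≡ -[1+ 511 ]
    alg = solve-∀
    clash : ∀ s e → + 1536 ≤ s * (-[1+ 62 ] + e) → e ≤ + 67 → s ≤ + 256 → 0ℤ ≤ s → ⊥
    clash s e q r t s≥0 = impossible 511 (gap q ⊞ s≥0 ⊠ gap r ⊞ nat≥0 {4} ⊠ gap t) (alg s e)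

  private
    -- A value below 4 forces M(q) = 0, and it excludes two double points with sum q, whose product
    -- is already 4. The total over all q is 4 · 41 + 41² = 1845, less than 4 · 512.
    badness₂ : F2^ v → ℤ
    badness₂ q = + 4 * M q + conv M M q

    conv≥0″ : ∀ q → 0ℤ ≤ conv M M q
    conv≥0″ = conv≥0 {f = M} {M} (nonneg A) (nonneg A)

  light-direction : Never M 3 → ∃ λ q → Nonzero q × badness₂ q < + 4
  light-direction no-3 = [ (λ x → x) , (λ le → ⊥-elim (clash (size v) (∑² M) (large-dimension no-3) (sparse no-3)
      (∑²-≥ A) (subst (λ z → size v * + 4 ≤ z + + 4) total′ le))) ]′ (search-nonzero v badness₂ (+ 4))
    where
    total′ : ∑ badness₂ - badness₂ (zeroVec v) ≡ + 4 * + 41 + + 41 * + 41 - ∑² M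
    total′ = cong₂ _-_
      (trans (∑-+ (λ q → + 4 * M q) (conv M M)) (cong₂ _+_ (trans (∑-* (+ 4) M) (cong (+ 4 *_) (total A)))
        (trans (∑-conv M M) (cong₂ _*_ (total A) (total A)))))
      (trans (cong₂ (λ a b → + 4 * a + b) (proj₂ P) (conv-zero M M)) (ℤ.+-identityˡ (∑² M)))
    alg : ∀ s e → + 4 * (s - + 512) + (+ 1845 - e + + 4 - s * + 4) + (e - + 41) ≡ -[1+ 239 ]
    alg = solve-∀
    clash : ∀ s e → + 512 ≤ s → e ≤ + 67 → + 41 ≤ e → s * + 4 ≤ + 1845 - e + + 4 → ⊥
    clash s e q _ r t = impossible 239 (nat≥0 {4} ⊠ gap q ⊞ gap t ⊞ gap r) (alg s e)

  light-outside : ∀ q → badness₂ q < + 4 → M q ≡ 0ℤ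
  light-outside q lt = go (values A q) (bounded (M q) (conv M M q) lt (conv≥0″ q))
    where
    bounded : ∀ m c → + 4 * m + c < + 4 → 0ℤ ≤ c → + 4 * m ≤ + 3
    bounded m c lt c≥0 = ≤-by (alg m c) (gap (ℤ.i<j⇒suc[i]≤j lt) ⊞ c≥0)
      where alg : ∀ m c → + 3 - + 4 * m ≡ (+ 4 - (1ℤ + (+ 4 * m + c))) + c
            alg = solve-∀
    go : (∃ λ m → M q ≡ + m × m ℕ.≤ 3) → + 4 * M q ≤ + 3 → M q ≡ 0ℤ
    go (zero , e , _) _ = e
    go (suc m , e , _) le = ⊥-elim (absurd (ℤ.drop‿+≤+ (subst (_≤ + 3) (trans (cong (+ 4 *_) e) (sym (ℤ.pos-* 4 (suc m)))) le)))
      where absurd : 4 ℕ.* suc m ℕ.≤ 3 → ⊥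
            absurd le = ℕ.<⇒≱ (ℕ.*-monoʳ-≤ 4 (ℕ.s≤s (ℕ.z≤n {m}))) le

  light-bound : Never M 3 → ∀ q → badness₂ q < + 4 → ∀ x → M x + M (x ⊕ q) ≤ + 3
  light-bound no-3 q lt x = go (values A x) (values A (x ⊕ q)) (bounded (M q) (conv M M q) (M x * M (x ⊕ q)) lt (nonneg A q)
      (∑-≥-point (λ y → M y * M (y ⊕ q)) (λ y → nonneg A y ⊠ nonneg A (y ⊕ q)) x))
    where
    bounded : ∀ m c t → + 4 * m + c < + 4 → 0ℤ ≤ m → t ≤ c → t ≤ + 3
    bounded m c t lt m≥0 le = ≤-by (alg m c t) (gap (ℤ.i<j⇒suc[i]≤j lt) ⊞ nat≥0 {4} ⊠ m≥0 ⊞ gap le)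
      where alg : ∀ m c t → + 3 - t ≡ (+ 4 - (1ℤ + (+ 4 * m + c))) + + 4 * m + (c - t)
            alg = solve-∀
    small : ∀ m m′ → m ℕ.≤ 2 → m′ ℕ.≤ 2 → m ℕ.* m′ ℕ.≤ 3 → m ℕ.+ m′ ℕ.≤ 3
    small 0 m′ _ le _ = ℕ.m≤n⇒m≤1+n le
    small 1 m′ _ le _ = ℕ.s≤s le
    small 2 0 _ _ _ = ℕ.s≤s (ℕ.s≤s ℕ.z≤n)
    small 2 1 _ _ _ = ℕ.≤-refl
    small 2 2 _ _ (ℕ.s≤s (ℕ.s≤s (ℕ.s≤s ())))
    small (suc (suc (suc _))) _ (ℕ.s≤s (ℕ.s≤s ())) _ _
    small 2 (suc (suc (suc _))) _ (ℕ.s≤s (ℕ.s≤s ())) _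
    below : ∀ {m y} → M y ≡ + m → m ℕ.≤ 3 → m ℕ.≤ 2
    below {m} {y} e le = ℕ.≤-pred (ℕ.≤∧≢⇒< le (λ { refl → no-3 y e }))
    go : (∃ λ m → M x ≡ + m × m ℕ.≤ 3) → (∃ λ m → M (x ⊕ q) ≡ + m × m ℕ.≤ 3) → M x * M (x ⊕ q) ≤ + 3 → M x + M (x ⊕ q) ≤ + 3
    go (m , e , le) (m′ , e′ , le′) t = subst₂ (λ a b → a + b ≤ + 3) (sym e) (sym e′) (+≤+ (small m m′ (below e le) (below e′ le′)
      (ℤ.drop‿+≤+ (subst (_≤ + 3) (trans (cong₂ _*_ e e′) (sym (ℤ.pos-* m m′))) t))))

  module Triple (r : F2^ v) (Mr : M r ≡ + 3) where

    nonzero-r : Nonzero r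
    nonzero-r refl with trans (sym (proj₂ P)) Mr
    ... | ()

    -- A line through r that meets the multiset in q but not in its third point: projecting from q,
    -- nothing is added to the multiplicity 3 of r.
    Escape : F2^ v → Set
    Escape q = ¬ (M q ≡ 0ℤ) × Nonzero (q ⊕ r) × M (q ⊕ r) ≡ 0ℤ

    escape? : (∃ Escape) ⊎ (∀ q → ¬ Escape q)
    escape? = decide (λ q → ¬? (M q ℤ.≟ 0ℤ) ×-dec ¬? (zero? (q ⊕ r)) ×-dec (M (q ⊕ r) ℤ.≟ 0ℤ))

    variance : ∑ (λ q → (M q - M (q ⊕ r)) * (M q - M (q ⊕ r))) ≡ ∑² M + ∑² M - + 2 * conv M M r
    variance = trans (∑-cong (λ q → alg (M q) (M (q ⊕ r)))) (trans (∑-- (λ q → M q * M q + M (q ⊕ r) * M (q ⊕ r)) (λ q → + 2 * (M q * M (q ⊕ r))))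
      (cong₂ _-_ (trans (∑-+ (λ q → M q * M q) (λ q → M (q ⊕ r) * M (q ⊕ r))) (cong (λ z → ∑² M + z) (∑-translate r (λ q → M q * M q))))
        (∑-* (+ 2) (λ q → M q * M (q ⊕ r)))))
      where alg : ∀ a b → (a - b) * (a - b) ≡ a * a + b * b - + 2 * (a * b)
            alg = solve-∀

    -- As M(r) = 3, `twisted` gives at most `∑² M` - 57 ordered pairs with sum r.
    variance-≥ : + 114 ≤ ∑² M + ∑² M - + 2 * conv M M r
    variance-≥ = clash (δ r) (M r) (conv M M r) (∑² M) (∑³ M) (δ-nonzero r nonzero-r) Mr (twisted P -[1+ 62 ] -[1+ 1 ] p≥0 r)
      where
      alg : ∀ d m c e f → e + e - + 2 * c - + 114 ≡
        + 2 * (-[1+ 62 ] + 1ℤ * e + 0ℤ * f - (-[1+ 62 ] * d + -[1+ 1 ] * m + c)) + + 126 * (0ℤ - d) + + 4 * (+ 3 - m)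
      alg = solve-∀
      clash : ∀ d m c e f → d ≡ 0ℤ → m ≡ + 3 → -[1+ 62 ] * d + -[1+ 1 ] * m + c ≤ -[1+ 62 ] + 1ℤ * e + 0ℤ * f → + 114 ≤ e + e - + 2 * c
      clash d m c e f d0 m3 le = ≤-by (alg d m c e f) (nat≥0 {2} ⊠ gap le ⊞ nat≥0 {126} ⊠ gap (ℤ.≤-reflexive d0) ⊞ nat≥0 {4} ⊠ gap (ℤ.≤-reflexive m3))

    -- Without an escape, q and q + r both have positive multiplicity or both have multiplicity 0,
    -- except for the pair 0, r. Then (a - b)² ≤ a + b, because multiplicities between 1 and 3
    -- differ by at most 2. The exceptional pair needs 9 ≤ 3 + 6, which the terms `+ 6 * δ q`
    -- supply; the total is 2(41 + 6) = 94.
    variance-≤ : (∀ q → ¬ Escape q) → ∑ (λ q → (M q - M (q ⊕ r)) * (M q - M (q ⊕ r))) ≤ + 94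
    variance-≤ none = subst (λ z → ∑ (λ q → (M q - M (q ⊕ r)) * (M q - M (q ⊕ r))) ≤ z) sum (∑-mono le)
      where
      rhs : F2^ v → ℤ
      rhs q = M q + + 6 * δ q
      sum : ∑ (λ q → rhs q + rhs (q ⊕ r)) ≡ + 94
      sum = trans (∑-+ rhs (λ q → rhs (q ⊕ r))) (trans (cong (λ z → ∑ rhs + z) (∑-translate r rhs))
        (cong (λ z → z + z) (trans (∑-+ M (λ q → + 6 * δ q)) (cong₂ _+_ (total A) (trans (∑-* {v} (+ 6) δ) (cong (+ 6 *_) (∑δ v)))))))
      close : ∀ m m′ → m ℕ.≤ 2 → m′ ℕ.≤ 2 → (+ suc m - + suc m′) * (+ suc m - + suc m′) ≤ + suc m + + suc m′
      close m m′ le le′ = T-does (_ ℤ.≤? _) (allBelow-sound 3 (test m) (allBelow-sound 3 (λ m → allBelow 3 (test m)) tt m (ℕ.s≤s le)) m′ (ℕ.s≤s le′))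
        where test : ℕ → ℕ → Bool
              test m m′ = does ((+ suc m - + suc m′) * (+ suc m - + suc m′) ℤ.≤? (+ suc m + + suc m′))
      extra : ∀ a b d d′ → 0ℤ ≤ d → 0ℤ ≤ d′ → (a - b) * (a - b) ≤ a + b → (a - b) * (a - b) ≤ a + + 6 * d + (b + + 6 * d′)
      extra a b d d′ p q t = ≤-by (alg a b d d′) (gap t ⊞ nat≥0 {6} ⊠ p ⊞ nat≥0 {6} ⊠ q)
        where alg : ∀ a b d d′ → a + + 6 * d + (b + + 6 * d′) - (a - b) * (a - b) ≡ (a + b - (a - b) * (a - b)) + + 6 * d + + 6 * d′
              alg = solve-∀
      nine : ∀ a b d d′ → a ≡ 0ℤ → b ≡ + 3 → d ≡ 1ℤ → 0ℤ ≤ d′ → (a - b) * (a - b) ≤ a + + 6 * d + (b + + 6 * d′)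
      nine _ _ _ d′ refl refl refl q = ≤-by (alg d′) (nat≥0 {6} ⊠ q)
        where alg : ∀ d′ → 0ℤ + + 6 * 1ℤ + (+ 3 + + 6 * d′) - (0ℤ - + 3) * (0ℤ - + 3) ≡ + 6 * d′
              alg = solve-∀
      nine′ : ∀ a b d d′ → a ≡ + 3 → b ≡ 0ℤ → 0ℤ ≤ d → d′ ≡ 1ℤ → (a - b) * (a - b) ≤ a + + 6 * d + (b + + 6 * d′)
      nine′ _ _ d _ refl refl q refl = ≤-by (alg d) (nat≥0 {6} ⊠ q)
        where alg : ∀ d → + 3 + + 6 * d + (0ℤ + + 6 * 1ℤ) - (+ 3 - 0ℤ) * (+ 3 - 0ℤ) ≡ + 6 * d
              alg = solve-∀
      generic : ∀ q → Nonzero q → Nonzero (q ⊕ r) → (M q - M (q ⊕ r)) * (M q - M (q ⊕ r)) ≤ M q + M (q ⊕ r)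
      generic q ne ne′ = go (values A q) (values A (q ⊕ r))
        where
        go : (∃ λ m → M q ≡ + m × m ℕ.≤ 3) → (∃ λ m → M (q ⊕ r) ≡ + m × m ℕ.≤ 3) → (M q - M (q ⊕ r)) * (M q - M (q ⊕ r)) ≤ M q + M (q ⊕ r)
        go (zero , e , _) (zero , e′ , _) = subst₂ (λ a b → (a - b) * (a - b) ≤ a + b) (sym e) (sym e′) ℤ.≤-refl
        go (suc m , e , _) (zero , e′ , _) = ⊥-elim (none q ((λ z → absurd (trans (sym e) z)) , ne′ , e′))
          where absurd : ¬ (+ suc m ≡ 0ℤ)
                absurd ()
        go (zero , e , _) (suc m , e′ , _) = ⊥-elim (none (q ⊕ r) ((λ z → absurd (trans (sym e′) z)) ,
            subst Nonzero (sym (⊕-cancelʳ q r)) ne , trans (cong M (⊕-cancelʳ q r)) e))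
          where absurd : ¬ (+ suc m ≡ 0ℤ)
                absurd ()
        go (suc m , e , le) (suc m′ , e′ , le′) = subst₂ (λ a b → (a - b) * (a - b) ≤ a + b) (sym e) (sym e′) (close m m′ (ℕ.≤-pred le) (ℕ.≤-pred le′))
      le : ∀ q → (M q - M (q ⊕ r)) * (M q - M (q ⊕ r)) ≤ rhs q + rhs (q ⊕ r)
      le q = [ (λ { (refl , d) → nine (M q) (M (q ⊕ r)) (δ q) (δ (q ⊕ r)) (proj₂ P) (trans (cong M (⊕-identityˡ r)) Mr) d (δ≥0 (q ⊕ r)) })
             , (λ { (ne , _) → [ (λ { (z , d) → nine′ (M q) (M (q ⊕ r)) (δ q) (δ (q ⊕ r)) (trans (cong M (⊕-zero⇒≡ q r z)) Mr) (trans (cong M z) (proj₂ P)) (δ≥0 q) d })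
                               , (λ { (ne′ , _) → extra (M q) (M (q ⊕ r)) (δ q) (δ (q ⊕ r)) (δ≥0 q) (δ≥0 (q ⊕ r)) (generic q ne ne′) }) ]′ (δ-cases (q ⊕ r)) }) ]′ (δ-cases q)

    escape : ∃ Escape
    escape = [ (λ x → x) , (λ none → ⊥-elim (clash (∑² M + ∑² M - + 2 * conv M M r) variance-≥ (subst (_≤ + 94) variance (variance-≤ none)))) ]′ escape?
      where
      alg : ∀ z → (z - + 114) + (+ 94 - z) ≡ -[1+ 19 ]
      alg = solve-∀
      clash : ∀ z → + 114 ≤ z → z ≤ + 94 → ⊥
      clash z p q = impossible 19 (gap p ⊞ gap q) (alg z)

-- Projecting from a point q of M off the line through the triple point r merges the origin
-- into a point of M, so that one copy of the origin can be removed. The image of r keeps multiplicity 3.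
no-triple-41 : ∀ {v} {M : F2^ (suc v) → ℤ} → Pts 8 3 41 M → ∀ r → M r ≡ + 3 → ∀ q →
  ¬ (M q ≡ 0ℤ) → Nonzero (q ⊕ r) → M (q ⊕ r) ≡ 0ℤ → ⊥
no-triple-41 {v} {M} P@(A , M0) r Mr q Mq≢0 ne Mqr = go (section-onto q q≢0 r)
  where
  q≢0 : Nonzero q
  q≢0 refl = Mq≢0 M0
  N K : F2^ v → ℤ
  N = quot q M
  K y = N y - δ y
  NA : Aff 8 6 41 N
  NA = aff-quot A q q≢0 (λ x → ℤ.+-mono-≤ (bound A x) (bound A (x ⊕ q)))
  N0 : 1ℤ ≤ N (zeroVec v)
  N0 = subst (1ℤ ≤_) (sym (trans (quot-zero q M q≢0) (trans (cong (_+ M q) M0) (ℤ.+-identityˡ (M q))))) (positive (values A q))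
    where
    positive : (∃ λ m → M q ≡ + m × m ℕ.≤ 3) → 1ℤ ≤ M q
    positive (zero , e , _) = ⊥-elim (Mq≢0 e)
    positive (suc m , e , _) = subst (1ℤ ≤_) (sym e) (+≤+ (ℕ.s≤s ℕ.z≤n))
  KA : Aff 8 7 40 K
  KA = record
    { nonneg = λ y → [ (λ { (refl , d) → subst (λ z → 0ℤ ≤ N y - z) (sym d) (gap N0) })
                     , (λ { (_ , d) → subst (0ℤ ≤_) (sym (trans (cong (λ z → N y - z) d) (ℤ.+-identityʳ (N y)))) (nonneg NA y) }) ]′ (δ-cases y)
    ; bound = λ y → ≤-by (alg (N y) (δ y)) (gap (bound NA y) ⊞ δ≥0 y ⊞ nat≥0 {1})
    ; total = trans (∑-- N δ) (cong₂ _-_ (total NA) (∑δ v))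
    ; div = λ h → subst (+ 8 ∣_) (sym (w h)) (div NA h) }
    where
    alg : ∀ n d → + 7 - (n - d) ≡ (+ 6 - n) + d + 1ℤ
    alg = solve-∀
    alg′ : ∀ n d i → (n - d) * i ≡ n * i - d * i
    alg′ = solve-∀
    w : ∀ h → wt K h ≡ wt N h
    w h = trans (∑-cong (λ y → alg′ (N y) (δ y) (ind h y))) (trans (∑-- (λ y → N y * ind h y) (λ y → δ y * ind h y))
      (trans (cong (λ z → wt N h - z) (wt-δ h)) (ℤ.+-identityʳ (wt N h))))
  -- The total 40 is a multiple of 8, so the image of r may become the origin; its 3 copies
  -- disappear and 37 points remain.
  finish : ∀ y → Nonzero y → N y ≡ + 3 → ⊥
  finish y y≢0 e = exclude₈-37 _ (recenter KA (divides (+ 5) refl) y 3 37 (trans (cong (λ z → N y - z) (δ-nonzero y y≢0)) (trans (ℤ.+-identityʳ (N y)) e)) refl)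
  go : (∃ λ y → section q y ≡ r ⊎ section q y ≡ r ⊕ q) → ⊥
  go (y , inj₁ e) = finish y (λ { refl → absurd (trans (sym M0) (trans (cong M (trans (sym (section-zero q)) e)) Mr)) })
    (trans (quot-section q M q≢0 y) (cong₂ _+_ (trans (cong M e) Mr) (trans (cong M (trans (cong (_⊕ q) e) (⊕-comm r q))) Mqr)))
    where absurd : ¬ (0ℤ ≡ + 3)
          absurd ()
  go (y , inj₂ e) = finish y (λ { refl → ne (trans (⊕-comm q r) (trans (sym e) (section-zero q))) })
    (trans (quot-section q M q≢0 y) (cong₂ _+_ (trans (cong M (trans e (⊕-comm r q))) Mqr) (trans (cong M (trans (cong (_⊕ q) e) (⊕-cancelʳ r q))) Mr)))

-- Induction on the dimension. Projecting without triple points keeps multiplicities at most 3 but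
-- may create triple points, and these are refuted at once.
no-41 : ∀ v (M : F2^ v → ℤ) → Pts 8 3 41 M → ⊥
no-41 zero M P@(A , M0) = absurd (trans (sym (trans (∑-[] M) M0)) (total A))
  where absurd : ¬ (0ℤ ≡ + 41)
        absurd ()
no-41 (suc v) M P = [ triple , single ]′ (decide (λ x → M x ℤ.≟ + 3))
  where
  triple : (∃ λ x → M x ≡ + 3) → ⊥
  triple (r , Mr) = go (Triple.escape P r Mr)
    where go : (∃ λ q → ¬ (M q ≡ 0ℤ) × Nonzero (q ⊕ r) × M (q ⊕ r) ≡ 0ℤ) → ⊥
          go (q , Mq , ne , Mqr) = no-triple-41 P r Mr q Mq ne Mqr
  single : (∀ x → ¬ (M x ≡ + 3)) → ⊥
  single no-3 = go (light-direction P no-3)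
    where
    go : (∃ λ q → Nonzero q × + 4 * M q + conv M M q < + 4) → ⊥
    go (q , ne , lt) = no-41 v (quot q M) (aff-quot (proj₁ P) q ne (light-bound P no-3 q lt) ,
      trans (quot-zero q M ne) (cong₂ _+_ (proj₂ P) (light-outside P q lt)))

exclude₈-41 : Ex 8 3 41
exclude₈-41 {v} = no-41 v

-- Self-orthogonal restrictions

conv-comm : ∀ {v} (f g : F2^ v → ℤ) p → conv f g p ≡ conv g f p
conv-comm f g p = trans (∑-cong (λ q → trans (ℤ.*-comm (f q) (g (q ⊕ p))) (cong (λ y → g (q ⊕ p) * f y) (sym (⊕-cancelʳ q p)))))
  (∑-translate p (λ q → g q * f (q ⊕ p)))

conv-even : ∀ {v} (f : F2^ v → ℤ) p → Nonzero p → Even (conv f f p)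
conv-even f [] ne = ⊥-elim (ne refl)
conv-even f (true ∷ p) ne = subst Even (sym (trans (conv-∷ f f true p) (cong (λ z → conv (half₀ f) (half₁ f) p + z) (conv-comm (half₁ f) (half₀ f) p))))
  (even-double (conv (half₀ f) (half₁ f) p))
conv-even f (false ∷ p) ne = subst Even (sym (conv-∷ f f false p))
  (even-+ (conv-even (half₀ f) p (nonzero-tail ne)) (conv-even (half₁ f) p (nonzero-tail ne)))

opaque
  unfolding ∑

  ∑-swap : ∀ {v w} (f : F2^ v → F2^ w → ℤ) → ∑ (λ x → ∑ (λ y → f x y)) ≡ ∑ (λ y → ∑ (λ x → f x y))
  ∑-swap {zero} f = refl
  ∑-swap {suc v} f = trans (cong₂ _+_ (∑-swap {v} (λ x → f (false ∷ x))) (∑-swap {v} (λ x → f (true ∷ x))))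
    (sym (∑-+ (λ y → ∑ {v} (λ x → f (false ∷ x) y)) (λ y → ∑ {v} (λ x → f (true ∷ x) y))))

sumL : ∀ {A : Set} → (A → ℤ) → List A → ℤ
sumL g [] = 0ℤ
sumL g (x ∷ xs) = g x + sumL g xs

sumL-++ : ∀ {A : Set} (g : A → ℤ) xs ys → sumL g (xs ++ ys) ≡ sumL g xs + sumL g ys
sumL-++ g [] ys = sym (ℤ.+-identityˡ _)
sumL-++ g (x ∷ xs) ys = trans (cong (λ z → g x + z) (sumL-++ g xs ys)) (sym (ℤ.+-assoc (g x) (sumL g xs) (sumL g ys)))

sumL-map : ∀ {A B : Set} (g : B → ℤ) (h : A → B) xs → sumL g (map h xs) ≡ sumL (λ x → g (h x)) xs
sumL-map g h [] = refl
sumL-map g h (x ∷ xs) = cong (λ z → g (h x) + z) (sumL-map g h xs)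

sumL-1 : ∀ {A : Set} (xs : List A) → sumL (λ _ → 1ℤ) xs ≡ + length xs
sumL-1 [] = refl
sumL-1 (x ∷ xs) = cong (λ z → 1ℤ + z) (sumL-1 xs)

support : ∀ {v} → (F2^ v → ℤ) → List (F2^ v)
support {zero} M with M [] ℤ.≟ 1ℤ
... | yes _ = [] ∷ []
... | no _ = []
support {suc v} M = map (false ∷_) (support (half₀ M)) ++ map (true ∷_) (support (half₁ M))

sumL-support : ∀ {v} (M : F2^ v → ℤ) → (∀ x → M x ≡ 0ℤ ⊎ M x ≡ 1ℤ) → ∀ g → sumL g (support M) ≡ ∑ (λ x → M x * g x)
sumL-support {zero} M bin g with M [] ℤ.≟ 1ℤ
... | yes e = trans (ℤ.+-identityʳ (g [])) (sym (trans (∑-[] (λ x → M x * g x)) (trans (cong (_* g []) e) (ℤ.*-identityˡ (g [])))))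
... | no ne = sym (trans (∑-[] (λ x → M x * g x)) (go (bin [])))
  where go : M [] ≡ 0ℤ ⊎ M [] ≡ 1ℤ → M [] * g [] ≡ 0ℤ
        go (inj₁ z) = cong (_* g []) z
        go (inj₂ z) = ⊥-elim (ne z)
sumL-support {suc v} M bin g = trans (sumL-++ g (map (false ∷_) (support (half₀ M))) (map (true ∷_) (support (half₁ M))))
  (trans (cong₂ _+_ (trans (sumL-map g (false ∷_) (support (half₀ M))) (sumL-support (half₀ M) (λ x → bin (false ∷ x)) (λ x → g (false ∷ x))))
                    (trans (sumL-map g (true ∷_) (support (half₁ M))) (sumL-support (half₁ M) (λ x → bin (true ∷ x)) (λ x → g (true ∷ x)))))
         (sym (∑-∷ (λ x → M x * g x))))

-- The codeword of `h` in the positions `L`. The map `combine` below is its transpose, so the kernel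
-- of `combine` is the dual code.
restrict : ∀ {v} (L : List (F2^ v)) → F2^ v → F2^ (length L)
restrict [] h = []
restrict (p ∷ L) h = dot h p ∷ restrict L h

combine : ∀ {v} (L : List (F2^ v)) → F2^ (length L) → F2^ v
combine [] y = zeroVec _
combine (p ∷ L) (true ∷ y) = p ⊕ combine L y
combine (p ∷ L) (false ∷ y) = combine L y

adjoint : ∀ {v} (L : List (F2^ v)) h y → dot h (combine L y) ≡ dot y (restrict L h)
adjoint [] h [] = dot-zeroʳ h
adjoint (p ∷ L) h (true ∷ y) = trans (dot-⊕ʳ h p (combine L y)) (cong (dot h p xor_) (adjoint L h y))
adjoint (p ∷ L) h (false ∷ y) = adjoint L h y

restrict-⊕ : ∀ {v} (L : List (F2^ v)) a b → restrict L (a ⊕ b) ≡ restrict L a ⊕ restrict L b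
restrict-⊕ [] a b = refl
restrict-⊕ (p ∷ L) a b = cong₂ _∷_ (dot-⊕ˡ a b p) (restrict-⊕ L a b)

restrict-zero : ∀ {v} (L : List (F2^ v)) → restrict L (zeroVec v) ≡ zeroVec (length L)
restrict-zero [] = refl
restrict-zero (p ∷ L) = cong₂ _∷_ (dot-zeroˡ p) (restrict-zero L)

nondegenerate : ∀ {v} (x : F2^ v) → (∀ a → dot a x ≡ false) → x ≡ zeroVec v
nondegenerate [] f = refl
nondegenerate {suc v} (b ∷ x) f = cong₂ _∷_ (trans (sym (first b)) (f (true ∷ zeroVec v))) (nondegenerate x (λ a → f (false ∷ a)))
  where
  first : ∀ b → dot (true ∷ zeroVec v) (b ∷ x) ≡ b
  first true = cong not (dot-zeroˡ x)
  first false = dot-zeroˡ x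

parity-dot : ∀ {v} (L : List (F2^ v)) a b → Even (sumL (λ p → ind a p * ind b p) L - bit (dot (restrict L a) (restrict L b)))
parity-dot [] a b = divides 0ℤ refl
parity-dot (p ∷ L) a b = step-parity (dot a p) (dot b p) _ (dot (restrict L a) (restrict L b)) (parity-dot L a b)
  where
  step-parity : ∀ x y s d → Even (s - bit d) → Even (bit x * bit y + s - bit ((x ∧ y) xor d))
  step-parity false y s d e = subst (λ z → Even (z - bit d)) (sym (ℤ.+-identityˡ s)) e
  step-parity true false s d e = subst (λ z → Even (z - bit d)) (sym (ℤ.+-identityˡ s)) e
  step-parity true true s true e = subst Even (alg s) (even-+ e (even-double 1ℤ))
    where alg : ∀ s → s - 1ℤ + (1ℤ + 1ℤ) ≡ 1ℤ * 1ℤ + s - 0ℤ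
          alg = solve-∀
  step-parity true true s false e = subst Even (alg s) e
    where alg : ∀ s → s - 0ℤ ≡ 1ℤ * 1ℤ + s - 1ℤ
          alg = solve-∀

self-orthogonal : ∀ {v} (L : List (F2^ v)) → (∀ a b → Even (sumL (λ p → ind a p * ind b p) L)) → ∀ b → combine L (restrict L b) ≡ zeroVec v
self-orthogonal L e b = nondegenerate _ (λ a → trans (adjoint L a (restrict L b)) (go _ (parity-dot L b a) (e b a)))
  where
  go : ∀ d {s} → Even (s - bit d) → Even s → d ≡ false
  go false _ _ = refl
  go true {s} e e′ = ⊥-elim (not-even-1 (subst Even (alg s) (even-+ e′ (even-- e))))
    where
    alg : ∀ s → s + - (s - 1ℤ) ≡ 1ℤ
    alg = solve-∀
    not-even-1 : ¬ Even 1ℤ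
    not-even-1 (divides (+ zero) ())
    not-even-1 (divides (+ suc n) ())
    not-even-1 (divides -[1+ n ] ())

annihilator : ∀ {v} → List (F2^ v) → F2^ v → ℤ
annihilator L e = δ (restrict L e)

-- The kernel of y ↦ ∑ yᵢpᵢ is the dual of the restricted code, so by counting characters twice
-- size v · kernel = size (length L) · annihilator; and the kernel contains the code.
annihilator-≥ : ∀ {v} (L : List (F2^ v)) → (∀ a b → Even (sumL (λ p → ind a p * ind b p) L)) →
  size v * size v ≤ size (length L) * (∑ (annihilator L) * ∑ (annihilator L))
annihilator-≥ {v} L so = subst (size v * size v ≤_)
    (trans (sym (ℤ.*-assoc (size v) kernel G)) (trans (cong (_* G) double-count) (ℤ.*-assoc (size (length L)) G G)))
    (ℤ.*-monoˡ-≤-nonNeg (size v) {{nonNegative (size≥0 v)}} size≤)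
  where
  G kernel : ℤ
  G = ∑ (annihilator L)
  kernel = ∑ (λ y → δ (combine L y))
  double-count : size v * kernel ≡ size (length L) * G
  double-count = trans (sym (∑-* (size v) (λ y → δ (combine L y)))) (trans (∑-cong (λ y → sym (∑-χ (combine L y))))
    (trans (∑-swap (λ y h → χ h (combine L y))) (trans (∑-cong (λ h → trans (∑-cong (λ y → cong sgn (adjoint L h y))) (∑-χ (restrict L h))))
      (∑-* (size (length L)) (annihilator L)))))
  fibre : F2^ (length L) → ℤ
  fibre y = ∑ (λ h → δ (restrict L h ⊕ y))
  G≥0 : 0ℤ ≤ G
  G≥0 = ∑-nonneg (λ h → δ≥0 (restrict L h))
  -- A nonempty fibre is a translate of the annihilator.
  fibre≤ : ∀ y → fibre y ≤ G
  fibre≤ y = [ (λ { (h , e) → ℤ.≤-reflexive (trans (∑-cong (λ k → cong δ (trans (cong (restrict L k ⊕_) (sym (⊕-zero⇒≡ _ _ e))) (sym (restrict-⊕ L k h)))))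
                    (∑-translate h (annihilator L))) })
             , (λ none → ℤ.≤-trans (ℤ.≤-reflexive (trans (∑-cong (λ h → δ-nonzero _ (none h))) (∑-zero {v}))) G≥0) ]′
               (decide (λ h → zero? (restrict L h ⊕ y)))
  count : ∀ h → ∑ (λ y → δ (combine L y) * δ (restrict L h ⊕ y)) ≡ 1ℤ
  count h = trans (sym (∑-translate (restrict L h) (λ y → δ (combine L y) * δ (restrict L h ⊕ y))))
    (trans (∑-cong (λ y → trans (ℤ.*-comm (δ (combine L (y ⊕ restrict L h))) _)
        (cong (λ z → δ z * δ (combine L (y ⊕ restrict L h))) (trans (⊕-comm (restrict L h) (y ⊕ restrict L h)) (⊕-cancelʳ y (restrict L h))))))
      (trans (∑-δ (λ y → δ (combine L (y ⊕ restrict L h)))) (trans (cong (λ z → δ (combine L z)) (⊕-identityˡ (restrict L h)))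
        (trans (cong δ (self-orthogonal L so h)) (δ-zero v)))))
  -- Each h is counted once, at its codeword, which self-orthogonality puts into the kernel; each
  -- kernel element is hit by at most G of them.
  size≤ : size v ≤ kernel * G
  size≤ = subst₂ _≤_ (trans (∑-swap (λ y h → δ (combine L y) * δ (restrict L h ⊕ y)))
        (trans (∑-cong count) (trans (∑-const {v} 1ℤ) (ℤ.*-identityʳ (size v)))))
      (trans (∑-cong (λ y → ℤ.*-comm (δ (combine L y)) G)) (trans (∑-* G (λ y → δ (combine L y))) (ℤ.*-comm G kernel)))
      (∑-mono {f = λ y → ∑ (λ h → δ (combine L y) * δ (restrict L h ⊕ y))} {g = λ y → δ (combine L y) * G}
        (λ y → subst (_≤ δ (combine L y) * G) (sym (∑-* (δ (combine L y)) (λ h → δ (restrict L h ⊕ y))))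
        (ℤ.*-monoˡ-≤-nonNeg (δ (combine L y)) {{nonNegative (δ≥0 (combine L y))}} (fibre≤ y))))

restrict-sum : ∀ {v} (L : List (F2^ v)) e → restrict L e ≡ zeroVec (length L) → sumL (ind e) L ≡ 0ℤ
restrict-sum [] e z = refl
restrict-sum (p ∷ L) e z = cong₂ _+_ (cong bit (cong Data.Vec.head z)) (restrict-sum L e (cong Data.Vec.tail z))

∑-≥-two : ∀ {v} (f : F2^ v → ℤ) → (∀ x → 0ℤ ≤ f x) → ∀ x → Nonzero x → f (zeroVec v) + f x ≤ ∑ f
∑-≥-two f f≥0 x ne = subst (λ z → f (zeroVec _) + f x ≤ z) (trans (cong₂ _+_ (sym (∑-δ f)) (refl {x = ∑ g})) (trans (sym (∑-+ (λ y → δ y * f y) g)) (∑-cong (λ y → alg (δ y) (f y)))))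
  (ℤ.+-monoʳ-≤ (f (zeroVec _)) (subst (_≤ ∑ g) (trans (cong (λ d → (1ℤ - d) * f x) (δ-nonzero x ne)) (ℤ.*-identityˡ (f x))) (∑-≥-point g g≥0 x)))
  where
  g : _ → ℤ
  g y = (1ℤ - δ y) * f y
  alg : ∀ d f → d * f + (1ℤ - d) * f ≡ f
  alg = solve-∀
  g≥0 : ∀ y → 0ℤ ≤ g y
  g≥0 y = [ (λ d → subst (λ d → 0ℤ ≤ (1ℤ - d) * f y) (sym d) (subst (0ℤ ≤_) (sym (ℤ.*-identityˡ (f y))) (f≥0 y)))
          , (λ d → subst (λ d → 0ℤ ≤ (1ℤ - d) * f y) (sym d) ℤ.≤-refl) ]′ (δ-0or1 y)

-- Fifty-nine points

∑²-1 : ∀ {Δ n v} {M : F2^ v → ℤ} → Aff Δ 1 n M → ∑² M ≡ + n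
∑²-1 {n = n} A = ℤ.≤-antisym (subst (_ ≤_) (ℤ.*-identityˡ (+ n)) (∑²-≤ A)) (∑²-≥ A)

zero-one : ∀ {Δ n v} {M : F2^ v → ℤ} → Aff Δ 1 n M → ∀ x → M x ≡ 0ℤ ⊎ M x ≡ 1ℤ
zero-one {M = M} A x = go (values A x)
  where go : (∃ λ m → M x ≡ + m × m ℕ.≤ 1) → M x ≡ 0ℤ ⊎ M x ≡ 1ℤ
        go (zero , e , _) = inj₁ e
        go (suc zero , e , _) = inj₂ e
        go (suc (suc _) , _ , ℕ.s≤s ())

-- Some q lies neither in M nor on a secant, since 59 + 59·58/2 = 1770 < 2047.
project-59 : ∀ {v} {M : F2^ (suc v) → ℤ} → + 2048 ≤ size (suc v) → Pts 8 1 59 M → ∃ λ (N : F2^ v → ℤ) → Pts 8 1 59 N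
project-59 {v} {M} big P@(A , M0) = go ([ (λ x → x) , (λ le → ⊥-elim (clash (size (suc v)) big
    (subst (λ z → size (suc v) * + 2 ≤ z + + 2) total′ le))) ]′ (search-nonzero (suc v) bad (+ 2)))
  where
  bad : F2^ (suc v) → ℤ
  bad q = + 2 * M q + conv M M q
  total′ : ∑ bad - bad (zeroVec (suc v)) ≡ + 3540
  total′ = cong₂ _-_
    (trans (∑-+ (λ q → + 2 * M q) (conv M M)) (cong₂ _+_ (trans (∑-* (+ 2) M) (cong (λ z → + 2 * z) (total A)))
      (trans (∑-conv M M) (cong₂ _*_ (total A) (total A)))))
    (cong₂ (λ a b → + 2 * a + b) M0 (trans (conv-zero M M) (∑²-1 A)))
  alg : ∀ s → + 2 * (s - + 2048) + (+ 3540 + + 2 - s * + 2) ≡ -[1+ 553 ]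
  alg = solve-∀
  clash : ∀ s → + 2048 ≤ s → s * + 2 ≤ + 3540 + + 2 → ⊥
  clash s p q = impossible 553 (nat≥0 {2} ⊠ gap p ⊞ gap q) (alg s)
  conv≥ : ∀ q → 0ℤ ≤ conv M M q
  conv≥ = conv≥0 {f = M} {M} (nonneg A) (nonneg A)
  outside : ∀ q → bad q < + 2 → M q ≡ 0ℤ
  outside q lt = [ (λ e → e) , (λ e → ⊥-elim (contra (M q) (conv M M q) e lt (conv≥ q))) ]′ (zero-one A q)
    where
    alg′ : ∀ m c → (+ 2 - (1ℤ + (+ 2 * m + c))) + c + + 2 * (m - 1ℤ) ≡ -[1+ 0 ]
    alg′ = solve-∀
    contra : ∀ m c → m ≡ 1ℤ → + 2 * m + c < + 2 → 0ℤ ≤ c → ⊥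
    contra m c e lt c≥0 = impossible 0 (gap (ℤ.i<j⇒suc[i]≤j lt) ⊞ c≥0 ⊞ nat≥0 {2} ⊠ gap (ℤ.≤-reflexive (sym e))) (alg′ m c)
  -- The number of ordered pairs is even, so fewer than 2 means none.
  no-secant : ∀ q → Nonzero q → bad q < + 2 → conv M M q ≤ 0ℤ
  no-secant q ne lt = even-small (conv M M q) (conv-even M q ne) (upper (M q) (conv M M q) lt (nonneg A q))
    where
    alg″ : ∀ m c → 1ℤ - c ≡ (+ 2 - (1ℤ + (+ 2 * m + c))) + + 2 * m
    alg″ = solve-∀
    upper : ∀ m c → + 2 * m + c < + 2 → 0ℤ ≤ m → c ≤ 1ℤ
    upper m c lt m≥0 = ≤-by (alg″ m c) (gap (ℤ.i<j⇒suc[i]≤j lt) ⊞ nat≥0 {2} ⊠ m≥0)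
    even-small : ∀ c → Even c → c ≤ 1ℤ → c ≤ 0ℤ
    even-small _ (divides (+ zero) refl) _ = ℤ.≤-refl
    even-small _ (divides (+ suc n) refl) (+≤+ (ℕ.s≤s ()))
    even-small _ (divides -[1+ n ] refl) _ = -≤+
  light : ∀ q → Nonzero q → bad q < + 2 → ∀ x → M x + M (x ⊕ q) ≤ 1ℤ
  light q ne lt x = go (zero-one A x) (zero-one A (x ⊕ q))
    (ℤ.≤-trans (∑-≥-point (λ y → M y * M (y ⊕ q)) (λ y → nonneg A y ⊠ nonneg A (y ⊕ q)) x) (no-secant q ne lt))
    where
    go : M x ≡ 0ℤ ⊎ M x ≡ 1ℤ → M (x ⊕ q) ≡ 0ℤ ⊎ M (x ⊕ q) ≡ 1ℤ → M x * M (x ⊕ q) ≤ 0ℤ → M x + M (x ⊕ q) ≤ 1ℤ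
    go (inj₁ e) _ _ = subst (λ a → a + M (x ⊕ q) ≤ 1ℤ) (sym e) (subst (_≤ 1ℤ) (sym (ℤ.+-identityˡ _)) (bound A (x ⊕ q)))
    go (inj₂ e) (inj₁ e′) _ = subst₂ (λ a b → a + b ≤ 1ℤ) (sym e) (sym e′) ℤ.≤-refl
    go (inj₂ e) (inj₂ e′) le = ⊥-elim (absurd (subst₂ (λ a b → a * b ≤ 0ℤ) e e′ le))
      where absurd : 1ℤ * 1ℤ ≤ 0ℤ → ⊥
            absurd (+≤+ ())
  go : (∃ λ q → Nonzero q × bad q < + 2) → ∃ λ (N : F2^ v → ℤ) → Pts 8 1 59 N
  go (q , ne , lt) = quot q M , aff-quot A q ne (light q ne lt) , trans (quot-zero q M ne) (cong₂ _+_ M0 (outside q lt))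

refute : ∀ {Q : Set} (d : Dec Q) → T (not (does d)) → ¬ Q
refute (no nq) _ x = nq x

-- In dimension 10, (x - 11)(x + 5) sums to 4096, of which 3072 belongs to h = 0. Its values at the
-- other weights are 1536 (weight 8), 512 (weights 16 and 40) and 0 (weights 24 and 32), so there are
-- exactly two words of weight 16 or 40 and none of weight 8.
module Dimension-10 {M : F2^ 10 → ℤ} (P : Pts 8 1 59 M) where
  private
    A = proj₁ P

    p : Cubic
    p = cubic -[1+ 54 ] -[1+ 5 ] 1ℤ 0ℤ

    q : F2^ 10 → ℤ
    q h = p ⟦ hat M h ⟧

    q≥0 : ∀ h → 0ℤ ≤ q h
    q≥0 = hat≥0 3 P exclude₄-below-2 p tt

    ∑q : ∑ q ≡ + 4096
    ∑q = trans (∑-cubic M (proj₂ P) -[1+ 54 ] -[1+ 5 ] 1ℤ 0ℤ) (cong (λ z → + 1024 * z)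
      (trans (cong (λ e → -[1+ 54 ] + 1ℤ * e + 0ℤ * ∑³ M) (∑²-1 A)) (alg (∑³ M))))
      where alg : ∀ f → -[1+ 54 ] + 1ℤ * + 59 + 0ℤ * f ≡ + 4
            alg = solve-∀

    q0 : q (zeroVec 10) ≡ + 3072
    q0 = cong (p ⟦_⟧) (hat-origin A)

    W : F2^ 10 → ℕ → Set
    W h k = wt M h ≡ + (k ℕ.* 8)

    value : ℕ → ℤ
    value k = p ⟦ + 59 - + 2 * + (k ℕ.* 8) ⟧

    q-value : ∀ h k → W h k → q h ≡ value k
    q-value h k e = cong (p ⟦_⟧) (trans (hat-wt M h) (cong₂ (λ a b → a - + 2 * b) (total A) e))

    weight : ∀ h → ∃ λ k → W h k × k ℕ.≤ 5
    weight h = go (weight-cases A h)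
      where
      excluded : ∀ k m → W h k → + 59 - + (k ℕ.* 8) ≡ + m → Ex 4 1 m → ⊥
      excluded k m e e′ ex = ex (on h M) (on-aff {4} A h m (trans (cong₂ _-_ (total A) e) e′) , on-zero h M (proj₂ P))
      go : (∃ λ k → wt M h ≡ + (k ℕ.* 8) × k ℕ.* 8 ℕ.≤ 59 × k ℕ.≤ 59) → ∃ λ k → W h k × k ℕ.≤ 5
      go (k , e , le , _) with k ℕ.≤? 5
      ... | yes le₅ = k , e , le₅
      ... | no nle = ⊥-elim (six-seven k (ℕ.≰⇒> nle) (ℕ.≤-pred (ℕ.*-cancelʳ-< 8 k 8 (ℕ.s≤s (ℕ.≤-trans le (ℕ.m≤m+n 59 4))))) e)
        where
        six-seven : ∀ k → 5 ℕ.< k → k ℕ.≤ 7 → W h k → ⊥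
        six-seven 6 _ _ e = excluded 6 11 e refl (lookupᵇ 11 exclude₄-below-2 tt)
        six-seven 7 _ _ e = excluded 7 3 e refl (lookupᵇ 3 exclude₄-below-2 tt)
        six-seven (suc (suc (suc (suc (suc (suc (suc (suc k)))))))) _ (ℕ.s≤s (ℕ.s≤s (ℕ.s≤s (ℕ.s≤s (ℕ.s≤s (ℕ.s≤s (ℕ.s≤s ()))))))) _
        six-seven 0 () _ _
        six-seven 1 (ℕ.s≤s ()) _ _
        six-seven 2 (ℕ.s≤s (ℕ.s≤s ())) _ _
        six-seven 3 (ℕ.s≤s (ℕ.s≤s (ℕ.s≤s ()))) _ _
        six-seven 4 (ℕ.s≤s (ℕ.s≤s (ℕ.s≤s (ℕ.s≤s ())))) _ _
        six-seven 5 (ℕ.s≤s (ℕ.s≤s (ℕ.s≤s (ℕ.s≤s (ℕ.s≤s ()))))) _ _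

    no-large : ∀ h → Nonzero h → ∀ {z} → q h ≡ z → + 1536 ≤ z → ⊥
    no-large h ne {z} e le = clash (q h) (subst (+ 1536 ≤_) (sym e) le) (subst₂ (λ a b → a + q h ≤ b) q0 ∑q (∑-≥-two q q≥0 h ne))
      where
      alg : ∀ z → (z - + 1536) + (+ 4096 - (+ 3072 + z)) ≡ -[1+ 511 ]
      alg = solve-∀
      clash : ∀ z → + 1536 ≤ z → + 3072 + z ≤ + 4096 → ⊥
      clash z p q = impossible 511 (gap p ⊞ gap q) (alg z)

    data Weight (h : F2^ 10) : Set where
      w16 : W h 2 → Weight h
      w24 : W h 3 → Weight h
      w32 : W h 4 → Weight h
      w40 : W h 5 → Weight h

    weights : ∀ h → Nonzero h → Weight h
    weights h ne = go (weight h)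
      where
      go : (∃ λ k → W h k × k ℕ.≤ 5) → Weight h
      go (0 , e , _) = ⊥-elim (no-large h ne (q-value h 0 e) (T-does (+ 1536 ℤ.≤? value 0) tt))
      go (1 , e , _) = ⊥-elim (no-large h ne (q-value h 1 e) (T-does (+ 1536 ℤ.≤? value 1) tt))
      go (2 , e , _) = w16 e
      go (3 , e , _) = w24 e
      go (4 , e , _) = w32 e
      go (5 , e , _) = w40 e
      go (suc (suc (suc (suc (suc (suc k))))) , _ , ℕ.s≤s (ℕ.s≤s (ℕ.s≤s (ℕ.s≤s (ℕ.s≤s ())))))

  -- A word d of weight 16 restricts M to 16 points on which the code is self-orthogonal, hence of
  -- dimension at most 8; so at least four words vanish there, too many for the count above.
  module Weight-16 (d : F2^ 10) (wd : wt M d ≡ + 16)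
    (L : List (F2^ 10)) (∑-L : ∀ g → sumL g L ≡ ∑ (λ x → off d M x * g x)) where
    private
      B : F2^ 10 → ℤ
      B = off d M

      length-L : + length L ≡ + 16
      length-L = trans (sym (sumL-1 L)) (trans (∑-L (λ _ → 1ℤ))
        (trans (∑-cong (λ x → ℤ.*-identityʳ (B x))) wd))

      so : ∀ a b → Even (sumL (λ p → ind a p * ind b p) L)
      so a b = subst Even (sym (trans (∑-L (λ p → ind a p * ind b p)) (∑-cong (λ x → alg (B x) (ind a x) (ind b x)))))
          (divides-off 1 {M = B} (divides-off 2 {M = M} (div A) d) b a)
        where alg : ∀ m a b → m * (a * b) ≡ m * b * a
              alg = solve-∀

      I : F2^ 10 → ℤ
      I = annihilator L
      G : ℤ
      G = ∑ I

      G≥0 : 0ℤ ≤ G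
      G≥0 = ∑-nonneg (λ e → δ≥0 (restrict L e))

      -- The dimension bound reads 2^20 ≤ 2^16 · G².
      four : + 4 ≤ G
      four = go G G≥0 (subst (λ n → + 1048576 ≤ size n * (G * G)) (ℤ.+-injective length-L) (annihilator-≥ L so))
        where
        go : ∀ g → 0ℤ ≤ g → + 1048576 ≤ + 65536 * (g * g) → + 4 ≤ g
        go (+ 0) _ le = ⊥-elim (refute (+ 1048576 ℤ.≤? 0ℤ) tt le)
        go (+ 1) _ le = ⊥-elim (refute (+ 1048576 ℤ.≤? + 65536) tt le)
        go (+ 2) _ le = ⊥-elim (refute (+ 1048576 ℤ.≤? + 262144) tt le)
        go (+ 3) _ le = ⊥-elim (refute (+ 1048576 ℤ.≤? + 589824) tt le)
        go (+ suc (suc (suc (suc n)))) _ _ = +≤+ (ℕ.s≤s (ℕ.s≤s (ℕ.s≤s (ℕ.s≤s ℕ.z≤n))))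

      vanish : ∀ e → restrict L e ≡ zeroVec (length L) → wt B e ≡ 0ℤ
      vanish e z = trans (sym (∑-L (ind e))) (restrict-sum L e z)

      wt-d⊕ : ∀ e → wt B e ≡ 0ℤ → wt M (d ⊕ e) ≡ + 16 + wt M e
      wt-d⊕ e z = alg (wt M e) (wt M (d ⊕ e)) (trans (sym (cong (λ z → + 2 * z) z)) (trans (wt-off d e M) (cong (λ z → z + wt M e - wt M (d ⊕ e)) wd)))
        where
        alg′ : ∀ a b → b ≡ + 16 + a - (+ 16 + a - b)
        alg′ = solve-∀
        alg : ∀ a b → 0ℤ ≡ + 16 + a - b → b ≡ + 16 + a
        alg a b e = trans (alg′ a b) (trans (cong (λ z → + 16 + a - z) (sym e)) (ℤ.+-identityʳ (+ 16 + a)))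

      B-d : ¬ (wt B d ≡ 0ℤ)
      B-d z = absurd (trans (sym (trans (∑-cong (λ x → go (M x) (dot d x))) wd)) z)
        where
        go : ∀ m b → m * bit b * bit b ≡ m * bit b
        go m true = ℤ.*-identityʳ (m * 1ℤ)
        go m false = trans (ℤ.*-zeroʳ (m * 0ℤ)) (sym (ℤ.*-zeroʳ m))
        absurd : ¬ (+ 16 ≡ 0ℤ)
        absurd ()

      -- The words d and e have disjoint supports, so w(d + e) = 16 + w(e). Among 16, 24, 32, 40
      -- this leaves w(e) = 16, or w(e) = 24 with w(d + e) = 40; either way a word of value 512
      -- occurs.
      special : ∀ e → Nonzero e → wt B e ≡ 0ℤ → + 512 ≤ q e + q (d ⊕ e)
      special e ne z = go (weights e ne) (weights (d ⊕ e) ne′)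
        where
        ne′ : Nonzero (d ⊕ e)
        ne′ z′ = B-d (subst (λ x → wt B x ≡ 0ℤ) (sym (⊕-zero⇒≡ d e z′)) z)
        left : ∀ {k} → W e k → + 512 ≤ value k → + 512 ≤ q e + q (d ⊕ e)
        left {k} w le = subst (_≤ q e + q (d ⊕ e)) (ℤ.+-identityʳ (+ 512)) (ℤ.+-mono-≤ (subst (+ 512 ≤_) (sym (q-value e k w)) le) (q≥0 (d ⊕ e)))
        right : ∀ {k} → W (d ⊕ e) k → + 512 ≤ value k → + 512 ≤ q e + q (d ⊕ e)
        right {k} w le = subst (_≤ q e + q (d ⊕ e)) (ℤ.+-identityˡ (+ 512)) (ℤ.+-mono-≤ (q≥0 e) (subst (+ 512 ≤_) (sym (q-value (d ⊕ e) k w)) le))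
        shifted : ∀ j k → T (not (does (2 ℕ.+ j ℕ.≟ k))) → W e j → W (d ⊕ e) k → ⊥
        shifted j k t w w′ = refute (2 ℕ.+ j ℕ.≟ k) t (ℕ.*-cancelʳ-≡ (2 ℕ.+ j) k 8 (ℤ.+-injective (trans (sym (trans (wt-d⊕ e z) (cong (λ x → + 16 + x) w))) w′)))
        go : Weight e → Weight (d ⊕ e) → + 512 ≤ q e + q (d ⊕ e)
        go (w16 w) _ = left {2} w ℤ.≤-refl
        go (w24 w) (w40 w′) = right {5} w′ ℤ.≤-refl
        go (w24 w) (w16 w′) = ⊥-elim (shifted 3 2 tt w w′)
        go (w24 w) (w24 w′) = ⊥-elim (shifted 3 3 tt w w′)
        go (w24 w) (w32 w′) = ⊥-elim (shifted 3 4 tt w w′)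
        go (w32 w) (w16 w′) = ⊥-elim (shifted 4 2 tt w w′)
        go (w32 w) (w24 w′) = ⊥-elim (shifted 4 3 tt w w′)
        go (w32 w) (w32 w′) = ⊥-elim (shifted 4 4 tt w w′)
        go (w32 w) (w40 w′) = ⊥-elim (shifted 4 5 tt w w′)
        go (w40 w) (w16 w′) = ⊥-elim (shifted 5 2 tt w w′)
        go (w40 w) (w24 w′) = ⊥-elim (shifted 5 3 tt w w′)
        go (w40 w) (w32 w′) = ⊥-elim (shifted 5 4 tt w w′)
        go (w40 w) (w40 w′) = ⊥-elim (shifted 5 5 tt w w′)

      -- The word d does not vanish on its own support, so the annihilator and its translate by d
      -- are disjoint and no value of q is counted twice.
      pairs : ∑ (λ e → I e * (q e + q (e ⊕ d))) ≤ + 4096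
      pairs = subst₂ _≤_ (sym rearrange) ∑q (∑-mono (λ e → le (I e) (I (e ⊕ d)) (q e) (q≥0 e) (cases e)))
        where
        rearrange : ∑ (λ e → I e * (q e + q (e ⊕ d))) ≡ ∑ (λ e → I e * q e + I (e ⊕ d) * q e)
        rearrange = trans (∑-cong (λ e → ℤ.*-distribˡ-+ (I e) (q e) (q (e ⊕ d)))) (trans (∑-+ (λ e → I e * q e) (λ e → I e * q (e ⊕ d)))
          (trans (cong (λ z → ∑ (λ e → I e * q e) + z) (trans (∑-cong (λ e → cong (λ x → I x * q (e ⊕ d)) (sym (⊕-cancelʳ e d))))
             (∑-translate d (λ e → I (e ⊕ d) * q e))))
           (sym (∑-+ (λ e → I e * q e) (λ e → I (e ⊕ d) * q e)))))
        cases : ∀ e → (I e ≡ 0ℤ × I (e ⊕ d) ≡ 0ℤ) ⊎ (I e ≡ 0ℤ × I (e ⊕ d) ≡ 1ℤ) ⊎ (I e ≡ 1ℤ × I (e ⊕ d) ≡ 0ℤ)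
        cases e = go (δ-cases (restrict L e)) (δ-cases (restrict L (e ⊕ d)))
          where
          go : _ → _ → _
          go (inj₂ (_ , a)) (inj₂ (_ , b)) = inj₁ (a , b)
          go (inj₂ (_ , a)) (inj₁ (_ , b)) = inj₂ (inj₁ (a , b))
          go (inj₁ (_ , a)) (inj₂ (_ , b)) = inj₂ (inj₂ (a , b))
          go (inj₁ (za , _)) (inj₁ (zb , _)) = ⊥-elim (B-d (vanish d (trans (sym (⊕-identityˡ (restrict L d)))
            (trans (cong (_⊕ restrict L d) (sym za)) (trans (sym (restrict-⊕ L e d)) zb)))))
        le : ∀ i j q → 0ℤ ≤ q → (i ≡ 0ℤ × j ≡ 0ℤ) ⊎ (i ≡ 0ℤ × j ≡ 1ℤ) ⊎ (i ≡ 1ℤ × j ≡ 0ℤ) → i * q + j * q ≤ q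
        le _ _ q q≥0 (inj₁ (refl , refl)) = q≥0
        le _ _ q q≥0 (inj₂ (inj₁ (refl , refl))) = ℤ.≤-reflexive (trans (ℤ.+-identityˡ (1ℤ * q)) (ℤ.*-identityˡ q))
        le _ _ q q≥0 (inj₂ (inj₂ (refl , refl))) = ℤ.≤-reflexive (trans (ℤ.+-identityʳ (1ℤ * q)) (ℤ.*-identityˡ q))

      -- The element 0 contributes 3072 + 512, every other one at least 512. With G ≥ 4 this makes
      -- at least 5120, more than the available 4096.
      pairs≥ : + 512 * G + + 3072 ≤ ∑ (λ e → I e * (q e + q (e ⊕ d)))
      pairs≥ = subst (_≤ ∑ (λ e → I e * (q e + q (e ⊕ d))))
          (trans (∑-+ (λ e → + 512 * I e) (λ e → δ e * + 3072)) (cong₂ _+_ (∑-* (+ 512) I) (∑-δ (λ _ → + 3072))))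
          (∑-mono le)
        where
        le : ∀ e → + 512 * I e + δ e * + 3072 ≤ I e * (q e + q (e ⊕ d))
        le e = [ (λ { (refl , z) → subst₂ _≤_ (cong₂ (λ i z → + 512 * i + z * + 3072) (sym I0) (sym z))
                        (cong₂ (λ i z → i * z) (sym I0) (sym (cong₂ _+_ q0 (trans (cong q (⊕-identityˡ d)) (q-value d 2 wd))))) ℤ.≤-refl })
               , (λ { (ne , z) → subst (λ z → + 512 * I e + z * + 3072 ≤ I e * (q e + q (e ⊕ d))) (sym z) (other ne) }) ]′ (δ-cases e)
          where
          I0 : I (zeroVec 10) ≡ 1ℤ
          I0 = trans (cong δ (restrict-zero L)) (δ-zero (length L))
          other : Nonzero e → + 512 * I e + 0ℤ * + 3072 ≤ I e * (q e + q (e ⊕ d))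
          other ne = [ (λ { (zr , i) → subst (λ i → + 512 * i + 0ℤ * + 3072 ≤ i * (q e + q (e ⊕ d))) (sym i)
                          (subst (+ 512 ≤_) (sym (trans (ℤ.*-identityˡ (q e + q (e ⊕ d))) (cong (λ x → q e + q x) (⊕-comm e d)))) (special e ne (vanish e zr))) })
                     , (λ { (_ , i) → subst (λ i → + 512 * i + 0ℤ * + 3072 ≤ i * (q e + q (e ⊕ d))) (sym i) ℤ.≤-refl }) ]′ (δ-cases (restrict L e))

    absurd : ⊥
    absurd = clash G four (ℤ.≤-trans pairs≥ pairs)
      where
      alg : ∀ g → + 512 * (g - + 4) + (+ 4096 - (+ 512 * g + + 3072)) ≡ -[1+ 1023 ]
      alg = solve-∀
      clash : ∀ g → + 4 ≤ g → + 512 * g + + 3072 ≤ + 4096 → ⊥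
      clash g p q = impossible 1023 (nat≥0 {512} ⊠ gap p ⊞ gap q) (alg g)

  private
    no-16 : ∀ d → W d 2 → ⊥
    no-16 d w = Weight-16.absurd d w (support (off d M)) (sumL-support (off d M) (λ x → go (zero-one A x) (dot d x)))
      where go : ∀ {m} → m ≡ 0ℤ ⊎ m ≡ 1ℤ → ∀ b → m * bit b ≡ 0ℤ ⊎ m * bit b ≡ 1ℤ
            go (inj₁ refl) b = inj₁ refl
            go (inj₂ refl) true = inj₂ refl
            go (inj₂ refl) false = inj₁ refl

    -- If there were none, q would vanish off the origin and its sum would be 3072 instead of 4096.
    word-40 : ∃ λ c → Nonzero c × W c 5
    word-40 = [ (λ x → x) , (λ none → ⊥-elim (3072≢4096 (trans (sym (trans (∑-cong (only-origin none)) (∑-δ {10} (λ _ → + 3072)))) ∑q))) ]′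
        (decide (λ c → ¬? (zero? c) ×-dec (wt M c ℤ.≟ + 40)))
      where
      3072≢4096 : ¬ (+ 3072 ≡ + 4096)
      3072≢4096 = refute (+ 3072 ℤ.≟ + 4096) tt
      only-origin : (∀ c → ¬ (Nonzero c × W c 5)) → ∀ h → q h ≡ δ h * + 3072
      only-origin none h = [ (λ { (refl , z) → trans q0 (sym (cong (_* + 3072) z)) })
                           , (λ { (ne , z) → trans (vanishes ne (weights h ne)) (sym (cong (_* + 3072) z)) }) ]′ (δ-cases h)
        where
        vanishes : Nonzero h → Weight h → q h ≡ 0ℤ
        vanishes ne (w16 w) = ⊥-elim (no-16 h w)
        vanishes ne (w24 w) = q-value h 3 w
        vanishes ne (w32 w) = q-value h 4 w
        vanishes ne (w40 w) = ⊥-elim (none h (ne , w))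

  -- The 19 points off a word c of weight 40: the quartic (y - 11)(y - 3)(y + 5)(y + 9), which has no
  -- cubic term, contradicts the lower bound 3n² - 2n for the number of quadruples with sum 0.
  module Weight-40 (c : F2^ 10) (c≢0 : Nonzero c) (wc : wt M c ≡ + 40) where
    private
      Z : F2^ 10 → ℤ
      Z = on c M

      ZA : Aff 4 1 19 Z
      ZA = on-aff {4} A c 19 (cong₂ _-_ (total A) wc)

      quartic : ℤ → ℤ
      quartic y = y * y * (y * y) + -[1+ 117 ] * (y * y) + -[1+ 167 ] * y + + 1485

      hat-Z : ∀ h → hat Z h ≡ + 59 - wt M h - wt M (h ⊕ c)
      hat-Z h = trans (hat-wt Z h) (trans (cong₂ _-_ (total ZA) (trans (wt-on c h M) (cong₂ (λ a x → wt M h - a + wt M x) wc (⊕-comm c h))))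
          (alg (wt M h) (wt M (h ⊕ c))))
        where alg : ∀ a b → + 19 - (a - + 40 + b) ≡ + 59 - a - b
              alg = solve-∀

      -- The factor 24 is forced: for h = 0 or h = c both sides equal 86016, and for the weights 32
      -- and 40 both equal 12288. In all other possible cases the quartic vanishes.
      Bounded : F2^ 10 → Set
      Bounded h = quartic (hat Z h) ≤ + 24 * (q h + q (h ⊕ c))

      closed : ∀ j k → T (does (quartic (+ 59 - + (j ℕ.* 8) - + (k ℕ.* 8)) ℤ.≤? + 24 * (value j + value k))) →
        ∀ h → W h j → W (h ⊕ c) k → Bounded h
      closed j k t h w w′ = subst₂ _≤_ (cong quartic (sym (trans (hat-Z h) (cong₂ (λ a b → + 59 - a - b) w w′))))
        (cong (+ 24 *_) (cong₂ _+_ (sym (q-value h j w)) (sym (q-value (h ⊕ c) k w′)))) (T-does (_ ℤ.≤? _) t)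

      -- Two words of weight 40 with a sum of weight 40 would cover 60 points.
      no-triangle : ∀ h → W h 5 → W (h ⊕ c) 5 → ⊥
      no-triangle h w w′ = clash (wt Z h) (trans (wt-on c h M) (cong₂ _+_ (cong₂ _-_ w wc) (trans (cong (wt M) (⊕-comm c h)) w′))) (wt≤n ZA h)
        where
        alg : ∀ z → + 2 * (+ 19 - z) + (+ 2 * z - + 40) ≡ -[1+ 1 ]
        alg = solve-∀
        clash : ∀ z → + 2 * z ≡ + 40 → z ≤ + 19 → ⊥
        clash z e le = impossible 1 (nat≥0 {2} ⊠ gap le ⊞ gap (ℤ.≤-reflexive (sym e))) (alg z)

      bounded : ∀ h → Bounded h
      bounded h = [ (λ { (refl , _) → closed 0 5 tt (zeroVec 10) (wt-zero M) (trans (cong (wt M) (⊕-identityˡ c)) wc) })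
                  , (λ { (ne , _) → [ (λ { (z , _) → closed 5 0 tt h (trans (cong (wt M) (⊕-zero⇒≡ h c z)) wc) (trans (cong (wt M) z) (wt-zero M)) })
                                    , (λ { (ne′ , _) → go (weights h ne) (weights (h ⊕ c) ne′) }) ]′ (δ-cases (h ⊕ c)) }) ]′ (δ-cases h)
        where
        go : Weight h → Weight (h ⊕ c) → Bounded h
        go (w16 w) _ = ⊥-elim (no-16 h w)
        go _ (w16 w) = ⊥-elim (no-16 (h ⊕ c) w)
        go (w24 w) (w24 w′) = closed 3 3 tt h w w′
        go (w24 w) (w32 w′) = closed 3 4 tt h w w′
        go (w24 w) (w40 w′) = closed 3 5 tt h w w′
        go (w32 w) (w24 w′) = closed 4 3 tt h w w′
        go (w32 w) (w32 w′) = closed 4 4 tt h w w′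
        go (w32 w) (w40 w′) = closed 4 5 tt h w w′
        go (w40 w) (w24 w′) = closed 5 3 tt h w w′
        go (w40 w) (w32 w′) = closed 5 4 tt h w w′
        go (w40 w) (w40 w′) = ⊥-elim (no-triangle h w w′)

      upper : ∑ (λ h → quartic (hat Z h)) ≤ + 196608
      upper = subst (∑ (λ h → quartic (hat Z h)) ≤_) (trans (∑-* (+ 24) (λ h → q h + q (h ⊕ c)))
        (cong (λ z → + 24 * z) (trans (∑-+ q (λ h → q (h ⊕ c))) (cong₂ _+_ ∑q (trans (∑-translate c q) ∑q))))) (∑-mono bounded)

      C : F2^ 10 → ℤ
      C = conv Z Z

      ∑-quartic : ∑ (λ h → quartic (hat Z h)) ≡ + 1024 * (∑² C + -[1+ 756 ])
      ∑-quartic = trans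
        (trans (∑-+ (λ h → y h * y h * (y h * y h) + -[1+ 117 ] * (y h * y h) + -[1+ 167 ] * y h) (λ _ → + 1485))
          (cong₂ _+_ (trans (∑-+ (λ h → y h * y h * (y h * y h) + -[1+ 117 ] * (y h * y h)) (λ h → -[1+ 167 ] * y h))
            (cong₂ _+_ (trans (∑-+ (λ h → y h * y h * (y h * y h)) (λ h → -[1+ 117 ] * (y h * y h)))
              (cong₂ _+_ (trans (∑-cong (λ h → cong₂ _*_ (sym (hat-conv Z Z h)) (sym (hat-conv Z Z h)))) (parseval C C))
                         (trans (∑-* -[1+ 117 ] (λ h → y h * y h)) (cong (λ z → -[1+ 117 ] * z) (trans (parseval Z Z) (cong (λ z → + 1024 * z) (∑²-1 ZA)))))))
              (trans (∑-* -[1+ 167 ] y) (cong (λ z → -[1+ 167 ] * z) (trans (hat-size Z) (cong (λ z → + 1024 * z) (on-zero c M (proj₂ P))))))))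
            (∑-const {10} (+ 1485))))
        (alg (∑² C))
        where
        y : F2^ 10 → ℤ
        y = hat Z
        alg : ∀ s → + 1024 * s + -[1+ 117 ] * (+ 1024 * + 19) + -[1+ 167 ] * (+ 1024 * 0ℤ) + + 1024 * + 1485 ≡ + 1024 * (s + -[1+ 756 ])
        alg = solve-∀

      -- Off the origin C is even and nonnegative, whence C² ≥ 2C; at the origin 19² = 2 · 19 + 323.
      -- The sum is 2 · 19² + 323 = 1045.
      quadruples : + 1045 ≤ ∑² C
      quadruples = subst (_≤ ∑² C) (trans (∑-+ (λ p → + 2 * C p) (λ p → δ p * + 323))
          (cong₂ _+_ (trans (∑-* (+ 2) C) (cong (λ z → + 2 * z) (trans (∑-conv Z Z) (cong₂ _*_ (total ZA) (total ZA))))) (∑-δ {10} (λ _ → + 323))))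
        (∑-mono le)
        where
        C0 : C (zeroVec 10) ≡ + 19
        C0 = trans (conv-zero Z Z) (∑²-1 ZA)
        square : ∀ z → 0ℤ ≤ z → Even z → + 2 * z + 0ℤ * + 323 ≤ z * z
        square _ _ (divides m refl) = ≤-by (alg m) (nat≥0 {4} ⊠ gap (square-≥ m))
          where alg : ∀ m → m * + 2 * (m * + 2) - (+ 2 * (m * + 2) + 0ℤ * + 323) ≡ + 4 * (m * m - m)
                alg = solve-∀
        le : ∀ p → + 2 * C p + δ p * + 323 ≤ C p * C p
        le p = [ (λ { (refl , z) → subst₂ _≤_ (cong₂ (λ a d → + 2 * a + d * + 323) (sym C0) (sym z)) (cong₂ _*_ (sym C0) (sym C0)) ℤ.≤-refl })
               , (λ { (ne , z) → subst (λ d → + 2 * C p + d * + 323 ≤ C p * C p) (sym z)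
                   (square (C p) (conv≥0 {f = Z} {Z} (nonneg ZA) (nonneg ZA) p) (conv-even Z p ne)) }) ]′ (δ-cases p)

    absurd : ⊥
    absurd = clash (∑² C) quadruples (subst (_≤ + 196608) ∑-quartic upper)
      where
      alg : ∀ s → + 1024 * (s - + 1045) + (+ 196608 - + 1024 * (s + -[1+ 756 ])) ≡ -[1+ 98303 ]
      alg = solve-∀
      clash : ∀ s → + 1045 ≤ s → + 1024 * (s + -[1+ 756 ]) ≤ + 196608 → ⊥
      clash s p q = impossible 98303 (nat≥0 {1024} ⊠ gap p ⊞ gap q) (alg s)

  absurd : ⊥
  absurd = go word-40
    where go : (∃ λ c → Nonzero c × W c 5) → ⊥
          go (c , ne , w) = Weight-40.absurd c ne w

exclude₈-59 : Ex 8 1 59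
exclude₈-59 {v} M P = descend v _ (proj₂ (raise 10 P))
  where
  descend : ∀ k (N : F2^ (10 ℕ.+ k) → ℤ) → Pts 8 1 59 N → ⊥
  descend zero N P = Dimension-10.absurd P
  descend (suc k) N P = go (project-59 (size-grow 11 k) P)
    where go : (∃ λ (N′ : F2^ (10 ℕ.+ k) → ℤ) → Pts 8 1 59 N′) → ⊥
          go (N′ , P′) = descend k N′ P′

-- From lists of points to multiplicity functions

eqVec-δ : ∀ {v} (x y : F2^ v) → + (if eqVec x y then 1 else 0) ≡ δ (x ⊕ y)
eqVec-δ {v} x y with ≡-dec _≟B_ x y
... | yes refl = sym (trans (cong δ (⊕-self x)) (δ-zero v))
... | no ne = sym (δ-nonzero (x ⊕ y) (λ z → ne (⊕-zero⇒≡ x y z)))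

∑-count : ∀ {v} (L : List (F2^ v)) g → ∑ (λ x → + countB (eqVec x) L * g x) ≡ sumL g L
∑-count {v} [] g = ∑-zero {v}
∑-count (y ∷ L) g = trans (∑-cong (λ x → trans (cong (_* g x) (trans (ℤ.pos-+ (if eqVec x y then 1 else 0) (countB (eqVec x) L))
      (cong (_+ + countB (eqVec x) L) (eqVec-δ x y)))) (ℤ.*-distribʳ-+ (g x) (δ (x ⊕ y)) (+ countB (eqVec x) L))))
  (trans (∑-+ (λ x → δ (x ⊕ y) * g x) (λ x → + countB (eqVec x) L * g x)) (cong₂ _+_
    (trans (∑-cong (λ x → cong (λ z → δ (x ⊕ y) * g z) (sym (⊕-cancelʳ x y))))
      (trans (∑-translate y (λ x → δ x * g (x ⊕ y))) (trans (∑-δ (λ x → g (x ⊕ y))) (cong g (⊕-identityˡ y)))))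
    (∑-count L g)))

countB-≤ : ∀ {A : Set} (f : A → Bool) L → countB f L ℕ.≤ length L
countB-≤ f [] = ℕ.z≤n
countB-≤ f (x ∷ L) with f x
... | true = ℕ.s≤s (countB-≤ f L)
... | false = ℕ.m≤n⇒m≤1+n (countB-≤ f L)

weight-count : ∀ {v} (h : F2^ v) L → length L ℕ.∸ countB (λ x → if dot h x then false else true) L ≡ countB (dot h) L
weight-count h [] = refl
weight-count h (x ∷ L) with dot h x
... | true = trans (ℕ.+-∸-assoc 1 (countB-≤ _ L)) (cong suc (weight-count h L))
... | false = weight-count h L

sumL-ind : ∀ {v} (h : F2^ v) L → sumL (ind h) L ≡ + countB (dot h) L
sumL-ind h [] = refl
sumL-ind h (x ∷ L) with dot h x
... | true = cong (λ z → 1ℤ + z) (sumL-ind h L)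
... | false = trans (ℤ.+-identityˡ _) (sumL-ind h L)

countB-zero : ∀ {v} (L : List (F2^ v)) → countB (dot (zeroVec v)) L ≡ 0
countB-zero [] = refl
countB-zero (x ∷ L) rewrite dot-zeroˡ x = countB-zero L

divisible-all : ∀ {Δ v} {M : Multiset v} → Divisible Δ M → ∀ h → Δ ℕ∣.∣ countB (dot h) (elems M)
divisible-all {Δ} {v} {M} d h with zero? h
... | yes refl = subst (Δ ℕ∣.∣_) (sym (countB-zero (elems M))) (Δ ℕ∣.∣0)
... | no ne = subst (Δ ℕ∣.∣_) (weight-count h (elems M)) (d h ne)

eqVec-refl : ∀ {v} (x : F2^ v) → eqVec x x ≡ true
eqVec-refl x with ≡-dec _≟B_ x x
... | yes _ = refl
... | no ne = ⊥-elim (ne refl)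

eqVec-≢ : ∀ {v} (x y : F2^ v) → ¬ (x ≡ y) → eqVec x y ≡ false
eqVec-≢ x y ne with ≡-dec _≟B_ x y
... | yes e = ⊥-elim (ne e)
... | no _ = refl

countB-absent : ∀ {v} (x : F2^ v) L → (∀ y → y ∈ L → ¬ (x ≡ y)) → countB (eqVec x) L ≡ 0
countB-absent x [] f = refl
countB-absent x (y ∷ L) f rewrite eqVec-≢ x y (f y (here refl)) = countB-absent x L (λ z i → f z (there i))

maxList-≥ : ∀ {A : Set} (f : A → ℕ) {x} L → x ∈ L → f x ℕ.≤ maxList (map f L)
maxList-≥ f (x ∷ L) (here refl) = ℕ.m≤m⊔n (f x) _
maxList-≥ f (y ∷ L) (there i) = ℕ.≤-trans (maxList-≥ f L i) (ℕ.m≤n⊔m (f y) _)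

mult-≤-γ₁ : ∀ {v} (M : Multiset v) x → mult M x ℕ.≤ γ₁ M
mult-≤-γ₁ M x = go (member? (elems M))
  where
  member? : ∀ L → (x ∈ L) ⊎ (∀ y → y ∈ L → ¬ (x ≡ y))
  member? [] = inj₂ (λ _ ())
  member? (y ∷ L) with ≡-dec _≟B_ x y | member? L
  ... | yes e | _ = inj₁ (here e)
  ... | no _ | inj₁ i = inj₁ (there i)
  ... | no ne | inj₂ f = inj₂ (λ { _ (here refl) → ne ; z (there i) → f z i })
  go : (x ∈ elems M) ⊎ (∀ y → y ∈ elems M → ¬ (x ≡ y)) → mult M x ℕ.≤ γ₁ M
  go (inj₁ i) = maxList-≥ (mult M) (elems M) i
  go (inj₂ f) = subst (ℕ._≤ γ₁ M) (sym (countB-absent x (elems M) f)) ℕ.z≤n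

multiplicities : ∀ {Δ μ n v} (M : Multiset v) → Divisible Δ M → card M ≡ n → γ₁ M ℕ.≤ μ → Pts Δ μ n (λ x → + mult M x)
multiplicities {Δ} {v = v} M d refl le = record
  { nonneg = λ x → +≤+ ℕ.z≤n
  ; bound = λ x → +≤+ (ℕ.≤-trans (mult-≤-γ₁ M x) le)
  ; total = trans (∑-cong (λ x → sym (ℤ.*-identityʳ (+ mult M x)))) (trans (∑-count (elems M) (λ _ → 1ℤ)) (sumL-1 (elems M)))
  ; div = λ h → subst (+ Δ ∣_) (sym (trans (∑-count (elems M) (ind h)) (sumL-ind h (elems M)))) (∣ᵤ⇒∣ (divisible-all {M = M} d h)) } ,
  cong +_ (countB-absent (zeroVec v) (elems M) (λ y i e → All.lookup (points M) i (sym e)))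

-- From exclusions and examples to values of Γ

gammaInf : ∀ {Δ n} → (∀ μ → Ex Δ μ n) → GammaInf Δ n
gammaInf ex v M d c = ex (γ₁ M) _ (multiplicities M d c ℕ.≤-refl)

gammaInfs : ∀ {Δ} ns → (∀ μ → All (Ex Δ μ) ns) → All (GammaInf Δ) ns
gammaInfs ns ex = All.tabulate (λ i → gammaInf (λ μ → All.lookup (ex μ) i))

record Realised (Δ n g : ℕ) : Set where
  constructor realised
  field
    {dimension} : ℕ
    multiset : Multiset dimension
    divisible : Divisible Δ multiset
    cardinality : card multiset ≡ n
    maximum : γ₁ multiset ≡ g

gammaIs : ∀ {Δ n} μ → Realised Δ n (suc μ) → Ex Δ μ n → GammaIs Δ n (suc μ)
gammaIs μ (realised M d c g) ex = (_ , M , d , c , g) , λ v M d c → ℕ.≰⇒> (λ le → ex _ (multiplicities M d c le))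

not-1 : ∀ {Δ n} → Ex Δ 1 n → ¬ GammaIs Δ n 1
not-1 ex ((v , M , d , c , g) , _) = ex _ (multiplicities M d c (ℕ.≤-reflexive g))

exclude-0 : ∀ {Δ n} → Ex Δ 0 (suc n)
exclude-0 M (A , _) = absurd (ℤ.≤-trans (∑²-≥ A) (∑²-≤ A))
  where absurd : ∀ {n} → ¬ (+ suc n ≤ 0ℤ)
        absurd (+≤+ ())

-- Constructions

countB-++ : ∀ {A : Set} (f : A → Bool) xs ys → countB f (xs ++ ys) ≡ countB f xs ℕ.+ countB f ys
countB-++ f [] ys = refl
countB-++ f (x ∷ xs) ys = trans (cong ((if f x then 1 else 0) ℕ.+_) (countB-++ f xs ys)) (sym (ℕ.+-assoc (if f x then 1 else 0) _ _))

countB-map : ∀ {A B : Set} (f : B → Bool) (f′ : A → Bool) (g : A → B) → (∀ x → f (g x) ≡ f′ x) → ∀ xs → countB f (map g xs) ≡ countB f′ xs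
countB-map f f′ g e [] = refl
countB-map f f′ g e (x ∷ xs) = cong₂ (λ b n → (if b then 1 else 0) ℕ.+ n) (e x) (countB-map f f′ g e xs)

countB-false : ∀ {A : Set} (L : List A) → countB (λ _ → false) L ≡ 0
countB-false [] = refl
countB-false (_ ∷ L) = countB-false L

maxList-++ : ∀ xs ys → maxList (xs ++ ys) ≡ maxList xs ℕ.⊔ maxList ys
maxList-++ [] ys = refl
maxList-++ (x ∷ xs) ys = trans (cong (x ℕ.⊔_) (maxList-++ xs ys)) (sym (ℕ.⊔-assoc x _ _))

module DirectSum {v w} (M : Multiset v) (N : Multiset w) where
  inl : F2^ v → F2^ (v ℕ.+ w)
  inl x = x Data.Vec.++ zeroVec w

  inr : F2^ w → F2^ (v ℕ.+ w)
  inr y = zeroVec v Data.Vec.++ y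

  zero-++ : ∀ v → zeroVec (v ℕ.+ w) ≡ zeroVec v Data.Vec.++ zeroVec w
  zero-++ zero = refl
  zero-++ (suc v) = cong (false ∷_) (zero-++ v)

  ++-injectiveʳ : ∀ {v} (x y : F2^ v) {z z′ : F2^ w} → x Data.Vec.++ z ≡ y Data.Vec.++ z′ → z ≡ z′
  ++-injectiveʳ [] [] e = e
  ++-injectiveʳ (a ∷ x) (b ∷ y) e = ++-injectiveʳ x y (cong Data.Vec.tail e)

  ++-injectiveˡ : ∀ {v} (x y : F2^ v) {z z′ : F2^ w} → x Data.Vec.++ z ≡ y Data.Vec.++ z′ → x ≡ y
  ++-injectiveˡ [] [] e = refl
  ++-injectiveˡ (a ∷ x) (b ∷ y) e = cong₂ _∷_ (cong Data.Vec.head e) (++-injectiveˡ x y (cong Data.Vec.tail e))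

  inl-nonzero : ∀ x → IsPoint x → IsPoint (inl x)
  inl-nonzero x p e = p (++-injectiveˡ x (zeroVec v) (trans e (zero-++ v)))

  inr-nonzero : ∀ y → IsPoint y → IsPoint (inr y)
  inr-nonzero y p e = p (++-injectiveʳ (zeroVec v) (zeroVec v) (trans e (zero-++ v)))

  sum : Multiset (v ℕ.+ w)
  sum = mkMultiset (map inl (elems M) ++ map inr (elems N))
    (All.++⁺ (All.map⁺ (All.map (λ {x} → inl-nonzero x) (points M))) (All.map⁺ (All.map (λ {y} → inr-nonzero y) (points N))))

  dot-++ : ∀ {v} (h x : F2^ v) (k y : F2^ w) → dot (h Data.Vec.++ k) (x Data.Vec.++ y) ≡ dot h x xor dot k y
  dot-++ [] [] k y = refl
  dot-++ (a ∷ h) (b ∷ x) k y = trans (cong ((a ∧ b) xor_) (dot-++ h x k y)) (sym (xor-assoc (a ∧ b) (dot h x) (dot k y)))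

  dot-inl : ∀ h k x → dot (h Data.Vec.++ k) (inl x) ≡ dot h x
  dot-inl h k x = trans (dot-++ h x k (zeroVec w)) (trans (cong (dot h x xor_) (dot-zeroʳ k)) (xor-identityʳ (dot h x)))

  dot-inr : ∀ h k y → dot (h Data.Vec.++ k) (inr y) ≡ dot k y
  dot-inr h k y = trans (dot-++ h (zeroVec v) k y) (cong (_xor dot k y) (dot-zeroʳ h))

  sum-divisible : ∀ {Δ} → Divisible Δ M → Divisible Δ N → Divisible Δ sum
  sum-divisible {Δ} d e h _ with Data.Vec.splitAt v h
  ... | a , b , refl = subst (Δ ℕ∣.∣_) (sym (trans (weight-count (a Data.Vec.++ b) (elems sum))
      (trans (countB-++ (dot (a Data.Vec.++ b)) (map inl (elems M)) (map inr (elems N)))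
        (cong₂ ℕ._+_ (countB-map _ (dot a) inl (dot-inl a b) (elems M)) (countB-map _ (dot b) inr (dot-inr a b) (elems N))))))
    (ℕ∣.∣m∣n⇒∣m+n (divisible-all {M = M} d a) (divisible-all {M = N} e b))

  sum-card : card sum ≡ card M ℕ.+ card N
  sum-card = trans (List.length-++ (map inl (elems M))) (cong₂ ℕ._+_ (List.length-map inl (elems M)) (List.length-map inr (elems N)))

  eqVec-cong : ∀ {v w} (f : F2^ v → F2^ w) → (∀ {x y} → f x ≡ f y → x ≡ y) → ∀ x y → eqVec (f x) (f y) ≡ eqVec x y
  eqVec-cong f inj x y with ≡-dec _≟B_ x y
  ... | yes refl = eqVec-refl (f x)
  ... | no ne = eqVec-≢ (f x) (f y) (λ e → ne (inj e))

  mult-inl : ∀ x → IsPoint x → mult sum (inl x) ≡ mult M x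
  mult-inl x p = trans (countB-++ (eqVec (inl x)) (map inl (elems M)) (map inr (elems N)))
    (trans (cong₂ ℕ._+_ (countB-map _ (eqVec x) inl (eqVec-cong inl (++-injectiveˡ _ _) x) (elems M))
      (trans (countB-map (eqVec (inl x)) (λ _ → false) inr (λ y → eqVec-≢ (inl x) (inr y) (λ e → p (++-injectiveˡ x (zeroVec v) e))) (elems N)) (countB-false (elems N))))
      (ℕ.+-identityʳ _))

  mult-inr : ∀ y → IsPoint y → mult sum (inr y) ≡ mult N y
  mult-inr y p = trans (countB-++ (eqVec (inr y)) (map inl (elems M)) (map inr (elems N)))
    (cong₂ ℕ._+_ (trans (countB-map (eqVec (inr y)) (λ _ → false) inl (λ x → eqVec-≢ (inr y) (inl x) (λ e → p (++-injectiveʳ (zeroVec v) x e))) (elems M)) (countB-false (elems M)))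
      (countB-map _ (eqVec y) inr (eqVec-cong inr (++-injectiveʳ (zeroVec v) (zeroVec v)) y) (elems N)))

  map-points : ∀ {v w} (f : F2^ v → F2^ w) (m : F2^ w → ℕ) (m′ : F2^ v → ℕ) → (∀ x → IsPoint x → m (f x) ≡ m′ x) →
    ∀ {L} → All IsPoint L → map m (map f L) ≡ map m′ L
  map-points f m m′ e [] = refl
  map-points f m m′ e (p ∷ ps) = cong₂ _∷_ (e _ p) (map-points f m m′ e ps)

  sum-γ₁ : γ₁ sum ≡ γ₁ M ℕ.⊔ γ₁ N
  sum-γ₁ = trans (cong maxList (List.map-++ (mult sum) (map inl (elems M)) (map inr (elems N))))
    (trans (maxList-++ (map (mult sum) (map inl (elems M))) _) (cong₂ (λ a b → maxList a ℕ.⊔ maxList b)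
      (map-points inl (mult sum) (mult M) mult-inl (points M)) (map-points inr (mult sum) (mult N) mult-inr (points N))))

infixr 5 _⊎ᴿ_
_⊎ᴿ_ : ∀ {Δ m n g g′} → Realised Δ m g → Realised Δ n g′ → Realised Δ (m ℕ.+ n) (g ℕ.⊔ g′)
realised M d refl refl ⊎ᴿ realised N e refl refl = realised sum (sum-divisible d e) sum-card sum-γ₁
  where open DirectSum M N

binary : ∀ v → ℕ → F2^ v
binary zero n = []
binary (suc v) n = (n ℕ.% 2 ℕ.≡ᵇ 1) ∷ binary v (n ℕ./ 2)

everywhere : ∀ v → (F2^ v → Bool) → Bool
everywhere zero f = f []
everywhere (suc v) f = everywhere v (λ x → f (false ∷ x)) ∧ everywhere v (λ x → f (true ∷ x))

everywhere-sound : ∀ v f → T (everywhere v f) → ∀ x → T (f x)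
everywhere-sound zero f t [] = t
everywhere-sound (suc v) f t (false ∷ x) = everywhere-sound v _ (proj₁ (T-∧ (everywhere v (λ x → f (false ∷ x))) _ t)) x
everywhere-sound (suc v) f t (true ∷ x) = everywhere-sound v _ (proj₂ (T-∧ (everywhere v (λ x → f (false ∷ x))) _ t)) x

nonzeroᵇ : ∀ {v} → F2^ v → Bool
nonzeroᵇ [] = false
nonzeroᵇ (b ∷ x) = b ∨ nonzeroᵇ x

nonzeroᵇ-zero : ∀ v → nonzeroᵇ (zeroVec v) ≡ false
nonzeroᵇ-zero zero = refl
nonzeroᵇ-zero (suc v) = nonzeroᵇ-zero v

allNonzero : ∀ {v} → List (F2^ v) → Bool
allNonzero [] = true
allNonzero (x ∷ L) = nonzeroᵇ x ∧ allNonzero L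

allNonzero-sound : ∀ {v} (L : List (F2^ v)) → T (allNonzero L) → All IsPoint L
allNonzero-sound [] t = []
allNonzero-sound {v} (x ∷ L) t with T-∧ (nonzeroᵇ x) _ t
... | t₁ , t₂ = (λ { refl → subst T (nonzeroᵇ-zero v) t₁ }) ∷ allNonzero-sound L t₂

divisibleᵇ : ∀ Δ .{{_ : ℕ.NonZero Δ}} v → List (F2^ v) → Bool
divisibleᵇ Δ v L = everywhere v (λ h → countB (dot h) L ℕ.% Δ ℕ.≡ᵇ 0)

realise : ∀ Δ .{{_ : ℕ.NonZero Δ}} v (ns : List ℕ) → let L = map (binary v) ns in
  T (allNonzero L) → T (divisibleᵇ Δ v L) → Realised Δ (length L) (maxList (map (λ x → countB (eqVec x) L) L))
realise Δ v ns t d = realised (mkMultiset L (allNonzero-sound L t))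
  (λ h _ → subst (Δ ℕ∣.∣_) (sym (weight-count h L)) (ℕ∣.m%n≡0⇒n∣m _ Δ (ℕ.≡ᵇ⇒≡ _ 0 (everywhere-sound v _ d h)))) refl refl
  where L = map (binary v) ns

repeat : ℕ → List ℕ → List ℕ
repeat zero ns = []
repeat (suc k) ns = ns ++ repeat k ns

-- Points are given by their binary expansions. The sets of 17 to 20, 49 to 51 and 68 to 70 points are
-- unions of orbits of linear groups found by computer; replacing disjoint planes of the last one by
-- affine 3-flats in a new dimension, with the same directions, gives 71 to 74 points.

real₂-2 : Realised 2 2 2
real₂-2 = realise 2 1
  (repeat 2 (1 ∷ []))
  _ _

real₂-3 : Realised 2 3 1
real₂-3 = realise 2 2
  (1 ∷ 2 ∷ 3 ∷ [])
  _ _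

real₂-4 : Realised 2 4 1
real₂-4 = realise 2 3
  (1 ∷ 2 ∷ 4 ∷ 7 ∷ [])
  _ _

real₂-5 : Realised 2 5 1
real₂-5 = realise 2 4
  (1 ∷ 2 ∷ 4 ∷ 8 ∷ 15 ∷ [])
  _ _

real₄-4 : Realised 4 4 4
real₄-4 = realise 4 1
  (repeat 4 (1 ∷ []))
  _ _

real₄-6 : Realised 4 6 2
real₄-6 = realise 4 2
  (repeat 2 (1 ∷ 2 ∷ 3 ∷ []))
  _ _

-- The Fano plane. It and PG(3,2) (`real₈-15`) give simplex codes; the affine spaces `real₄-8` and
-- `real₈-16` give first-order Reed-Muller codes.
real₄-7 : Realised 4 7 1
real₄-7 = realise 4 3
  (1 ∷ 2 ∷ 3 ∷ 4 ∷ 5 ∷ 6 ∷ 7 ∷ [])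
  _ _

real₄-8 : Realised 4 8 1
real₄-8 = realise 4 4
  (8 ∷ 9 ∷ 10 ∷ 11 ∷ 12 ∷ 13 ∷ 14 ∷ 15 ∷ [])
  _ _

-- A projective frame of PG(3,2), whose code is the even-weight code of length 5, taken twice:
-- repeating all points s times multiplies divisor and multiplicity by s.
real₄-10 : Realised 4 10 2
real₄-10 = realise 4 4
  (repeat 2 (1 ∷ 2 ∷ 4 ∷ 8 ∷ 15 ∷ []))
  _ _

real₈-8 : Realised 8 8 8
real₈-8 = realise 8 1
  (repeat 8 (1 ∷ []))
  _ _

real₈-12 : Realised 8 12 4
real₈-12 = realise 8 2
  (repeat 4 (1 ∷ 2 ∷ 3 ∷ []))
  _ _

real₈-14 : Realised 8 14 2
real₈-14 = realise 8 3
  (repeat 2 (1 ∷ 2 ∷ 3 ∷ 4 ∷ 5 ∷ 6 ∷ 7 ∷ []))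
  _ _

real₈-15 : Realised 8 15 1
real₈-15 = realise 8 4
  (1 ∷ 2 ∷ 3 ∷ 4 ∷ 5 ∷ 6 ∷ 7 ∷ 8 ∷ 9 ∷ 10 ∷ 11 ∷ 12 ∷ 13 ∷ 14 ∷ 15 ∷ [])
  _ _

real₈-16 : Realised 8 16 1
real₈-16 = realise 8 5
  (16 ∷ 17 ∷ 18 ∷ 19 ∷ 20 ∷ 21 ∷ 22 ∷ 23 ∷ 24 ∷ 25 ∷ 26 ∷ 27 ∷ 28 ∷ 29 ∷ 30 ∷ 31 ∷ [])
  _ _

real₈-20 : Realised 8 20 4
real₈-20 = realise 8 4
  (repeat 4 (1 ∷ 2 ∷ 4 ∷ 8 ∷ 15 ∷ []))
  _ _

points-17 : List ℕ
points-17 =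
  5 ∷ 6 ∷ 7 ∷ 9 ∷ 10 ∷ 11 ∷ 13 ∷ 14 ∷ 15 ∷ 16 ∷ 20 ∷ 24 ∷ 28 ∷ 32 ∷ 33 ∷ 34 ∷ 35 ∷ []

real₄-17 : Realised 4 17 1
real₄-17 = realise 4 6 points-17 _ _

real₈-34 : Realised 8 34 2
real₈-34 = realise 8 6 (repeat 2 points-17) _ _

points-18 : List ℕ
points-18 =
  16 ∷ 21 ∷ 25 ∷ 26 ∷ 27 ∷ 29 ∷ 32 ∷ 35 ∷ 38 ∷ 39 ∷ 44 ∷ 46 ∷ 48 ∷ 49 ∷ 50 ∷ 52 ∷ 56 ∷ 63 ∷ []

real₄-18 : Realised 4 18 1
real₄-18 = realise 4 6 points-18 _ _

real₈-36 : Realised 8 36 2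
real₈-36 = realise 8 6 (repeat 2 points-18) _ _

points-19 : List ℕ
points-19 =
  21 ∷ 25 ∷ 26 ∷ 27 ∷ 29 ∷ 35 ∷ 38 ∷ 39 ∷ 44 ∷ 46 ∷ 49 ∷ 50 ∷ 52 ∷ 56 ∷ 63 ∷ 64 ∷ 80 ∷ 96 ∷ 112 ∷ []

real₄-19 : Realised 4 19 1
real₄-19 = realise 4 7 points-19 _ _

real₈-38 : Realised 8 38 2
real₈-38 = realise 8 7 (repeat 2 points-19) _ _

points-20 : List ℕ
points-20 =
  5 ∷ 9 ∷ 10 ∷ 11 ∷ 13 ∷ 19 ∷ 22 ∷ 23 ∷ 28 ∷ 30 ∷ 33 ∷ 34 ∷ 36 ∷ 40 ∷ 47 ∷ 48 ∷ 64 ∷ 80 ∷ 96 ∷ 112 ∷ []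

real₄-20 : Realised 4 20 1
real₄-20 = realise 4 7 points-20 _ _

real₈-40 : Realised 8 40 2
real₈-40 = realise 8 7 (repeat 2 points-20) _ _

real₈-49 : Realised 8 49 1
real₈-49 = realise 8 8
  (9 ∷ 10 ∷ 11 ∷ 16 ∷ 24 ∷ 32 ∷ 36 ∷ 40 ∷ 44 ∷ 48 ∷ 49 ∷ 50 ∷ 51 ∷ 64 ∷ 72 ∷ 84 ∷ 92 ∷ 96 ∷ 97 ∷ 98 ∷ 99 ∷ 112
  ∷ 113 ∷ 114 ∷ 115 ∷ 128 ∷ 132 ∷ 136 ∷ 140 ∷ 165 ∷ 166 ∷ 167 ∷ 173 ∷ 174 ∷ 175 ∷ 180 ∷ 188 ∷ 192 ∷ 193 ∷ 194
  ∷ 195 ∷ 224 ∷ 225 ∷ 226 ∷ 227 ∷ 228 ∷ 236 ∷ 240 ∷ 248 ∷ [])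
  _ _

real₈-50 : Realised 8 50 1
real₈-50 = realise 8 8
  (1 ∷ 2 ∷ 3 ∷ 4 ∷ 6 ∷ 7 ∷ 8 ∷ 12 ∷ 14 ∷ 15 ∷ 17 ∷ 18 ∷ 24 ∷ 27 ∷ 33 ∷ 36 ∷ 40 ∷ 45 ∷ 49 ∷ 52 ∷ 59 ∷ 62 ∷ 64 ∷
  69 ∷ 75 ∷ 78 ∷ 101 ∷ 103 ∷ 108 ∷ 110 ∷ 114 ∷ 115 ∷ 120 ∷ 121 ∷ 130 ∷ 132 ∷ 137 ∷ 143 ∷ 192 ∷ 197 ∷ 200 ∷ 205
  ∷ 226 ∷ 230 ∷ 235 ∷ 239 ∷ 242 ∷ 245 ∷ 248 ∷ 255 ∷ [])
  _ _

real₈-51 : Realised 8 51 1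
real₈-51 = realise 8 8
  (5 ∷ 9 ∷ 10 ∷ 18 ∷ 20 ∷ 21 ∷ 31 ∷ 36 ∷ 37 ∷ 39 ∷ 40 ∷ 41 ∷ 42 ∷ 57 ∷ 62 ∷ 67 ∷ 72 ∷ 74 ∷ 78 ∷ 80 ∷ 82 ∷ 83 ∷
  84 ∷ 97 ∷ 101 ∷ 114 ∷ 124 ∷ 134 ∷ 135 ∷ 144 ∷ 148 ∷ 151 ∷ 155 ∷ 156 ∷ 159 ∷ 160 ∷ 164 ∷ 166 ∷ 168 ∷ 194 ∷
  202 ∷ 217 ∷ 219 ∷ 225 ∷ 228 ∷ 233 ∷ 239 ∷ 247 ∷ 248 ∷ 249 ∷ 255 ∷ [])
  _ _

real₈-68 : Realised 8 68 1
real₈-68 = realise 8 8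
  (9 ∷ 11 ∷ 13 ∷ 15 ∷ 17 ∷ 18 ∷ 22 ∷ 26 ∷ 30 ∷ 31 ∷ 34 ∷ 36 ∷ 39 ∷ 44 ∷ 52 ∷ 55 ∷ 57 ∷ 59 ∷ 60 ∷ 62 ∷ 68 ∷ 72
  ∷ 77 ∷ 78 ∷ 88 ∷ 89 ∷ 104 ∷ 107 ∷ 110 ∷ 111 ∷ 114 ∷ 118 ∷ 119 ∷ 120 ∷ 123 ∷ 124 ∷ 136 ∷ 141 ∷ 144 ∷ 154 ∷
  156 ∷ 157 ∷ 165 ∷ 173 ∷ 176 ∷ 177 ∷ 178 ∷ 179 ∷ 181 ∷ 183 ∷ 185 ∷ 189 ∷ 199 ∷ 205 ∷ 208 ∷ 214 ∷ 220 ∷ 222 ∷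
  227 ∷ 228 ∷ 236 ∷ 237 ∷ 238 ∷ 239 ∷ 240 ∷ 246 ∷ 247 ∷ 248 ∷ [])
  _ _

real₈-69 : Realised 8 69 1
real₈-69 = realise 8 9
  (1 ∷ 2 ∷ 3 ∷ 13 ∷ 20 ∷ 26 ∷ 28 ∷ 40 ∷ 44 ∷ 51 ∷ 56 ∷ 70 ∷ 76 ∷ 80 ∷ 87 ∷ 88 ∷ 94 ∷ 97 ∷ 103 ∷ 109 ∷ 112 ∷
  134 ∷ 139 ∷ 140 ∷ 148 ∷ 152 ∷ 158 ∷ 160 ∷ 165 ∷ 169 ∷ 172 ∷ 176 ∷ 180 ∷ 187 ∷ 188 ∷ 194 ∷ 197 ∷ 201 ∷ 204 ∷
  218 ∷ 223 ∷ 224 ∷ 228 ∷ 239 ∷ 252 ∷ 257 ∷ 258 ∷ 259 ∷ 261 ∷ 266 ∷ 275 ∷ 289 ∷ 293 ∷ 310 ∷ 318 ∷ 322 ∷ 330 ∷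
  363 ∷ 374 ∷ 379 ∷ 382 ∷ 387 ∷ 403 ∷ 465 ∷ 469 ∷ 491 ∷ 497 ∷ 501 ∷ 507 ∷ [])
  _ _

real₈-70 : Realised 8 70 1
real₈-70 = realise 8 9
  (64 ∷ 65 ∷ 82 ∷ 88 ∷ 105 ∷ 108 ∷ 109 ∷ 110 ∷ 113 ∷ 124 ∷ 128 ∷ 130 ∷ 133 ∷ 159 ∷ 164 ∷ 176 ∷ 181 ∷ 187 ∷ 189
  ∷ 191 ∷ 192 ∷ 200 ∷ 206 ∷ 212 ∷ 218 ∷ 219 ∷ 226 ∷ 242 ∷ 249 ∷ 250 ∷ 256 ∷ 260 ∷ 263 ∷ 266 ∷ 269 ∷ 273 ∷ 281
  ∷ 285 ∷ 303 ∷ 318 ∷ 320 ∷ 329 ∷ 332 ∷ 342 ∷ 343 ∷ 350 ∷ 357 ∷ 359 ∷ 363 ∷ 371 ∷ 384 ∷ 387 ∷ 400 ∷ 403 ∷ 405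
  ∷ 412 ∷ 419 ∷ 424 ∷ 436 ∷ 438 ∷ 448 ∷ 454 ∷ 459 ∷ 463 ∷ 480 ∷ 481 ∷ 486 ∷ 490 ∷ 503 ∷ 504 ∷ [])
  _ _

real₈-71 : Realised 8 71 1
real₈-71 = realise 8 10
  (65 ∷ 82 ∷ 88 ∷ 105 ∷ 108 ∷ 109 ∷ 110 ∷ 113 ∷ 124 ∷ 130 ∷ 133 ∷ 159 ∷ 164 ∷ 176 ∷ 181 ∷ 187 ∷ 189 ∷ 191 ∷
  200 ∷ 206 ∷ 212 ∷ 218 ∷ 219 ∷ 226 ∷ 242 ∷ 249 ∷ 250 ∷ 260 ∷ 263 ∷ 266 ∷ 269 ∷ 273 ∷ 281 ∷ 285 ∷ 303 ∷ 318 ∷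
  329 ∷ 332 ∷ 342 ∷ 343 ∷ 350 ∷ 357 ∷ 359 ∷ 363 ∷ 371 ∷ 387 ∷ 400 ∷ 403 ∷ 405 ∷ 412 ∷ 419 ∷ 424 ∷ 436 ∷ 438 ∷
  454 ∷ 459 ∷ 463 ∷ 480 ∷ 481 ∷ 486 ∷ 490 ∷ 503 ∷ 504 ∷ 512 ∷ 576 ∷ 640 ∷ 704 ∷ 768 ∷ 832 ∷ 896 ∷ 960 ∷ [])
  _ _

real₈-72 : Realised 8 72 1
real₈-72 = realise 8 10
  (82 ∷ 88 ∷ 105 ∷ 108 ∷ 109 ∷ 110 ∷ 113 ∷ 124 ∷ 130 ∷ 133 ∷ 159 ∷ 164 ∷ 176 ∷ 181 ∷ 189 ∷ 191 ∷ 200 ∷ 206 ∷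
  212 ∷ 218 ∷ 219 ∷ 226 ∷ 242 ∷ 249 ∷ 260 ∷ 263 ∷ 266 ∷ 273 ∷ 281 ∷ 285 ∷ 303 ∷ 318 ∷ 329 ∷ 342 ∷ 343 ∷ 350 ∷
  357 ∷ 359 ∷ 363 ∷ 371 ∷ 387 ∷ 400 ∷ 403 ∷ 405 ∷ 412 ∷ 419 ∷ 424 ∷ 436 ∷ 454 ∷ 459 ∷ 463 ∷ 480 ∷ 481 ∷ 486 ∷
  490 ∷ 504 ∷ 512 ∷ 514 ∷ 576 ∷ 579 ∷ 640 ∷ 697 ∷ 704 ∷ 760 ∷ 768 ∷ 783 ∷ 832 ∷ 846 ∷ 896 ∷ 948 ∷ 960 ∷ 1013 ∷
  [])
  _ _

real₈-73 : Realised 8 73 1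
real₈-73 = realise 8 10
  (82 ∷ 105 ∷ 108 ∷ 109 ∷ 110 ∷ 113 ∷ 124 ∷ 133 ∷ 159 ∷ 164 ∷ 176 ∷ 181 ∷ 189 ∷ 191 ∷ 200 ∷ 206 ∷ 212 ∷ 219 ∷
  226 ∷ 242 ∷ 249 ∷ 260 ∷ 263 ∷ 266 ∷ 281 ∷ 285 ∷ 303 ∷ 318 ∷ 342 ∷ 343 ∷ 350 ∷ 357 ∷ 359 ∷ 363 ∷ 371 ∷ 387 ∷
  400 ∷ 405 ∷ 412 ∷ 419 ∷ 424 ∷ 436 ∷ 454 ∷ 463 ∷ 480 ∷ 481 ∷ 486 ∷ 490 ∷ 504 ∷ 512 ∷ 513 ∷ 514 ∷ 576 ∷ 579 ∷
  601 ∷ 640 ∷ 643 ∷ 697 ∷ 704 ∷ 731 ∷ 760 ∷ 768 ∷ 783 ∷ 784 ∷ 832 ∷ 840 ∷ 846 ∷ 896 ∷ 914 ∷ 948 ∷ 960 ∷ 970 ∷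
  1013 ∷ [])
  _ _

real₈-74 : Realised 8 74 1
real₈-74 = realise 8 10
  (105 ∷ 108 ∷ 109 ∷ 110 ∷ 113 ∷ 124 ∷ 133 ∷ 159 ∷ 164 ∷ 181 ∷ 189 ∷ 191 ∷ 200 ∷ 206 ∷ 212 ∷ 219 ∷ 242 ∷ 249 ∷
  263 ∷ 266 ∷ 281 ∷ 285 ∷ 303 ∷ 318 ∷ 343 ∷ 350 ∷ 357 ∷ 359 ∷ 363 ∷ 371 ∷ 387 ∷ 400 ∷ 405 ∷ 412 ∷ 419 ∷ 424 ∷
  454 ∷ 463 ∷ 480 ∷ 481 ∷ 490 ∷ 504 ∷ 512 ∷ 513 ∷ 514 ∷ 515 ∷ 576 ∷ 579 ∷ 593 ∷ 601 ∷ 640 ∷ 643 ∷ 691 ∷ 697 ∷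
  704 ∷ 731 ∷ 737 ∷ 760 ∷ 768 ∷ 775 ∷ 783 ∷ 784 ∷ 832 ∷ 840 ∷ 846 ∷ 853 ∷ 896 ∷ 914 ∷ 948 ∷ 951 ∷ 960 ∷ 970 ∷
  997 ∷ 1013 ∷ [])
  _ _

real₈-30 : Realised 8 30 1
real₈-30 = real₈-15 ⊎ᴿ real₈-15

real₈-31 : Realised 8 31 1
real₈-31 = real₈-15 ⊎ᴿ real₈-16

real₈-32 : Realised 8 32 1
real₈-32 = real₈-16 ⊎ᴿ real₈-16

∈ᵇ-sound : ∀ {m} xs → T (m ∈ᵇ xs) → m ∈ xs
∈ᵇ-sound {m} (x ∷ xs) t with m ℕ.≡ᵇ x in eq
... | true = here (ℕ.≡ᵇ⇒≡ m x (subst T (sym eq) tt))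
... | false = there (∈ᵇ-sound xs t)

-- Direct sums with copies of one block of size p preserve maximum multiplicity 1, so p consecutive
-- sizes starting at `a` yield all larger ones.
periodic : ∀ {Δ R} a p .{{_ : ℕ.NonZero p}} → Realised Δ p 1 → All (λ r → Realised Δ (a ℕ.+ r) 1) R →
  T (allBelow p (_∈ᵇ R)) → ∀ n → a ℕ.≤ n → Realised Δ n 1
periodic {Δ} {R} a p block bases ok n a≤n = subst (λ n → Realised Δ n 1) eq
    (blocks (m ℕ./ p) (All.lookup bases (∈ᵇ-sound R (allBelow-sound p (_∈ᵇ R) ok (m ℕ.% p) (ℕ.m%n<n m p)))))
  where
  m = n ℕ.∸ a
  blocks : ∀ k {n} → Realised Δ n 1 → Realised Δ (n ℕ.+ k ℕ.* p) 1
  blocks zero {n} r = subst (λ n → Realised Δ n 1) (sym (ℕ.+-identityʳ n)) r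
  blocks (suc k) {n} r = subst (λ n → Realised Δ n 1) (ℕ.+-assoc n p (k ℕ.* p)) (blocks k (r ⊎ᴿ block))
  eq : a ℕ.+ m ℕ.% p ℕ.+ m ℕ./ p ℕ.* p ≡ n
  eq = trans (ℕ.+-assoc a (m ℕ.% p) _) (trans (cong (a ℕ.+_) (sym (ℕ.m≡m%n+[m/n]*n m p))) (ℕ.m+[n∸m]≡n a≤n))

real₂-≥3 : ∀ n → 3 ℕ.≤ n → Realised 2 n 1
real₂-≥3 = periodic {R = 0 ∷ 1 ∷ 2 ∷ []} 3 3 real₂-3 (real₂-3 ∷ real₂-4 ∷ real₂-5 ∷ []) tt

real₄-≥14 : ∀ n → 14 ℕ.≤ n → Realised 4 n 1
real₄-≥14 = periodic {R = 0 ∷ 1 ∷ 2 ∷ 3 ∷ 4 ∷ 5 ∷ 6 ∷ []} 14 7 real₄-7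
  ((real₄-7 ⊎ᴿ real₄-7) ∷ (real₄-7 ⊎ᴿ real₄-8) ∷ (real₄-8 ⊎ᴿ real₄-8) ∷ real₄-17 ∷ real₄-18 ∷ real₄-19 ∷ real₄-20 ∷ []) tt

real₈-≥60 : ∀ n → 60 ℕ.≤ n → Realised 8 n 1
real₈-≥60 = periodic {R = 0 ∷ 1 ∷ 2 ∷ 3 ∷ 4 ∷ 5 ∷ 6 ∷ 7 ∷ 8 ∷ 9 ∷ 10 ∷ 11 ∷ 12 ∷ 13 ∷ 14 ∷ []} 60 15 real₈-15
  ((real₈-30 ⊎ᴿ real₈-30) ∷ (real₈-30 ⊎ᴿ real₈-31) ∷ (real₈-31 ⊎ᴿ real₈-31) ∷ (real₈-31 ⊎ᴿ real₈-32) ∷ (real₈-32 ⊎ᴿ real₈-32)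
    ∷ (real₈-16 ⊎ᴿ real₈-49) ∷ (real₈-15 ⊎ᴿ real₈-51) ∷ (real₈-16 ⊎ᴿ real₈-51) ∷ real₈-68 ∷ real₈-69 ∷ real₈-70 ∷ real₈-71
    ∷ real₈-72 ∷ real₈-73 ∷ real₈-74 ∷ []) tt

-- The sizes of maximum multiplicity 1

listed : ∀ {Δ} N {X} G → All (Ex Δ 1) X → T (allBelow N (λ m → (m ℕ.≡ᵇ 0) ∨ (m ∈ᵇ X) ∨ (m ∈ᵇ G))) →
  ∀ n → 1 ℕ.≤ n → GammaIs Δ n 1 → n ∈ G ⊎ N ℕ.≤ n
listed N {X} G ex ok n 1≤n γ = [ (λ lt → inj₁ (go n 1≤n γ (n ∈ᵇ X) refl (allBelow-sound N _ ok n lt))) , inj₂ ]′ (ℕ.<-≤-connex n N)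
  where
  go : ∀ n → 1 ℕ.≤ n → GammaIs _ n 1 → ∀ b → (n ∈ᵇ X) ≡ b → T ((n ℕ.≡ᵇ 0) ∨ b ∨ (n ∈ᵇ G)) → n ∈ G
  go (suc n) _ γ true e t = ⊥-elim (not-1 (lookupᵇ (suc n) ex (subst T (sym e) tt)) γ)
  go (suc n) _ γ false e t = ∈ᵇ-sound G t

attained : ∀ {Δ n} → 1 ℕ.≤ n → Realised Δ n 1 → GammaIs Δ n 1
attained (ℕ.s≤s _) r = gammaIs 0 r exclude-0

exclude₈-1 : All (Ex 8 1) _
exclude₈-1 = All.++⁺ (exclude₈ 1) (All.++⁺ exclude₈-below-2 (exclude₈-59 ∷
  weak₃ (exclude₈-below-4 12 _) ∷ weak₃ (exclude₈-below-4 20 _) ∷ weak₃ exclude₈-24 ∷ weak₃ exclude₈-26 ∷ weak₃ (exclude₈-below-4 27 _)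
  ∷ weak₃ (exclude₈-below-4 35 _) ∷ weak₃ exclude₈-39 ∷ weak₃ exclude₈-41
  ∷ weak₇ exclude₈-8 ∷ weak₇ exclude₈-22 ∷ weak₇ exclude₈-23 ∷ weak₇ exclude₈-37 ∷ []))
  where
  weak₃ : ∀ {n} → Ex 8 3 n → Ex 8 1 n
  weak₃ = ex-weaken (ℕ.s≤s ℕ.z≤n)
  weak₇ : ∀ {n} → Ex 8 7 n → Ex 8 1 n
  weak₇ = ex-weaken (ℕ.s≤s ℕ.z≤n)

projective₂ : ∀ n → 1 ℕ.≤ n → GammaIs 2 n 1 ⇔ 3 ℕ.≤ n
projective₂ n 1≤n = mk⇔ (λ γ → [ (λ ()) , (λ le → le) ]′ (listed 3 [] exclude₂-1 tt n 1≤n γ)) (λ le → attained 1≤n (real₂-≥3 n le))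

projective₄ : ∀ n → 1 ℕ.≤ n → GammaIs 4 n 1 ⇔ (n ∈ (7 ∷ 8 ∷ []) ⊎ 14 ℕ.≤ n)
projective₄ n 1≤n = mk⇔ (listed 14 (7 ∷ 8 ∷ []) exclude₄-below-2 tt n 1≤n)
  [ (λ i → attained 1≤n (All.lookup reals i)) , (λ le → attained 1≤n (real₄-≥14 n le)) ]′
  where
  reals : All (λ n → Realised 4 n 1) (7 ∷ 8 ∷ [])
  reals = real₄-7 ∷ real₄-8 ∷ []

projective₈ : ∀ n → 1 ℕ.≤ n → GammaIs 8 n 1 ⇔ (n ∈ (15 ∷ 16 ∷ 30 ∷ 31 ∷ 32 ∷ 45 ∷ 46 ∷ 47 ∷ 48 ∷ 49 ∷ 50 ∷ 51 ∷ []) ⊎ 60 ℕ.≤ n)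
projective₈ n 1≤n = mk⇔ (listed 60 (15 ∷ 16 ∷ 30 ∷ 31 ∷ 32 ∷ 45 ∷ 46 ∷ 47 ∷ 48 ∷ 49 ∷ 50 ∷ 51 ∷ []) exclude₈-1 tt n 1≤n)
  [ (λ i → attained 1≤n (All.lookup reals i)) , (λ le → attained 1≤n (real₈-≥60 n le)) ]′
  where
  reals : All (λ n → Realised 8 n 1) (15 ∷ 16 ∷ 30 ∷ 31 ∷ 32 ∷ 45 ∷ 46 ∷ 47 ∷ 48 ∷ 49 ∷ 50 ∷ 51 ∷ [])
  reals = real₈-15 ∷ real₈-16 ∷ real₈-30 ∷ real₈-31 ∷ real₈-32 ∷ (real₈-30 ⊎ᴿ real₈-15) ∷ (real₈-30 ⊎ᴿ real₈-16)
    ∷ (real₈-31 ⊎ᴿ real₈-16) ∷ (real₈-32 ⊎ᴿ real₈-16) ∷ real₈-49 ∷ real₈-50 ∷ real₈-51 ∷ []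

real₈-28 : Realised 8 28 2
real₈-28 = real₈-14 ⊎ᴿ real₈-14

real₈-29 : Realised 8 29 2
real₈-29 = real₈-14 ⊎ᴿ real₈-15

double₈ : All (λ n → GammaIs 8 n 2) (14 ∷ 28 ∷ 29 ∷ 34 ∷ 36 ∷ 38 ∷ 40 ∷ 42 ∷ 43 ∷ 44 ∷ 52 ∷ 53 ∷ 54 ∷ 55 ∷ 56 ∷ 57 ∷ 58 ∷ 59 ∷ [])
double₈ = All.zipWith bounded (reals , All.++⁺ exclude₈-below-2 (exclude₈-59 ∷ []))
  where
  bounded : ∀ {n} → Realised 8 n 2 × Ex 8 1 n → GammaIs 8 n 2
  bounded (r , ex) = gammaIs 1 r ex
  reals : All (λ n → Realised 8 n 2) (14 ∷ 28 ∷ 29 ∷ 34 ∷ 36 ∷ 38 ∷ 40 ∷ 42 ∷ 43 ∷ 44 ∷ 52 ∷ 53 ∷ 54 ∷ 55 ∷ 56 ∷ 57 ∷ 58 ∷ 59 ∷ [])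
  reals = real₈-14 ∷ real₈-28 ∷ real₈-29 ∷ real₈-34 ∷ real₈-36 ∷ real₈-38 ∷ real₈-40
    ∷ (real₈-14 ⊎ᴿ real₈-28) ∷ (real₈-28 ⊎ᴿ real₈-15) ∷ (real₈-14 ⊎ᴿ real₈-30)
    ∷ (real₈-14 ⊎ᴿ real₈-38) ∷ (real₈-15 ⊎ᴿ real₈-38) ∷ (real₈-16 ⊎ᴿ real₈-38) ∷ (real₈-15 ⊎ᴿ real₈-40) ∷ (real₈-16 ⊎ᴿ real₈-40)
    ∷ (real₈-28 ⊎ᴿ real₈-29) ∷ (real₈-29 ⊎ᴿ real₈-29) ∷ (real₈-29 ⊎ᴿ real₈-30) ∷ []

theorem13 : GammaInf 2 1
    × All (GammaInf 4) (1 ∷ 2 ∷ 3 ∷ 5 ∷ 9 ∷ [])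
    × All (GammaInf 8) (1 ∷ 2 ∷ 3 ∷ 4 ∷ 5 ∷ 6 ∷ 7 ∷ 9 ∷ 10 ∷ 11 ∷ 13 ∷ 17 ∷ 18 ∷ 19 ∷ 21 ∷ 25 ∷ 33 ∷ [])
    × (∀ (n : ℕ) → 1 ℕ.≤ n → GammaIs 2 n 1 ⇔ 3 ℕ.≤ n)
    × (∀ (n : ℕ) → 1 ℕ.≤ n → GammaIs 4 n 1 ⇔ (n ∈ (7 ∷ 8 ∷ []) ⊎ 14 ℕ.≤ n))
    × (∀ (n : ℕ) → 1 ℕ.≤ n → GammaIs 8 n 1 ⇔ (n ∈ (15 ∷ 16 ∷ 30 ∷ 31 ∷ 32 ∷ 45 ∷ 46 ∷ 47 ∷ 48 ∷ 49 ∷ 50 ∷ 51 ∷ []) ⊎ 60 ℕ.≤ n))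
    × GammaIs 2 2 2
    × All (λ n → GammaIs 4 n 2) (6 ∷ 10 ∷ 12 ∷ 13 ∷ [])
    × All (λ n → GammaIs 8 n 2) (14 ∷ 28 ∷ 29 ∷ 34 ∷ 36 ∷ 38 ∷ 40 ∷ 42 ∷ 43 ∷ 44 ∷ 52 ∷ 53 ∷ 54 ∷ 55 ∷ 56 ∷ 57 ∷ 58 ∷ 59 ∷ [])
    × All (λ n → GammaIs 4 n 4) (4 ∷ 11 ∷ [])
    × All (λ n → GammaIs 8 n 4) (12 ∷ 20 ∷ 24 ∷ 26 ∷ 27 ∷ 35 ∷ 39 ∷ 41 ∷ [])
    × All (λ n → GammaIs 8 n 8) (8 ∷ 22 ∷ 23 ∷ 37 ∷ [])
theorem13 =
  gammaInf (λ μ → lookupᵇ 1 (exclude₂ μ) tt) ,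
  gammaInfs _ exclude₄ ,
  gammaInfs _ exclude₈ ,
  projective₂ , projective₄ , projective₈ ,
  gammaIs 1 real₂-2 (lookupᵇ 2 exclude₂-1 tt) ,
  (gammaIs 1 real₄-6 (lookupᵇ 6 exclude₄-below-2 tt) ∷ gammaIs 1 real₄-10 (lookupᵇ 10 exclude₄-below-2 tt)
    ∷ gammaIs 1 (real₄-6 ⊎ᴿ real₄-6) (lookupᵇ 12 exclude₄-below-2 tt) ∷ gammaIs 1 (real₄-6 ⊎ᴿ real₄-7) (lookupᵇ 13 exclude₄-below-2 tt) ∷ []) ,
  double₈ ,
  (gammaIs 3 real₄-4 exclude₄-4 ∷ gammaIs 3 (real₄-4 ⊎ᴿ real₄-7) exclude₄-11 ∷ []) ,
  (gammaIs 3 real₈-12 (exclude₈-below-4 12 _) ∷ gammaIs 3 real₈-20 (exclude₈-below-4 20 _)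
    ∷ gammaIs 3 (real₈-12 ⊎ᴿ real₈-12) exclude₈-24 ∷ gammaIs 3 (real₈-12 ⊎ᴿ real₈-14) exclude₈-26
    ∷ gammaIs 3 (real₈-12 ⊎ᴿ real₈-15) (exclude₈-below-4 27 _) ∷ gammaIs 3 (real₈-20 ⊎ᴿ real₈-15) (exclude₈-below-4 35 _)
    ∷ gammaIs 3 (real₈-12 ⊎ᴿ real₈-12 ⊎ᴿ real₈-15) exclude₈-39 ∷ gammaIs 3 (real₈-12 ⊎ᴿ real₈-14 ⊎ᴿ real₈-15) exclude₈-41 ∷ []) ,
  (gammaIs 7 real₈-8 exclude₈-8 ∷ gammaIs 7 (real₈-8 ⊎ᴿ real₈-14) exclude₈-22 ∷ gammaIs 7 (real₈-8 ⊎ᴿ real₈-15) exclude₈-23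
    ∷ gammaIs 7 (real₈-8 ⊎ᴿ real₈-14 ⊎ᴿ real₈-15) exclude₈-37 ∷ [])
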